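{- Let $\chi$, $k$ be as in the context, and let the maximal congruence of $\mathbb{Z}_p^{\otimes k}[\chi]$ be the smallest ideal $\mathcal{I}\trianglelefteq\mathbb{Z}_p[\chi]$ such that $\psi(a,b)=\chi_p(a)\chi'(b)a^k$ is trivial modulo $\mathcal{I}$ for all $(a,b)\in\mathbb{Z}_p^\times\times(\mathbb{Z}/N')^\times$. Then: I. If $p>2$ and the conductor of $\chi$ is $1$ or $p$, so $\chi=\omega^a$ with $0\le a\le p-2$, the maximal congruence is $(p^{v_p(k)+1})$ if $(p-1)\mid(k+a)$ and $(1)$ otherwise. II. If $p=2$ and the conductor is $1$ or $4$, so $\chi=\omega^a$ with $a\in\{0,1\}$, the maximal congruence is $(2^{v_2(k)+2})$ if $2\mid(k+a)$ and $(2)$ otherwise. III. If $p>2$ and the conductor is $p^v>p$, then $\mathbb{Z}_p[\chi]=\mathbb{Z}_p[\zeta_{p^{v-1}}]$; writing $\chi|_{(\mathbb{Z}/p)^\times}=\omega^a$, the maximal congruence is $(1-\zeta_{p^{v-1}})$ if $(p-1)\mid(k+a)$ and $(1)$ otherwise. IV. If $p=2$ and the conductor is $2^v>4$, then $\mathbb{Z}_2[\chi]=\mathbb{Z}_2[\zeta_{2^{v-2}}]$ and the maximal congruence is $(1-\zeta_{2^{v-2}})$ for all $k$ and $a$. V. If $N'\ne1$ and $|\mathrm{im}\,\chi'|$ is not a power of $p$, the maximal congruence is $(1)$. VI. If $p>2$, $N'\neq1$ and $|\mathrm{im}\,\chi'|$ is a power $p^{v'}>1$ of $p$, then $\mathbb{Z}_p[\chi]=\mathbb{Z}_p[\zeta_{p^{\max(v-1,v')}}]$;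 writing $\chi_p|_{(\mathbb{Z}/p)^\times}=\omega^a$, the maximal congruence is $(1-\zeta_{p^{\max(v-1,v')}})$ if $(p-1)\mid(k+a)$ and $(1)$ otherwise. VII. If $p=2$, $N'\neq1$ and $\mathbb{Q}_2(\chi')$ is totally ramified over $\mathbb{Q}_2$ (so $\mathrm{im}\chi'$ is generated by $\zeta_{2^{v'}}$, $v'\ge1$), then $\mathbb{Z}_2[\chi]=\mathbb{Z}_2[\zeta_{2^{\max(v',v-2)}}]$ and the maximal congruence is $(1-\zeta_{2^{\max(v',v-2)}})$ for all $k$ and $a$.
   Context: $p$ prime; $\chi:(\mathbb{Z}/N)^\times\to\mathbb{C}_p^\times$ a primitive Dirichlet character of conductor $N=p^vN'$, $p\nmid N'$, factored uniquely as $\chi=\chi_p\chi'$ with $\chi_p,\chi'$ of conductors $p^v,N'$; $\mathbb{Z}_p[\chi]=\mathbb{Z}_p[\mathrm{im}\chi]$; $k$ an integer with $(-1)^k=\chi(-1)$. $\mathbb{Z}_p^{\otimes k}[\chi]$ is $\mathbb{Z}_p[\chi]$ with $(a,b)\in\mathbb{Z}_p^\times\times(\mathbb{Z}/N')^\times$ acting by multiplication by $a^k\chi_p(a)\chi'(b)$. $\omega$ denotes the Teichmüller character ($\omega:(\mathbb{Z}/p)^\times\to\mathbb{Z}_p^\times$ for $p>2$, $\omega:(\mathbb{Z}/4)^\times\to\mathbb{Z}_2^\times$ for $p=2$). In case IV, $a$ is defined by $\chi|_{(\mathbb{Z}/4)^\times}=\omega^a$, and in VII by $\chi_2|_{(\mathbb{Z}/4)^\times}=\omega^a$.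 $\zeta_n$ is a primitive $n$-th root of unity. -}

module Defs where

open import Level using (0ℓ) renaming (suc to lsuc)
open import Data.Nat as ℕ using (ℕ; zero; suc)
import Data.Nat.Divisibility as ℕ
import Data.Nat.Properties as ℕ
open import Data.Integer as ℤ using (ℤ; +_; -[1+_])
import Data.Integer.Properties as ℤ
import Data.Integer.Divisibility.Signed as ℤ
open import Data.Rational as ℚ using (ℚ)
open import Data.Fin using (Fin)
open import Data.Vec using (Vec; []; _∷_)
open import Data.Vec.Relation.Unary.All using (All)
open import Data.Product using (Σ; ∃; ∃-syntax; _×_; _,_; proj₁; proj₂)
open import Function using (_⇔_; Bijection)
open import Relation.Nullary using (¬_; yes; no)
open import Relation.Nullary.Construct.Add.Supremum using (_⁺; [_]; ⊤⁺)
open import Relation.Binary using (Setoid; IsEquivalence)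
open import Relation.Binary.PropositionalEquality as ≡
  using (_≡_; _≢_; refl; cong; cong₂; subst)
import Relation.Binary.Construct.On as On
import Relation.Binary.Construct.Add.Supremum.NonStrict as AddSupremum
open import Algebra.Bundles using (CommutativeRing; AbelianGroup; Semiring)
open import Algebra.Structures
open import Algebra.Morphism.Structures
  using (module RingMorphisms; module GroupMorphisms)
import Algebra.Definitions.RawMonoid as RawMonoidDefs
import Algebra.Definitions.RawSemiring as RawSemiringDefs
import Data.Integer.Tactic.RingSolver as ℤ-solver

------------------------------------------------------------------------
-- Congruences and the rings ℤ/N

infix 4 _≡_[mod_]

record _≡_[mod_] (x y : ℤ) (N : ℕ) : Set where
  constructor mod
  field divides : + N ℤ.∣ (x ℤ.- y)

≡⇒≡mod : ∀ {N x y} → x ≡ y → x ≡ y [mod N ]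
≡⇒≡mod {x = x} refl = mod (ℤ.divides (+ 0) (ℤ.+-inverseʳ x))

mod-sym : ∀ {N x y} → x ≡ y [mod N ] → y ≡ x [mod N ]
mod-sym {N} {x} {y} (mod d) = mod (subst (+ N ℤ.∣_) (lem x y) (ℤ.∣m⇒∣-m d))
  where
  lem : ∀ x y → ℤ.- (x ℤ.- y) ≡ y ℤ.- x
  lem = ℤ-solver.solve-∀

mod-trans : ∀ {N x y z} → x ≡ y [mod N ] → y ≡ z [mod N ] → x ≡ z [mod N ]
mod-trans {N} {x} {y} {z} (mod d) (mod e) =
  mod (subst (+ N ℤ.∣_) (lem x y z) (ℤ.∣m∣n⇒∣m+n d e))
  where
  lem : ∀ x y z → (x ℤ.- y) ℤ.+ (y ℤ.- z) ≡ x ℤ.- z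
  lem = ℤ-solver.solve-∀

mod-+ : ∀ {N x y u v} → x ≡ y [mod N ] → u ≡ v [mod N ] →
        (x ℤ.+ u) ≡ (y ℤ.+ v) [mod N ]
mod-+ {N} {x} {y} {u} {v} (mod d) (mod e) =
  mod (subst (+ N ℤ.∣_) (lem x y u v) (ℤ.∣m∣n⇒∣m+n d e))
  where
  lem : ∀ x y u v → (x ℤ.- y) ℤ.+ (u ℤ.- v) ≡ (x ℤ.+ u) ℤ.- (y ℤ.+ v)
  lem = ℤ-solver.solve-∀

mod-* : ∀ {N x y u v} → x ≡ y [mod N ] → u ≡ v [mod N ] →
        (x ℤ.* u) ≡ (y ℤ.* v) [mod N ]
mod-* {N} {x} {y} {u} {v} (mod d) (mod e) =
  mod (subst (+ N ℤ.∣_) (lem x y u v)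
        (ℤ.∣m∣n⇒∣m+n (ℤ.∣n⇒∣m*n u d) (ℤ.∣n⇒∣m*n y e)))
  where
  lem : ∀ x y u v →
        u ℤ.* (x ℤ.- y) ℤ.+ y ℤ.* (u ℤ.- v) ≡ (x ℤ.* u) ℤ.- (y ℤ.* v)
  lem = ℤ-solver.solve-∀

mod-neg : ∀ {N x y} → x ≡ y [mod N ] → (ℤ.- x) ≡ (ℤ.- y) [mod N ]
mod-neg {N} {x} {y} (mod d) = mod (subst (+ N ℤ.∣_) (lem x y) (ℤ.∣m⇒∣-m d))
  where
  lem : ∀ x y → ℤ.- (x ℤ.- y) ≡ (ℤ.- x) ℤ.- (ℤ.- y)
  lem = ℤ-solver.solve-∀

mod-weaken : ∀ {M N x y} → M ℕ.∣ N → x ≡ y [mod N ] → x ≡ y [mod M ]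
mod-weaken M∣N (mod d) = mod (ℤ.∣-trans (ℤ.∣ᵤ⇒∣ M∣N) d)

ℤ/_ : ℕ → CommutativeRing 0ℓ 0ℓ
ℤ/ N = record
  { Carrier = ℤ
  ; _≈_ = λ x y → x ≡ y [mod N ]
  ; _+_ = ℤ._+_
  ; _*_ = ℤ._*_
  ; -_ = ℤ.-_
  ; 0# = + 0
  ; 1# = + 1
  ; isCommutativeRing = record
    { isRing = record
      { +-isAbelianGroup = record
        { isGroup = record
          { isMonoid = record
            { isSemigroup = record
              { isMagma = record { isEquivalence = eqv ; ∙-cong = mod-+ }
              ; assoc = λ x y z → ≡⇒≡mod (ℤ.+-assoc x y z) }
            ; identity = (λ x → ≡⇒≡mod (ℤ.+-identityˡ x))
                       , (λ x → ≡⇒≡mod (ℤ.+-identityʳ x)) }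
          ; inverse = (λ x → ≡⇒≡mod (ℤ.+-inverseˡ x))
                    , (λ x → ≡⇒≡mod (ℤ.+-inverseʳ x))
          ; ⁻¹-cong = mod-neg }
        ; comm = λ x y → ≡⇒≡mod (ℤ.+-comm x y) }
      ; *-cong = mod-*
      ; *-assoc = λ x y z → ≡⇒≡mod (ℤ.*-assoc x y z)
      ; *-identity = (λ x → ≡⇒≡mod (ℤ.*-identityˡ x))
                   , (λ x → ≡⇒≡mod (ℤ.*-identityʳ x))
      ; distrib = (λ x y z → ≡⇒≡mod (ℤ.*-distribˡ-+ x y z))
                , (λ x y z → ≡⇒≡mod (ℤ.*-distribʳ-+ x y z)) }
    ; *-comm = λ x y → ≡⇒≡mod (ℤ.*-comm x y) } }
  where
  eqv : IsEquivalence (λ x y → x ≡ y [mod N ])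
  eqv = record { refl = ≡⇒≡mod refl ; sym = mod-sym ; trans = mod-trans }

------------------------------------------------------------------------
-- The ring of p-adic integers, as the inverse limit of the ℤ/pⁿ

record ℤₚ (p : ℕ) : Set where
  field
    seq      : ℕ → ℤ
    coherent : ∀ n → seq (suc n) ≡ seq n [mod p ℕ.^ n ]

open ℤₚ public

fromℤ : ∀ {p} → ℤ → ℤₚ p
fromℤ x = record { seq = λ _ → x ; coherent = λ _ → ≡⇒≡mod refl }

infix 4 _≈ₚ_

record _≈ₚ_ {p : ℕ} (x y : ℤₚ p) : Set where
  constructor eq
  field at : ∀ n → seq x n ≡ seq y n [mod p ℕ.^ n ]

ℤₚ-ring : ℕ → CommutativeRing 0ℓ 0ℓ
ℤₚ-ring p = record
  { Carrier = ℤₚ p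
  ; _≈_ = _≈ₚ_
  ; _+_ = λ x y → record
      { seq = λ n → seq x n ℤ.+ seq y n
      ; coherent = λ n → mod-+ (coherent x n) (coherent y n) }
  ; _*_ = λ x y → record
      { seq = λ n → seq x n ℤ.* seq y n
      ; coherent = λ n → mod-* (coherent x n) (coherent y n) }
  ; -_ = λ x → record
      { seq = λ n → ℤ.- seq x n
      ; coherent = λ n → mod-neg (coherent x n) }
  ; 0# = fromℤ (+ 0)
  ; 1# = fromℤ (+ 1)
  ; isCommutativeRing = record
    { isRing = record
      { +-isAbelianGroup = record
        { isGroup = record
          { isMonoid = record
            { isSemigroup = record
              { isMagma = record
                { isEquivalence = eqv
                ; ∙-cong = λ (eq d) (eq e) → eq λ n → mod-+ (d n) (e n) }
              ; assoc = λ x y z → eq λ n → ≡⇒≡mod (ℤ.+-assoc (seq x n) (seq y n) (seq z n)) }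
            ; identity = (λ x → eq λ n → ≡⇒≡mod (ℤ.+-identityˡ (seq x n)))
                       , (λ x → eq λ n → ≡⇒≡mod (ℤ.+-identityʳ (seq x n))) }
          ; inverse = (λ x → eq λ n → ≡⇒≡mod (ℤ.+-inverseˡ (seq x n)))
                    , (λ x → eq λ n → ≡⇒≡mod (ℤ.+-inverseʳ (seq x n)))
          ; ⁻¹-cong = λ (eq d) → eq λ n → mod-neg (d n) }
        ; comm = λ x y → eq λ n → ≡⇒≡mod (ℤ.+-comm (seq x n) (seq y n)) }
      ; *-cong = λ (eq d) (eq e) → eq λ n → mod-* (d n) (e n)
      ; *-assoc = λ x y z → eq λ n → ≡⇒≡mod (ℤ.*-assoc (seq x n) (seq y n) (seq z n))
      ; *-identity = (λ x → eq λ n → ≡⇒≡mod (ℤ.*-identityˡ (seq x n)))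
                   , (λ x → eq λ n → ≡⇒≡mod (ℤ.*-identityʳ (seq x n)))
      ; distrib = (λ x y z → eq λ n → ≡⇒≡mod (ℤ.*-distribˡ-+ (seq x n) (seq y n) (seq z n)))
                , (λ x y z → eq λ n → ≡⇒≡mod (ℤ.*-distribʳ-+ (seq x n) (seq y n) (seq z n))) }
    ; *-comm = λ x y → eq λ n → ≡⇒≡mod (ℤ.*-comm (seq x n) (seq y n)) } }
  where
  eqv : IsEquivalence _≈ₚ_
  eqv = record
    { refl = eq λ _ → ≡⇒≡mod refl
    ; sym = λ (eq d) → eq λ n → mod-sym (d n)
    ; trans = λ (eq d) (eq e) → eq λ n → mod-trans (d n) (e n) }

------------------------------------------------------------------------
-- Unit groups

record Unit (R : CommutativeRing 0ℓ 0ℓ) : Set where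
  open CommutativeRing R
  field
    val     : Carrier
    inv     : Carrier
    val*inv : val * inv ≈ 1#

open Unit public

infix 9 _ˣ

_ˣ : CommutativeRing 0ℓ 0ℓ → AbelianGroup 0ℓ 0ℓ
R ˣ = record
  { Carrier = Unit R
  ; _≈_ = λ u w → val u ≈ val w
  ; _∙_ = mul
  ; ε = record { val = 1# ; inv = 1# ; val*inv = *-identityˡ 1# }
  ; _⁻¹ = λ u → record
      { val = inv u ; inv = val u ; val*inv = inv*val u }
  ; isAbelianGroup = record
    { isGroup = record
      { isMonoid = record
        { isSemigroup = record
          { isMagma = record
            { isEquivalence = On.isEquivalence val isEquivalence
            ; ∙-cong = *-cong }
          ; assoc = λ u w t → *-assoc (val u) (val w) (val t) }
        ; identity = (λ u → *-identityˡ (val u)) , (λ u → *-identityʳ (val u)) }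
      ; inverse = inv*val , val*inv
      ; ⁻¹-cong = λ {u} {w} → inv-cong u w }
    ; comm = λ u w → *-comm (val u) (val w) } }
  where
  open CommutativeRing R
  open import Relation.Binary.Reasoning.Setoid setoid
  inv*val : ∀ u → inv u * val u ≈ 1#
  inv*val u = trans (*-comm (inv u) (val u)) (val*inv u)
  mul : Unit R → Unit R → Unit R
  mul u w = record
    { val = val u * val w
    ; inv = inv u * inv w
    ; val*inv = begin
        (val u * val w) * (inv u * inv w) ≈⟨ *-congʳ (*-comm (val u) (val w)) ⟩
        (val w * val u) * (inv u * inv w) ≈⟨ *-assoc _ _ _ ⟩
        val w * (val u * (inv u * inv w)) ≈⟨ *-congˡ (*-assoc _ _ _) ⟨
        val w * ((val u * inv u) * inv w) ≈⟨ *-congˡ (*-congʳ (val*inv u)) ⟩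
        val w * (1# * inv w)              ≈⟨ *-congˡ (*-identityˡ _) ⟩
        val w * inv w                     ≈⟨ val*inv w ⟩
        1#                                ∎ }
  inv-cong : ∀ u w → val u ≈ val w → inv u ≈ inv w
  inv-cong u w e = begin
    inv u                   ≈⟨ *-identityʳ _ ⟨
    inv u * 1#              ≈⟨ *-congˡ (val*inv w) ⟨
    inv u * (val w * inv w) ≈⟨ *-congˡ (*-congʳ e) ⟨
    inv u * (val u * inv w) ≈⟨ *-assoc _ _ _ ⟨
    (inv u * val u) * inv w ≈⟨ *-congʳ (inv*val u) ⟩
    1# * inv w              ≈⟨ *-identityˡ _ ⟩
    inv w                   ∎

infixr 8 _^ᵘ_

_^ᵘ_ : ∀ {R} → Unit R → ℤ → Unit R
_^ᵘ_ {R} u (+ n)    = n ·ᵘ u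
  where open RawMonoidDefs (AbelianGroup.rawMonoid (R ˣ)) using () renaming (_×_ to _·ᵘ_)
_^ᵘ_ {R} u -[1+ n ] = (suc n ·ᵘ u) ⁻¹
  where
  open AbelianGroup (R ˣ) using (_⁻¹)
  open RawMonoidDefs (AbelianGroup.rawMonoid (R ˣ)) using () renaming (_×_ to _·ᵘ_)

-1ᵘ : ∀ {R} → Unit R
-1ᵘ {R} = record { val = - 1# ; inv = - 1# ; val*inv = begin
    (- 1#) * (- 1#)   ≈⟨ -‿distribˡ-* 1# (- 1#) ⟨
    - (1# * (- 1#))   ≈⟨ -‿cong (*-identityˡ (- 1#)) ⟩
    - (- 1#)          ≈⟨ -‿involutive 1# ⟩
    1#                ∎ }
  where
  open CommutativeRing R
  open import Algebra.Properties.Ring ring using (-‿distribˡ-*; -‿involutive)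
  open import Relation.Binary.Reasoning.Setoid setoid

reduce : ∀ {M N} → M ℕ.∣ N → Unit (ℤ/ N) → Unit (ℤ/ M)
reduce M∣N u = record
  { val = val u ; inv = inv u ; val*inv = mod-weaken M∣N (val*inv u) }

reduceₚ : ∀ {p v M} → M ℕ.∣ p ℕ.^ v → Unit (ℤₚ-ring p) → Unit (ℤ/ M)
reduceₚ {v = v} M∣pᵛ u = record
  { val = seq (val u) v ; inv = seq (inv u) v
  ; val*inv = mod-weaken M∣pᵛ (_≈ₚ_.at (val*inv u) v) }

------------------------------------------------------------------------
-- The p-adic valuation on ℤ, with value ∞ at 0

-- The search for the largest e with pᵉ ∣ k may start at ∣k∣, since
-- pᵉ > e for p ≥ 2.
vₚ : ℕ → ℤ → ℕ ⁺
vₚ p k with ℤ.∣ k ∣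
... | zero  = ⊤⁺
... | suc m = [ search (suc m) ]
  where
  search : ℕ → ℕ
  search zero = zero
  search (suc e) with (p ℕ.^ suc e) ℕ.∣? suc m
  ... | yes _ = suc e
  ... | no  _ = search e

infixl 6 _+⁺_

_+⁺_ : ℕ ⁺ → ℕ → ℕ ⁺
[ m ] +⁺ n = [ m ℕ.+ n ]
⊤⁺    +⁺ n = ⊤⁺

infixr 8 _^⁺_

-- p^∞ = 0
_^⁺_ : ℕ → ℕ ⁺ → ℤ
p ^⁺ [ e ] = + (p ℕ.^ e)
p ^⁺ ⊤⁺    = + 0

------------------------------------------------------------------------
-- The Teichmüller character

teichmüllerModulus : ℕ → ℕ
teichmüllerModulus 2 = 4
teichmüllerModulus p = p

record Teichmüller (p : ℕ) : Set where
  private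
    q = teichmüllerModulus p
  field
    ω     : Unit (ℤ/ q) → Unit (ℤₚ-ring p)
    isHom : GroupMorphisms.IsGroupHomomorphism
              (AbelianGroup.rawGroup ((ℤ/ q) ˣ))
              (AbelianGroup.rawGroup (ℤₚ-ring p ˣ)) ω
    -- The component at level 2 determines an element of ℤₚ modulo p²,
    -- and q divides p².
    lifts : ∀ u → seq (val (ω u)) 2 ≡ val u [mod q ]

------------------------------------------------------------------------
-- The field ℂₚ

ℚ∞ : Set
ℚ∞ = ℚ ⁺

open AddSupremum ℚ._≤_ public using () renaming (_≤⁺_ to _≤∞_)

infixl 6 _+∞_

_+∞_ : ℚ∞ → ℚ∞ → ℚ∞
[ a ] +∞ [ b ] = [ a ℚ.+ b ]
_     +∞ _     = ⊤⁺

fromℕ∞ : ℕ → ℚ∞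
fromℕ∞ n = [ + n ℚ./ 1 ]

-- The monic polynomial c₀ + c₁ x + … + cₙ₋₁ xⁿ⁻¹ + xⁿ.
evalMonic : (R : CommutativeRing 0ℓ 0ℓ) → ∀ {n} →
            Vec (CommutativeRing.Carrier R) n →
            CommutativeRing.Carrier R → CommutativeRing.Carrier R
evalMonic R []       x = CommutativeRing.1# R
evalMonic R (c ∷ cs) x = c + x * evalMonic R cs x
  where open CommutativeRing R

-- An instance is a model of ℂₚ: an algebraically closed field containing
-- ℤₚ, complete for a valuation extending the one of ℤₚ, in which the
-- elements algebraic over ℚₚ are dense.  These properties determine ℂₚ with
-- its valuation up to isomorphism over ℤₚ.
record ℂₚ (p : ℕ) : Set₁ where
  field
    commRing : CommutativeRing 0ℓ 0ℓ

  open CommutativeRing commRing public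

  field
    1≉0       : ¬ 1# ≈ 0#
    inverse   : ∀ x → ¬ x ≈ 0# → ∃[ y ] x * y ≈ 1#

    ι         : ℤₚ p → Carrier
    ι-isHom   : RingMorphisms.IsRingHomomorphism
                (CommutativeRing.rawRing (ℤₚ-ring p)) rawRing ι

    ord       : Carrier → ℚ∞
    ord-cong  : ∀ {x y} → x ≈ y → ord x ≡ ord y
    ord-∞     : ∀ x → ord x ≡ ⊤⁺ ⇔ x ≈ 0#
    ord-*     : ∀ x y → ord (x * y) ≡ ord x +∞ ord y
    ord-+     : ∀ x y q → q ≤∞ ord x → q ≤∞ ord y → q ≤∞ ord (x + y)
    ord-ι     : ∀ z n → fromℕ∞ n ≤∞ ord (ι z) ⇔ seq z n ≡ + 0 [mod p ℕ.^ n ]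

  inℚₚ : Carrier → Set
  inℚₚ x = ∃[ n ] ∃[ z ] ι (fromℤ (+ (p ℕ.^ n))) * x ≈ ι z

  Algebraic : Carrier → Set
  Algebraic x = ∃[ n ] Σ (Vec Carrier n) λ cs →
                  All inℚₚ cs × evalMonic commRing cs x ≈ 0#

  Cauchy : (ℕ → Carrier) → Set
  Cauchy s = ∀ M → ∃[ N ] ∀ m n → N ℕ.≤ m → N ℕ.≤ n →
               fromℕ∞ M ≤∞ ord (s m - s n)

  _⟶_ : (ℕ → Carrier) → Carrier → Set
  s ⟶ x = ∀ M → ∃[ N ] ∀ n → N ℕ.≤ n → fromℕ∞ M ≤∞ ord (s n - x)

  field
    algClosed : ∀ {n} (cs : Vec Carrier (suc n)) →
                ∃[ x ] evalMonic commRing cs x ≈ 0#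
    complete  : ∀ s → Cauchy s → ∃[ x ] s ⟶ x
    dense     : ∀ x M → ∃[ y ] Algebraic y × fromℕ∞ M ≤∞ ord (x - y)

------------------------------------------------------------------------
-- Dirichlet characters

record Character {p : ℕ} (C : ℂₚ p) (N : ℕ) : Set where
  field
    ⟦_⟧   : Unit (ℤ/ N) → Unit (ℂₚ.commRing C)
    isHom : GroupMorphisms.IsGroupHomomorphism
              (AbelianGroup.rawGroup ((ℤ/ N) ˣ))
              (AbelianGroup.rawGroup (ℂₚ.commRing C ˣ)) ⟦_⟧

open Character public using (⟦_⟧)

module _ {p : ℕ} {C : ℂₚ p} where
  open ℂₚ C

  FactorsThrough : ∀ {N M} → M ℕ.∣ N → Character C N → Set
  FactorsThrough {M = M} M∣N χ =
    Σ (Character C M) λ χ₀ → ∀ u → val (⟦ χ ⟧ u) ≈ val (⟦ χ₀ ⟧ (reduce M∣N u))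

  Primitive : ∀ {N} → Character C N → Set
  Primitive {N} χ = ∀ {M} (M∣N : M ℕ.∣ N) → FactorsThrough M∣N χ → M ≡ N

  IsProduct : ∀ {M N} → Character C (M ℕ.* N) →
              Character C M → Character C N → Set
  IsProduct {M} {N} χ χ₁ χ₂ = ∀ u →
    val (⟦ χ ⟧ u) ≈
      val (⟦ χ₁ ⟧ (reduce (ℕ.m∣m*n N) u)) * val (⟦ χ₂ ⟧ (reduce (ℕ.n∣m*n M) u))

  HasParity : ∀ {N} → Character C N → ℤ → Set
  HasParity χ k = val (-1ᵘ {commRing} ^ᵘ k) ≈ val (⟦ χ ⟧ -1ᵘ)

  Im : ∀ {N} → Character C N → Carrier → Set
  Im χ x = ∃[ u ] val (⟦ χ ⟧ u) ≈ x

  -- Equality of Dirichlet characters whose moduli may differ: χ and ωᵃ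
  -- agree on all integers prime to both moduli.
  IsTeichmüllerPower : ∀ {N} → Teichmüller p → Character C N → ℕ → Set
  IsTeichmüllerPower 𝝎 χ a = ∀ u w → val u ≡ val w →
    val (⟦ χ ⟧ u) ≈ ι (val (Teichmüller.ω 𝝎 w ^ᵘ (+ a)))

  -- χ restricted to (ℤ/q)ˣ is ωᵃ, for q = p or 4 and (ℤ/q)ˣ embedded in
  -- (ℤ/N)ˣ, N a power of p, by w ↦ ω(w) mod N.
  RestrictsToTeichmüllerPower : ∀ {N} v → N ℕ.∣ p ℕ.^ v →
                                Teichmüller p → Character C N → ℕ → Set
  RestrictsToTeichmüllerPower v N∣pᵛ 𝝎 χ a = ∀ w →
    val (⟦ χ ⟧ (reduceₚ {v = v} N∣pᵛ (ω w))) ≈ ι (val (ω w ^ᵘ (+ a)))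
    where open Teichmüller 𝝎 using (ω)

------------------------------------------------------------------------
-- Subrings and ideals in ℂₚ

module _ {p : ℕ} (C : ℂₚ p) where
  open ℂₚ C
  open RawSemiringDefs (Semiring.rawSemiring semiring) using (_^_)

  HasCardinality : (Carrier → Set) → ℕ → Set
  HasCardinality S m = Bijection (≡.setoid (Fin m)) S-setoid
    where
    S-setoid : Setoid 0ℓ 0ℓ
    S-setoid = record
      { Carrier = ∃ S
      ; isEquivalence = On.isEquivalence proj₁ isEquivalence }

  -- ℤₚ[S]; negatives are products with ι (-1).
  data ℤₚ[_] (S : Carrier → Set) : Carrier → Set where
    scalar : ∀ z → ℤₚ[ S ] (ι z)
    gen    : ∀ {x} → S x → ℤₚ[ S ] x
    sum    : ∀ {x y} → ℤₚ[ S ] x → ℤₚ[ S ] y → ℤₚ[ S ] (x + y)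
    prod   : ∀ {x y} → ℤₚ[ S ] x → ℤₚ[ S ] y → ℤₚ[ S ] (x * y)
    resp   : ∀ {x y} → x ≈ y → ℤₚ[ S ] x → ℤₚ[ S ] y

  data ℚₚ⟨_⟩ (S : Carrier → Set) : Carrier → Set where
    scalar : ∀ z → ℚₚ⟨ S ⟩ (ι z)
    gen    : ∀ {x} → S x → ℚₚ⟨ S ⟩ x
    sum    : ∀ {x y} → ℚₚ⟨ S ⟩ x → ℚₚ⟨ S ⟩ y → ℚₚ⟨ S ⟩ (x + y)
    prod   : ∀ {x y} → ℚₚ⟨ S ⟩ x → ℚₚ⟨ S ⟩ y → ℚₚ⟨ S ⟩ (x * y)
    recip  : ∀ {x y} → x * y ≈ 1# → ℚₚ⟨ S ⟩ x → ℚₚ⟨ S ⟩ y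
    resp   : ∀ {x y} → x ≈ y → ℚₚ⟨ S ⟩ x → ℚₚ⟨ S ⟩ y

  infix 4 _≐_

  _≐_ : (Carrier → Set) → (Carrier → Set) → Set
  S ≐ T = ∀ x → S x ⇔ T x

  PrimitiveRoot : ℕ → Carrier → Set
  PrimitiveRoot n ζ = ζ ^ n ≈ 1# × (∀ m → 0 ℕ.< m → m ℕ.< n → ¬ ζ ^ m ≈ 1#)

  Generates : Carrier → (Carrier → Set) → Set
  Generates ζ S = ∀ x → S x ⇔ (∃[ n ] x ≈ ζ ^ n)

  -- Total ramification of ℚₚ(S) over ℚₚ: residue field extension of degree
  -- one, i.e. every integer of ℚₚ(S) is congruent to an element of ℤₚ modulo
  -- the maximal ideal.
  TotallyRamified : (Carrier → Set) → Set
  TotallyRamified S = ∀ x → ℚₚ⟨ S ⟩ x → fromℕ∞ 0 ≤∞ ord x →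
    ∃[ z ] ¬ (ord (x - ι z) ≤∞ fromℕ∞ 0)

  record IsIdeal (R I : Carrier → Set) : Set where
    field
      ⊆R      : ∀ {x} → I x → R x
      I-resp  : ∀ {x y} → x ≈ y → I x → I y
      0∈I     : I 0#
      +-closed : ∀ {x y} → I x → I y → I (x + y)
      *-closed : ∀ {r x} → R r → I x → I (r * x)

  Principal : (R : Carrier → Set) → Carrier → Carrier → Set
  Principal R α x = ∃[ r ] R r × x ≈ r * α

------------------------------------------------------------------------
-- The maximal congruence

module _ {p : ℕ} (v : ℕ) {N' : ℕ} {C : ℂₚ p} where
  open ℂₚ C

  ψ : Character C (p ℕ.^ v) → Character C N' → ℤ →
      Unit (ℤₚ-ring p) → Unit (ℤ/ N') → Carrier
  ψ χₚ χ' k a b =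
    val (⟦ χₚ ⟧ (reduceₚ {v = v} ℕ.∣-refl a)) * val (⟦ χ' ⟧ b) * ι (val (a ^ᵘ k))

  record IsMaximalCongruence (R : Carrier → Set) (χₚ : Character C (p ℕ.^ v))
                             (χ' : Character C N') (k : ℤ)
                             (I : Carrier → Set) : Set₁ where
    field
      isIdeal  : IsIdeal C R I
      trivial  : ∀ a b → I (ψ χₚ χ' k a b - 1#)
      smallest : ∀ J → IsIdeal C R J → (∀ a b → J (ψ χₚ χ' k a b - 1#)) →
                 ∀ {x} → I x → J x

conductor-prime-power : ∀ {M N} → N ≡ 1 → M ℕ.* N ℕ.∣ M
conductor-prime-power {M} refl = subst (ℕ._∣ M) (≡.sym (ℕ.*-identityʳ M)) ℕ.∣-refl

{-# OPTIONS --safe #-}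

-- Write q = p for odd p and q = 4 for p = 2.  A p-adic unit is x = ω(x) y with
-- y ≡ 1 modulo q, so ψ(x, b) = ω(x)^(k+a) · χₚ(y) χ′(b) · y^k.  If ω^(k+a) is
-- nontrivial (p odd), or if the order of χ′ is not a power of p, then some
-- value ψ - 1 is ζ - 1 for a root of unity ζ ≠ 1 of order n prime to p; it is
-- invertible because 1 - ζ divides n.  Otherwise χₚ(y) and χ′(b) are powers of
-- a root of unity ζ of p-power order.  If ζ = 1, the congruence is generated by
-- the y^k - 1, whose valuations are found by lifting the exponent.  If ζ ≠ 1,
-- every ψ - 1 lies in (1 - ζ) since p does; conversely ζ may be taken to be a
-- value of χ′, where ψ - 1 = ζ - 1, or, as χₚ is primitive, to be χₚ(1 + q),
-- where ψ - 1 = ζ c - 1 with c = (1 + q)^k.  The value at c of the cyclotomic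
-- polynomial vanishing at ζ⁻¹ is p times a unit, so p, and with it 1 - ζ, is a
-- multiple of ζ c - 1.

module Submission where

open import Defs
open import Level using (0ℓ)
open import Algebra.Bundles using (CommutativeRing; AbelianGroup)
open import Algebra.Morphism.Structures using (module GroupMorphisms; module RingMorphisms)
open import Algebra.Solver.Ring.AlmostCommutativeRing
  using (_-Raw-AlmostCommutative⟶_; fromCommutativeRing)
open import Data.Fin as Fin using (Fin; zero; suc)
open import Data.Fin.Permutation using (permutation)
import Data.Fin.Properties as Fin
open import Data.Integer as ℤ using (ℤ; +_; -[1+_])
import Data.Integer.Divisibility.Signed as ℤ
import Data.Integer.DivMod as ℤ
import Data.Integer.Properties as ℤ
import Data.Integer.Tactic.RingSolver as ℤ-solver
open import Data.Maybe using (Maybe; just; nothing)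
open import Data.Maybe.Properties using (just-injective)
open import Data.Nat as ℕ using (ℕ; zero; suc)
import Data.Nat.Coprimality as ℕ
import Data.Nat.DivMod as ℕ
import Data.Nat.Divisibility as ℕ
import Data.Nat.GCD as ℕ
import Data.Nat.Primality as ℕ
import Data.Nat.Properties as ℕ
open import Data.Product using (Σ; ∃-syntax; _×_; _,_; proj₁; proj₂)
import Data.Rational as ℚ
import Data.Rational.Properties as ℚ
open import Data.Sum using (_⊎_; inj₁; inj₂)
open import Data.Vec using (Vec; []; _∷_; lookup)
open import Function using (Bijection; Equivalence; mk⇔)
open import Relation.Binary using (tri<; tri≈; tri>)
import Relation.Binary.Construct.Add.Supremum.NonStrict as AddSupremum
open import Relation.Binary.PropositionalEquality as ≡
  using (_≡_; _≢_; refl; cong; cong₂; subst)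
open import Relation.Nullary using (¬_; Dec; yes; no; contradiction)
open import Relation.Nullary.Construct.Add.Supremum using (_⁺; [_]; ⊤⁺)
open import Relation.Nullary.Decidable using (¬?; decidable-stable)

-- Integers

-- Two constraints shape the proof. It does not rest on the units modulo p or the values of χ′ being
-- cyclic. Instead, a polynomial with n coefficients and n distinct zeros in ℂₚ vanishes; this
-- bounds roots of unity, makes each of them a power of a given primitive one, and, through
-- interpolation, makes every character modulo an odd p a power of ω. Nor is `R` known to be a
-- valuation ring. Containments of ideals are witnessed by explicit multiples, built from geometric
-- sums and their difference quotients, and only units of ℤₚ are inverted in them. The constant q
-- comes from the sum 1 + z + ... + z^(p-1) at z = 1 + qt, which has to be p times an element of 1 +
-- pℤₚ. Its linear term is qt·p(p-1)/2, so q = p works when (p-1)/2 is an integer; for p = 2 the sum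
-- is 2 + qt, which asks for q = 4. At p = 2, total ramification is used through residues: for odd
-- n, 1 + z + ... + z^(n-1) is a unit at every z in ℤ₂, so no n-th root of unity other than 1 is
-- congruent to an element of ℤ₂.

n<p^n : ∀ {p} → 1 ℕ.< p → ∀ n → n ℕ.< p ℕ.^ n
n<p^n 1<p zero = ℕ.s≤s ℕ.z≤n
n<p^n {p} 1<p (suc n) = begin-strict
  suc n               <⟨ ℕ.s≤s (n<p^n 1<p n) ⟩
  suc (p ℕ.^ n)       ≤⟨ ℕ.+-monoˡ-≤ (p ℕ.^ n) (ℕ.≤-trans (ℕ.s≤s ℕ.z≤n) (n<p^n 1<p n)) ⟩
  p ℕ.^ n ℕ.+ p ℕ.^ n ≡⟨ cong (p ℕ.^ n ℕ.+_) (ℕ.+-identityʳ _) ⟨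
  2 ℕ.* p ℕ.^ n       ≤⟨ ℕ.*-monoˡ-≤ (p ℕ.^ n) 1<p ⟩
  p ℕ.^ suc n  ∎
  where open ℕ.≤-Reasoning

-- The search inside vₚ is a local function.  Two unfoldings and an
-- abstraction bring it to distinct variables, where unification finds it.
mutual
  search : ℕ → ℤ → ℕ → ℕ → ℕ
  search = _

  search-unifies : ∀ p k m → ℤ.∣ k ∣ ≡ suc (suc m) →
                   ¬ (p ℕ.^ suc (suc m) ℕ.∣ suc (suc m)) →
                   ¬ (p ℕ.^ suc m ℕ.∣ suc (suc m)) →
                   vₚ p k ≡ [ search p k (suc m) m ]
  search-unifies p k m e a b with ℤ.∣ k ∣ | e
  ... | .(suc (suc m)) | refl with (p ℕ.^ suc (suc m)) ℕ.∣? suc (suc m)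
  ... | yes q = contradiction q a
  ... | no _ with (p ℕ.^ suc m) ℕ.∣? suc (suc m)
  ... | yes q = contradiction q b
  ... | no _ with suc m
  ... | w = refl

vₚ≡search : ∀ p k m → ℤ.∣ k ∣ ≡ suc m → vₚ p k ≡ [ search p k m (suc m) ]
vₚ≡search p k m e with ℤ.∣ k ∣ | e
... | .(suc m) | refl = refl

search-∣ : ∀ p k m e → p ℕ.^ search p k m e ℕ.∣ suc m
search-∣ p k m zero = ℕ.1∣ suc m
search-∣ p k m (suc e) with (p ℕ.^ suc e) ℕ.∣? suc m
... | yes d = d
... | no _  = search-∣ p k m e

search-max : ∀ p k m e j → j ℕ.≤ e → p ℕ.^ j ℕ.∣ suc m → j ℕ.≤ search p k m e
search-max p k m zero j j≤e d = j≤e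
search-max p k m (suc e) j j≤e d with (p ℕ.^ suc e) ℕ.∣? suc m
... | yes _ = j≤e
... | no nd with ℕ.m≤n⇒m<n∨m≡n j≤e
...   | inj₁ j<e  = search-max p k m e j (ℕ.≤-pred j<e) d
...   | inj₂ refl = contradiction d nd

-- If p still divided m, then p^(e+1) would divide ∣k∣. Since e + 1 < p^(e+1) ≤ ∣k∣, the search
-- descending from ∣k∣ would have met e + 1 before e.
vₚ-factor : ∀ {p} → 1 ℕ.< p → ∀ k → ℤ.∣ k ∣ ≢ 0 →
            ∃[ e ] ∃[ m ] vₚ p k ≡ [ e ] × ℤ.∣ k ∣ ≡ p ℕ.^ e ℕ.* m × ¬ p ℕ.∣ m
vₚ-factor {p} 1<p k k≢0 = go ℤ.∣ k ∣ refl
  where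
  go : ∀ n → ℤ.∣ k ∣ ≡ n →
       ∃[ e ] ∃[ m ] vₚ p k ≡ [ e ] × ℤ.∣ k ∣ ≡ p ℕ.^ e ℕ.* m × ¬ p ℕ.∣ m
  go zero k≡ = contradiction k≡ k≢0
  go (suc n) k≡ with search-∣ p k n (suc n)
  ... | ℕ.divides m m≡ =
    e , m , vₚ≡search p k n k≡ , ≡.trans k≡ (≡.trans m≡ (ℕ.*-comm m _)) , p∤m
    where
    e = search p k n (suc n)
    p∤m : ¬ p ℕ.∣ m
    p∤m p∣m = ℕ.<-irrefl refl (search-max p k n (suc n) (suc e) e<n pᵉ⁺¹∣n)
      where
      pᵉ⁺¹∣n : p ℕ.^ suc e ℕ.∣ suc n
      pᵉ⁺¹∣n = subst (p ℕ.^ suc e ℕ.∣_) (≡.sym m≡) (ℕ.*-monoˡ-∣ (p ℕ.^ e) p∣m)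
      e<n = ℕ.<⇒≤ (ℕ.<-≤-trans (n<p^n 1<p (suc e)) (ℕ.∣⇒≤ pᵉ⁺¹∣n))

p-part : ∀ {p} → 1 ℕ.< p → ∀ n → n ≢ 0 →
         ∃[ e ] ∃[ m ] n ≡ p ℕ.^ e ℕ.* m × ¬ p ℕ.∣ m
p-part 1<p n n≢0 with vₚ-factor 1<p (+ n) n≢0
... | e , m , _ , n≡ , p∤m = e , m , n≡ , p∤m

prime>1 : ∀ {p} → ℕ.Prime p → 1 ℕ.< p
prime>1 {p} pr = ℕ.nonTrivial⇒n>1 p {{ℕ.prime⇒nonTrivial pr}}

prime∤⇒coprime : ∀ {p m} → ℕ.Prime p → ¬ p ℕ.∣ m → ℕ.Coprime p m
prime∤⇒coprime pr p∤m (d∣p , d∣m) with ℕ.prime⇒irreducible pr d∣p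
... | inj₁ d≡1  = d≡1
... | inj₂ refl = contradiction d∣m p∤m

coprime-^ : ∀ {p m} → ℕ.Coprime p m → ∀ j → ℕ.Coprime (p ℕ.^ j) m
coprime-^ c zero (d∣1 , _) = ℕ.∣1⇒≡1 d∣1
coprime-^ {p} c (suc j) {d} (d∣ , d∣m) =
  coprime-^ c j (ℕ.coprime-divisor {n = p} coprime-d-p d∣ , d∣m)
  where
  coprime-d-p : ℕ.Coprime d p
  coprime-d-p (e∣d , e∣p) = c (e∣p , ℕ.∣-trans e∣d d∣m)

bézout : ∀ {m n} → ℕ.Coprime m n → ∃[ x ] ∃[ y ] x ℤ.* + m ℤ.+ y ℤ.* + n ≡ + 1
bézout {m} {n} c with ℕ.coprime-Bézout c
... | ℕ.Bézout.+- x y e = + x , ℤ.- (+ y) , (begin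
    + x ℤ.* + m ℤ.+ ℤ.- (+ y) ℤ.* + n  ≡⟨ cong (ℤ._+ ℤ.- (+ y) ℤ.* + n) xm ⟩
    (+ 1 ℤ.+ + y ℤ.* + n) ℤ.+ ℤ.- (+ y) ℤ.* + n ≡⟨ lem (+ y) (+ n) ⟩
    + 1  ∎)
  where
  open ≡.≡-Reasoning
  xm : + x ℤ.* + m ≡ + 1 ℤ.+ + y ℤ.* + n
  xm = ≡.trans (≡.sym (ℤ.pos-* x m)) (≡.trans (cong +_ (≡.sym e))
         (cong (λ t → + 1 ℤ.+ t) (ℤ.pos-* y n)))
  lem : ∀ y n → (+ 1 ℤ.+ y ℤ.* n) ℤ.+ ℤ.- y ℤ.* n ≡ + 1
  lem = ℤ-solver.solve-∀
... | ℕ.Bézout.-+ x y e = ℤ.- (+ x) , + y , (begin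
    ℤ.- (+ x) ℤ.* + m ℤ.+ + y ℤ.* + n  ≡⟨ cong (λ t → ℤ.- (+ x) ℤ.* + m ℤ.+ t) yn ⟩
    ℤ.- (+ x) ℤ.* + m ℤ.+ (+ 1 ℤ.+ + x ℤ.* + m) ≡⟨ lem (+ x) (+ m) ⟩
    + 1  ∎)
  where
  open ≡.≡-Reasoning
  yn : + y ℤ.* + n ≡ + 1 ℤ.+ + x ℤ.* + m
  yn = ≡.trans (≡.sym (ℤ.pos-* y n)) (≡.trans (cong +_ (≡.sym e))
         (cong (λ t → + 1 ℤ.+ t) (ℤ.pos-* x m)))
  lem : ∀ x m → ℤ.- x ℤ.* m ℤ.+ (+ 1 ℤ.+ x ℤ.* m) ≡ + 1
  lem = ℤ-solver.solve-∀

inverse-mod : ∀ {m n} → ℕ.Coprime m n → ∃[ y ] + m ℤ.* y ≡ + 1 [mod n ]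
inverse-mod {m} {n} c with bézout c
... | x , y , e = x , mod (ℤ.divides (ℤ.- y) (≡.trans (lem (+ m) (+ n) x y)
    (≡.trans (cong (λ z → z ℤ.- + 1 ℤ.+ ℤ.- y ℤ.* + n) e) (ℤ.+-identityˡ _))))
  where
  lem : ∀ m n x y → m ℤ.* x ℤ.- + 1 ≡ (x ℤ.* m ℤ.+ y ℤ.* n) ℤ.- + 1 ℤ.+ ℤ.- y ℤ.* n
  lem = ℤ-solver.solve-∀

mod-refl : ∀ {N x} → x ≡ x [mod N ]
mod-refl = ≡⇒≡mod refl

mod-1 : ∀ {x y} → x ≡ y [mod 1 ]
mod-1 {x} {y} = mod (ℤ.divides (x ℤ.- y) (≡.sym (ℤ.*-identityʳ _)))

mod-^ : ∀ {N x y} → x ≡ y [mod N ] → ∀ n → (x ℤ.^ n) ≡ (y ℤ.^ n) [mod N ]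
mod-^ x≡y zero    = mod-refl
mod-^ x≡y (suc n) = mod-* x≡y (mod-^ x≡y n)

pos-^ : ∀ p n → + (p ℕ.^ n) ≡ (+ p) ℤ.^ n
pos-^ p zero    = refl
pos-^ p (suc n) = ≡.trans (ℤ.pos-* p (p ℕ.^ n)) (cong ((+ p) ℤ.*_) (pos-^ p n))

^-distrib : ∀ x y n → (x ℤ.* y) ℤ.^ n ≡ x ℤ.^ n ℤ.* y ℤ.^ n
^-distrib x y zero    = refl
^-distrib x y (suc n) = ≡.trans (cong (x ℤ.* y ℤ.*_) (^-distrib x y n))
  (lem x y (x ℤ.^ n) (y ℤ.^ n))
  where
  lem : ∀ x y a b → (x ℤ.* y) ℤ.* (a ℤ.* b) ≡ (x ℤ.* a) ℤ.* (y ℤ.* b)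
  lem = ℤ-solver.solve-∀

^-mod-0 : ∀ {p z} → z ≡ + 0 [mod p ] → ∀ n → z ℤ.^ n ≡ + 0 [mod p ℕ.^ n ]
^-mod-0 {p} {z} (mod (ℤ.divides q e)) n = mod (ℤ.divides (q ℤ.^ n) (begin
  z ℤ.^ n ℤ.- + 0  ≡⟨ ℤ.+-identityʳ _ ⟩
  z ℤ.^ n  ≡⟨ cong (ℤ._^ n) (≡.trans (≡.sym (ℤ.+-identityʳ z)) e) ⟩
  (q ℤ.* + p) ℤ.^ n  ≡⟨ ^-distrib q (+ p) n ⟩
  q ℤ.^ n ℤ.* (+ p) ℤ.^ n   ≡⟨ cong (q ℤ.^ n ℤ.*_) (pos-^ p n) ⟨
  q ℤ.^ n ℤ.* + (p ℕ.^ n)   ∎))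
  where
  open ≡.≡-Reasoning

-- Geometric sums and triangular numbers over ℤ.

geoℤ : ℕ → ℤ → ℤ
geoℤ zero    z = + 0
geoℤ (suc n) z = + 1 ℤ.+ z ℤ.* geoℤ n z

geoℤ-telescope : ∀ n z → (+ 1 ℤ.- z) ℤ.* geoℤ n z ≡ + 1 ℤ.- z ℤ.^ n
geoℤ-telescope zero    z = ℤ.*-zeroʳ (+ 1 ℤ.- z)
geoℤ-telescope (suc n) z =
  ≡.trans (lem₁ z (geoℤ n z))
    (≡.trans (cong (λ y → + 1 ℤ.- z ℤ.+ z ℤ.* y) (geoℤ-telescope n z)) (lem₂ z (z ℤ.^ n)))
  where
  lem₁ : ∀ z g → (+ 1 ℤ.- z) ℤ.* (+ 1 ℤ.+ z ℤ.* g) ≡ + 1 ℤ.- z ℤ.+ z ℤ.* ((+ 1 ℤ.- z) ℤ.* g)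
  lem₁ = ℤ-solver.solve-∀
  lem₂ : ∀ z y → + 1 ℤ.- z ℤ.+ z ℤ.* (+ 1 ℤ.- y) ≡ + 1 ℤ.- z ℤ.* y
  lem₂ = ℤ-solver.solve-∀

geoℤ-snoc : ∀ n z → geoℤ (suc n) z ≡ geoℤ n z ℤ.+ z ℤ.^ n
geoℤ-snoc zero    z = cong (λ t → + 1 ℤ.+ t) (ℤ.*-zeroʳ z)
geoℤ-snoc (suc n) z =
  ≡.trans (cong (λ g → + 1 ℤ.+ z ℤ.* g) (geoℤ-snoc n z)) (lem z (geoℤ n z) (z ℤ.^ n))
  where
  lem : ∀ z g y → + 1 ℤ.+ z ℤ.* (g ℤ.+ y) ≡ + 1 ℤ.+ z ℤ.* g ℤ.+ z ℤ.* y
  lem = ℤ-solver.solve-∀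

geoℤ-cong : ∀ {N y z} n → y ≡ z [mod N ] → geoℤ n y ≡ geoℤ n z [mod N ]
geoℤ-cong zero    y≡z = mod-refl
geoℤ-cong (suc n) y≡z = mod-+ (mod-refl {x = + 1}) (mod-* y≡z (geoℤ-cong n y≡z))

-- n(n-1)/2 without a division: the linear coefficient of 1 + (1 + x) + ... + (1 + x)^(n-1) as a
-- polynomial in x.
triangle : ℕ → ℤ
triangle zero    = + 0
triangle (suc n) = triangle n ℤ.+ + n

2*triangle : ∀ n → + 2 ℤ.* triangle n ≡ + n ℤ.* (+ n ℤ.- + 1)
2*triangle zero    = refl
2*triangle (suc n) = ≡.trans (lem₁ (triangle n) (+ n))
    (≡.trans (cong (ℤ._+ + 2 ℤ.* + n) (2*triangle n)) (lem₂ (+ n)))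
  where
  lem₁ : ∀ t n → + 2 ℤ.* (t ℤ.+ n) ≡ + 2 ℤ.* t ℤ.+ + 2 ℤ.* n
  lem₁ = ℤ-solver.solve-∀
  lem₂ : ∀ n → n ℤ.* (n ℤ.- + 1) ℤ.+ + 2 ℤ.* n ≡ (+ 1 ℤ.+ n) ℤ.* ((+ 1 ℤ.+ n) ℤ.- + 1)
  lem₂ = ℤ-solver.solve-∀

-- Powers of units

geo : (R : CommutativeRing 0ℓ 0ℓ) → ℕ → CommutativeRing.Carrier R → CommutativeRing.Carrier R
geo R zero    z = CommutativeRing.0# R
geo R (suc n) z = 1# + z * geo R n z
  where open CommutativeRing R

module UnitPowers (R : CommutativeRing 0ℓ 0ℓ) where
  open AbelianGroup (R ˣ) renaming (refl to ≈-refl)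
  open import Algebra.Definitions.RawMonoid rawMonoid using () renaming (_×_ to _·_)
  open import Algebra.Properties.Monoid.Mult monoid using (×-congʳ; ×-homo-+)
  open import Algebra.Properties.CommutativeMonoid.Mult commutativeMonoid using (×-distrib-+)
  open import Algebra.Properties.Group group using (ε⁻¹≈ε; inverseʳ-unique; ⁻¹-involutive)
  open import Algebra.Properties.AbelianGroup (R ˣ) using (⁻¹-∙-comm)
  open import Relation.Binary.Reasoning.Setoid setoid
  open import Algebra.Properties.Semiring.Exp (CommutativeRing.semiring R) using (_^_)

  val-^ᵘ : ∀ (u : Unit R) n → val (u ^ᵘ (+ n)) ≡ val u ^ n
  val-^ᵘ u zero    = refl
  val-^ᵘ u (suc n) = cong (CommutativeRing._*_ R (val u)) (val-^ᵘ u n)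

  ^ᵘ-cong : ∀ {u w} k → u ≈ w → u ^ᵘ k ≈ w ^ᵘ k
  ^ᵘ-cong (+ n)    u≈w = ×-congʳ n u≈w
  ^ᵘ-cong {u} {w} -[1+ n ] u≈w = ⁻¹-cong {suc n · u} {suc n · w} (×-congʳ (suc n) u≈w)

  ^ᵘ-distrib-∙ : ∀ u w k → (u ∙ w) ^ᵘ k ≈ u ^ᵘ k ∙ w ^ᵘ k
  ^ᵘ-distrib-∙ u w (+ n)    = ×-distrib-+ u w n
  ^ᵘ-distrib-∙ u w -[1+ n ] = begin
    (suc n · (u ∙ w)) ⁻¹  ≈⟨ ⁻¹-cong {suc n · (u ∙ w)} {suc n · u ∙ suc n · w}
        (×-distrib-+ u w (suc n)) ⟩
    (suc n · u ∙ suc n · w) ⁻¹   ≈⟨ ⁻¹-∙-comm (suc n · u) (suc n · w) ⟨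
    (suc n · u) ⁻¹ ∙ (suc n · w) ⁻¹ ∎

  ^ᵘ-neg : ∀ u k → u ^ᵘ (ℤ.- k) ≈ (u ^ᵘ k) ⁻¹
  ^ᵘ-neg u (+ zero)   = sym {ε ⁻¹} {ε} ε⁻¹≈ε
  ^ᵘ-neg u (+ suc n)  = ≈-refl {(suc n · u) ⁻¹}
  ^ᵘ-neg u -[1+ n ]   = sym {((suc n · u) ⁻¹) ⁻¹} {suc n · u} (⁻¹-involutive (suc n · u))

  ^ᵘ-suc : ∀ u k → u ^ᵘ (+ 1 ℤ.+ k) ≈ u ∙ u ^ᵘ k
  ^ᵘ-suc u (+ n)        = ≈-refl {suc n · u}
  ^ᵘ-suc u -[1+ zero ]  = begin
    ε  ≈⟨ inverseʳ u ⟨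
    u ∙ u ⁻¹  ≈⟨ ∙-congˡ {u} {u ⁻¹} {(u ∙ ε) ⁻¹}
        (⁻¹-cong {u} {u ∙ ε} (sym {u ∙ ε} {u} (identityʳ u))) ⟩
    u ∙ (u ∙ ε) ⁻¹  ∎
  ^ᵘ-suc u -[1+ suc n ] = begin
    w ⁻¹  ≈⟨ identityˡ (w ⁻¹) ⟨
    ε ∙ w ⁻¹  ≈⟨ ∙-congʳ {w ⁻¹} {u ∙ u ⁻¹} {ε} (inverseʳ u) ⟨
    (u ∙ u ⁻¹) ∙ w ⁻¹    ≈⟨ assoc u (u ⁻¹) (w ⁻¹) ⟩
    u ∙ (u ⁻¹ ∙ w ⁻¹)    ≈⟨ ∙-congˡ {u} {u ⁻¹ ∙ w ⁻¹} {(u ∙ w) ⁻¹} (⁻¹-∙-comm u w) ⟩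
    u ∙ (u ∙ w) ⁻¹  ∎
    where w = suc n · u

  ^ᵘ-+⁺ : ∀ u n k → u ^ᵘ (+ n ℤ.+ k) ≈ n · u ∙ u ^ᵘ k
  ^ᵘ-+⁺ u zero k = begin
    u ^ᵘ (+ 0 ℤ.+ k)  ≡⟨ cong (u ^ᵘ_) (ℤ.+-identityˡ k) ⟩
    u ^ᵘ k  ≈⟨ identityˡ (u ^ᵘ k) ⟨
    ε ∙ u ^ᵘ k  ∎
  ^ᵘ-+⁺ u (suc n) k = begin
    u ^ᵘ (+ suc n ℤ.+ k)  ≡⟨ cong (u ^ᵘ_) (ℤ.+-assoc (+ 1) (+ n) k) ⟩
    u ^ᵘ (+ 1 ℤ.+ (+ n ℤ.+ k))   ≈⟨ ^ᵘ-suc u (+ n ℤ.+ k) ⟩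
    u ∙ u ^ᵘ (+ n ℤ.+ k)  ≈⟨ ∙-congˡ {u} {u ^ᵘ (+ n ℤ.+ k)} {n · u ∙ u ^ᵘ k} (^ᵘ-+⁺ u n k) ⟩
    u ∙ (n · u ∙ u ^ᵘ k)  ≈⟨ assoc u (n · u) (u ^ᵘ k) ⟨
    (u ∙ n · u) ∙ u ^ᵘ k  ∎
  -- For negative j, the trivial factor `a ⁻¹ ∙ a` is inserted and `a` absorbed by `^ᵘ-+⁺`, which
  -- leaves only nonnegative first exponents to treat by induction.
  ^ᵘ-+ : ∀ u j k → u ^ᵘ (j ℤ.+ k) ≈ u ^ᵘ j ∙ u ^ᵘ k
  ^ᵘ-+ u (+ n)    k = ^ᵘ-+⁺ u n k
  ^ᵘ-+ u -[1+ n ] k = begin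
    b  ≈⟨ identityˡ b ⟨
    ε ∙ b  ≈⟨ ∙-congʳ {b} {a ⁻¹ ∙ a} {ε} (inverseˡ a) ⟨
    (a ⁻¹ ∙ a) ∙ b  ≈⟨ assoc (a ⁻¹) a b ⟩
    a ⁻¹ ∙ (a ∙ b)  ≈⟨ ∙-congˡ {a ⁻¹} {u ^ᵘ (+ suc n ℤ.+ (-[1+ n ] ℤ.+ k))} {a ∙ b}
        (^ᵘ-+⁺ u (suc n) (-[1+ n ] ℤ.+ k)) ⟨
    a ⁻¹ ∙ u ^ᵘ (+ suc n ℤ.+ (-[1+ n ] ℤ.+ k)) ≡⟨ cong (λ j → a ⁻¹ ∙ u ^ᵘ j) k≡ ⟩
    a ⁻¹ ∙ u ^ᵘ k  ∎
    where
    a = suc n · u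
    b = u ^ᵘ (-[1+ n ] ℤ.+ k)
    k≡ : + suc n ℤ.+ (-[1+ n ] ℤ.+ k) ≡ k
    k≡ = ≡.trans (≡.sym (ℤ.+-assoc (+ suc n) -[1+ n ] k))
           (≡.trans (cong (ℤ._+ k) (ℤ.+-inverseʳ (+ suc n))) (ℤ.+-identityˡ k))

  ^ᵘ-multiple : ∀ u n → u ^ᵘ (+ n) ≈ ε → ∀ c → u ^ᵘ (c ℤ.* + n) ≈ ε
  ^ᵘ-multiple u n uⁿ≈ε (+ c) = begin
    u ^ᵘ (+ c ℤ.* + n) ≡⟨ cong (u ^ᵘ_) (ℤ.pos-* c n) ⟨
    (c ℕ.* n) · u      ≈⟨ go c ⟩
    ε  ∎
    where
    go : ∀ c → (c ℕ.* n) · u ≈ ε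
    go zero    = ≈-refl {ε}
    go (suc c) = begin
      (n ℕ.+ c ℕ.* n) · u    ≈⟨ ×-homo-+ u n (c ℕ.* n) ⟩
      n · u ∙ (c ℕ.* n) · u  ≈⟨ ∙-cong {n · u} {ε} {(c ℕ.* n) · u} {ε} uⁿ≈ε (go c) ⟩
      ε ∙ ε  ≈⟨ identityˡ ε ⟩
      ε  ∎
  ^ᵘ-multiple u n uⁿ≈ε -[1+ c ] = begin
    u ^ᵘ (-[1+ c ] ℤ.* + n)  ≡⟨ cong (u ^ᵘ_) (ℤ.neg-distribˡ-* (+ suc c) (+ n)) ⟨
    u ^ᵘ (ℤ.- (+ suc c ℤ.* + n))   ≈⟨ ^ᵘ-neg u (+ suc c ℤ.* + n) ⟩
    (u ^ᵘ (+ suc c ℤ.* + n)) ⁻¹    ≈⟨ ⁻¹-cong {u ^ᵘ (+ suc c ℤ.* + n)} {ε}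
        (^ᵘ-multiple u n uⁿ≈ε (+ suc c)) ⟩
    ε ⁻¹  ≈⟨ ε⁻¹≈ε ⟩
    ε  ∎

  ^ᵘ-ε : ∀ u k → u ≈ ε → u ^ᵘ k ≈ ε
  ^ᵘ-ε u k u≈ε = begin
    u ^ᵘ k  ≡⟨ cong (u ^ᵘ_) (ℤ.*-identityʳ k) ⟨
    u ^ᵘ (k ℤ.* + 1)   ≈⟨ ^ᵘ-multiple u 1 (AbelianGroup.trans (R ˣ) {u ∙ ε} {u} {ε} (identityʳ u) u≈ε) k ⟩
    ε  ∎

module UnitMap (R S : CommutativeRing 0ℓ 0ℓ)
  (f : CommutativeRing.Carrier R → CommutativeRing.Carrier S)
  (f-isHom : RingMorphisms.IsRingHomomorphism (CommutativeRing.rawRing R) (CommutativeRing.rawRing S) f)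
  where
  open CommutativeRing S using (_≈_; trans; sym; *-congˡ)
  open RingMorphisms.IsRingHomomorphism f-isHom
  open import Algebra.Definitions.RawMonoid (AbelianGroup.rawMonoid (R ˣ)) using () renaming (_×_ to _·_)
  open import Algebra.Definitions.RawMonoid (AbelianGroup.rawMonoid (S ˣ)) using () renaming (_×_ to _·′_)

  mapᵘ : Unit R → Unit S
  mapᵘ u = record { val = f (val u) ; inv = f (inv u)
                  ; val*inv = trans (sym (*-homo (val u) (inv u))) (trans (⟦⟧-cong (val*inv u)) 1#-homo) }

  map-val-· : ∀ u n → f (val (n · u)) ≈ val (n ·′ mapᵘ u)
  map-val-· u zero    = 1#-homo
  map-val-· u (suc n) = trans (*-homo (val u) (val (n · u))) (*-congˡ (map-val-· u n))

  -- A negative power is the inverse of a positive one, so its value is the `inv` component;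
  -- `map-^ᵘ` therefore needs both components.
  map-inv-· : ∀ u n → f (inv (n · u)) ≈ inv (n ·′ mapᵘ u)
  map-inv-· u zero    = 1#-homo
  map-inv-· u (suc n) = trans (*-homo (inv u) (inv (n · u))) (*-congˡ (map-inv-· u n))

  map-^ᵘ : ∀ u k → f (val (u ^ᵘ k)) ≈ val (mapᵘ u ^ᵘ k)
  map-^ᵘ u (+ n)    = map-val-· u n
  map-^ᵘ u -[1+ n ] = map-inv-· u (suc n)

unit-quotient : ∀ (R : CommutativeRing 0ℓ 0ℓ) (x w : Unit R) → let open CommutativeRing R in
  ∃[ y ] (val {R} y ≈ val x * inv w × val x ≈ val w * val y)
unit-quotient R x w = x ∙ (w ⁻¹) , refl-R , (begin
    val x  ≈⟨ *-identityʳ _ ⟨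
    val x * 1#  ≈⟨ *-congˡ (val*inv w) ⟨
    val x * (val w * inv w)   ≈⟨ *-assoc _ _ _ ⟨
    val x * val w * inv w     ≈⟨ *-congʳ (*-comm _ _) ⟩
    val w * val x * inv w     ≈⟨ *-assoc _ _ _ ⟩
    val w * (val x * inv w)   ∎)
  where
  open AbelianGroup (R ˣ) using (_∙_; _⁻¹)
  open CommutativeRing R renaming (refl to refl-R)
  open import Relation.Binary.Reasoning.Setoid setoid

module UnitHomomorphism (R S : CommutativeRing 0ℓ 0ℓ) (f : Unit R → Unit S)
  (f-isHom : GroupMorphisms.IsGroupHomomorphism
    (AbelianGroup.rawGroup (R ˣ)) (AbelianGroup.rawGroup (S ˣ)) f) where
  private
    module R = CommutativeRing R
    module S = CommutativeRing S
  open GroupMorphisms.IsGroupHomomorphism f-isHom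

  val-cong : ∀ u w → val u R.≈ val w → val (f u) S.≈ val (f w)
  val-cong u w e = ⟦⟧-cong {u} {w} e

  val-∙ : ∀ u w t → val t R.≈ val u R.* val w → val (f t) S.≈ val (f u) S.* val (f w)
  val-∙ u w t e = S.trans (val-cong t (AbelianGroup._∙_ (R ˣ) u w) e) (homo u w)

-- p-adic integers

module Padic (p : ℕ) where

  -- With the ring explicit: unification would η-expand it.
  valₚ invₚ : Unit (ℤₚ-ring p) → ℤₚ p
  valₚ u = val {ℤₚ-ring p} u
  invₚ u = inv {ℤₚ-ring p} u

  abstract
    affine : ℤ → ℤ → ℤₚ p → ℤₚ p
    affine a b t = CommutativeRing._+_ (ℤₚ-ring p) (fromℤ a) (CommutativeRing._*_ (ℤₚ-ring p) (fromℤ b) t)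

    affine-unfold : ∀ a b t → affine a b t ≡
      CommutativeRing._+_ (ℤₚ-ring p) (fromℤ a) (CommutativeRing._*_ (ℤₚ-ring p) (fromℤ b) t)
    affine-unfold a b t = refl

    seq-affine : ∀ a b t n → seq (affine a b t) n ≡ a ℤ.+ b ℤ.* seq t n
    seq-affine a b t n = refl

  p^m∣p^[m+n] : ∀ m n → p ℕ.^ m ℕ.∣ p ℕ.^ (m ℕ.+ n)
  p^m∣p^[m+n] m n = subst (p ℕ.^ m ℕ.∣_) (≡.sym (ℕ.^-distribˡ-+-* p m n)) (ℕ.m∣m*n _)

  p^-mono-∣ : ∀ {m n} → m ℕ.≤ n → p ℕ.^ m ℕ.∣ p ℕ.^ n
  p^-mono-∣ {m} {n} m≤n = subst (λ k → p ℕ.^ m ℕ.∣ p ℕ.^ k) (ℕ.m+[n∸m]≡n m≤n) (p^m∣p^[m+n] m (n ℕ.∸ m))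

  seq-+ : ∀ (x : ℤₚ p) m n → seq x (m ℕ.+ n) ≡ seq x m [mod p ℕ.^ m ]
  seq-+ x m zero    = ≡⇒≡mod (cong (seq x) (ℕ.+-identityʳ m))
  seq-+ x m (suc n) = mod-trans (≡⇒≡mod (cong (seq x) (ℕ.+-suc m n)))
    (mod-trans (mod-weaken (p^m∣p^[m+n] m n) (coherent x (m ℕ.+ n))) (seq-+ x m n))

  seq-≤ : ∀ (x : ℤₚ p) {m n} → m ℕ.≤ n → seq x n ≡ seq x m [mod p ℕ.^ m ]
  seq-≤ x {m} {n} m≤n =
    subst (λ k → seq x k ≡ seq x m [mod p ℕ.^ m ]) (ℕ.m+[n∸m]≡n m≤n) (seq-+ x m (n ℕ.∸ m))

  abstract
    -- The n-th term of t is (x_(m+n) - a)/p^m. Division by p^m loses m digits of precision, and the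
    -- shift of the index by m restores coherence.
    divide : .{{_ : ℕ.NonZero p}} → ∀ (x : ℤₚ p) a m → seq x m ≡ a [mod p ℕ.^ m ] →
             ∃[ t ] ∀ n → seq x n ≡ a ℤ.+ + (p ℕ.^ m) ℤ.* seq {p} t n [mod p ℕ.^ n ]
    divide x a m x≡a = record { seq = q ; coherent = λ n → q-coherent n } , x≈
      where
      d : ∀ n → + (p ℕ.^ m) ℤ.∣ seq x (m ℕ.+ n) ℤ.- a
      d n = _≡_[mod_].divides (mod-trans (seq-+ x m n) x≡a)
      q : ℕ → ℤ
      q n = ℤ.quotient (d n)
      x≡q : ∀ n → seq x (m ℕ.+ n) ≡ a ℤ.+ + (p ℕ.^ m) ℤ.* q n
      x≡q n = ≡.trans (lem (seq x (m ℕ.+ n)) a)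
                (cong (λ y → a ℤ.+ y) (≡.trans (ℤ._∣_.equality (d n)) (ℤ.*-comm (q n) _)))
        where
        lem : ∀ x a → x ≡ a ℤ.+ (x ℤ.- a)
        lem = ℤ-solver.solve-∀
      instance
        pᵐ≢0 : ℕ.NonZero (p ℕ.^ m)
        pᵐ≢0 = ℕ.m^n≢0 p m
      q-coherent : ∀ n → q (suc n) ≡ q n [mod p ℕ.^ n ]
      q-coherent n = mod (ℤ.*-cancelˡ-∣ (+ (p ℕ.^ m)) (cancelled (coherent x (m ℕ.+ n))))
        where
        cancelled : seq x (suc (m ℕ.+ n)) ≡ seq x (m ℕ.+ n) [mod p ℕ.^ (m ℕ.+ n) ] →
                    + (p ℕ.^ m) ℤ.* + (p ℕ.^ n) ℤ.∣ + (p ℕ.^ m) ℤ.* (q (suc n) ℤ.- q n)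
        cancelled (mod e) = ≡.subst₂ ℤ._∣_
          (≡.trans (cong +_ (ℕ.^-distribˡ-+-* p m n)) (ℤ.pos-* (p ℕ.^ m) (p ℕ.^ n)))
          (≡.trans (cong₂ ℤ._-_ (≡.trans (cong (seq x) (≡.sym (ℕ.+-suc m n))) (x≡q (suc n))) (x≡q n))
            (lem a (+ (p ℕ.^ m)) (q (suc n)) (q n)))
          e
          where
          lem : ∀ x a b c → (x ℤ.+ a ℤ.* b) ℤ.- (x ℤ.+ a ℤ.* c) ≡ a ℤ.* (b ℤ.- c)
          lem = ℤ-solver.solve-∀
      x≈ : ∀ n → seq x n ≡ a ℤ.+ + (p ℕ.^ m) ℤ.* q n [mod p ℕ.^ n ]
      x≈ n = mod-trans (mod-sym (seq-≤ x (ℕ.m≤n+m n m))) (≡⇒≡mod (x≡q n))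

  private module _ (x : ℤₚ p) (y : ℤ) (xy≡1 : seq x 1 ℤ.* y ≡ + 1 [mod p ]) where
    z : ℕ → ℤ
    z n = + 1 ℤ.- seq x n ℤ.* y

    x≡x₁ : ∀ n → seq x (suc n) ≡ seq x 1 [mod p ]
    x≡x₁ n = subst (λ q → seq x (suc n) ≡ seq x 1 [mod q ]) (ℕ.*-identityʳ p) (seq-+ x 1 n)

    z≡0 : ∀ n → z (suc n) ≡ + 0 [mod p ]
    z≡0 n = mod-+ {x = + 1} {y = + 1} mod-refl
      (mod-neg (mod-trans (mod-* {u = y} {v = y} (x≡x₁ n) mod-refl) xy≡1))

    z-coherent : ∀ n → z (suc n) ≡ z n [mod p ℕ.^ n ]
    z-coherent n = mod-+ {x = + 1} {y = + 1} mod-refl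
      (mod-neg (mod-* {u = y} {v = y} (coherent x n) mod-refl))

    -- Level n keeps n terms of the series. The term z^n added at the next level is divisible by p^n
    -- because p divides z.
    geo-coherent : ∀ n → geoℤ (suc n) (z (suc n)) ≡ geoℤ n (z n) [mod p ℕ.^ n ]
    geo-coherent n = mod-trans (≡⇒≡mod (geoℤ-snoc n (z (suc n))))
      (mod-trans (mod-+ (geoℤ-cong n (z-coherent n)) (^-mod-0 (z≡0 n) n))
        (≡⇒≡mod (ℤ.+-identityʳ _)))

  abstract
    -- Newton's geometric series, started from an inverse modulo p.
    inverseₚ : ∀ (x : ℤₚ p) y → seq x 1 ℤ.* y ≡ + 1 [mod p ] → ℤₚ p
    inverseₚ x y xy≡1 = record
      { seq = λ n → y ℤ.* geoℤ n (z x y xy≡1 n)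
      ; coherent = λ n → mod-* {x = y} {y = y} mod-refl (geo-coherent x y xy≡1 n) }

    inverseₚ-correct : ∀ (x : ℤₚ p) y (xy≡1 : seq x 1 ℤ.* y ≡ + 1 [mod p ]) →
                       ∀ n → seq x n ℤ.* seq (inverseₚ x y xy≡1) n ≡ + 1 [mod p ℕ.^ n ]
    inverseₚ-correct x y xy≡1 zero    = mod-1
    inverseₚ-correct x y xy≡1 (suc n) =
      mod-trans (≡⇒≡mod (≡.trans (lem (seq x (suc n)) y (geoℤ (suc n) (z x y xy≡1 (suc n))))
                           (geoℤ-telescope (suc n) (z x y xy≡1 (suc n)))))
        (mod-+ {x = + 1} {y = + 1} mod-refl (mod-neg (^-mod-0 (z≡0 x y xy≡1 n) (suc n))))
      where
      lem : ∀ x y g → x ℤ.* (y ℤ.* g) ≡ (+ 1 ℤ.- (+ 1 ℤ.- x ℤ.* y)) ℤ.* g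
      lem = ℤ-solver.solve-∀

  abstract
    unitₚ : ∀ (x : ℤₚ p) y → seq x 1 ℤ.* y ≡ + 1 [mod p ] → Unit (ℤₚ-ring p)
    unitₚ x y xy≡1 = record
      { val = x ; inv = inverseₚ x y xy≡1 ; val*inv = eq (inverseₚ-correct x y xy≡1) }

    val-unitₚ : ∀ x y xy≡1 → valₚ (unitₚ x y xy≡1) ≡ x
    val-unitₚ x y xy≡1 = refl

-- The field ℂₚ

module Field {p : ℕ} (C : ℂₚ p) where
  open ℂₚ C hiding (zero) renaming (refl to ≈-refl)
  open import Algebra.Properties.Semiring.Exp semiring public using (_^_; ^-congˡ; ^-homo-*; ^-assocʳ)
  open import Algebra.Properties.CommutativeSemiring.Exp commutativeSemiring public using (^-distrib-*)
  open import Algebra.Properties.Group +-group public using ()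
    renaming (x∙y⁻¹≈ε⇒x≈y to x-y≈0⇒x≈y; x≈y⇒x∙y⁻¹≈ε to x≈y⇒x-y≈0)
  open import Relation.Binary.Reasoning.Setoid setoid
  open RingMorphisms.IsRingHomomorphism ι-isHom public
    using () renaming (⟦⟧-cong to ι-cong; +-homo to ι-+; *-homo to ι-*; -‿homo to ι-neg; 0#-homo to ι-0;
        1#-homo to ι-1)

  -- Abstract, since the normal form of fromℤ carries large coherence proofs.
  abstract
    int : ℤ → Carrier
    int a = ι (fromℤ a)

    int≡ι : ∀ a → int a ≡ ι (fromℤ a)
    int≡ι a = refl

    int-0 : int (+ 0) ≈ 0#
    int-0 = ι-0

    int-1 : int (+ 1) ≈ 1#
    int-1 = ι-1

    int-+ : ∀ a b → int (a ℤ.+ b) ≈ int a + int b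
    int-+ a b = trans (ι-cong (eq λ _ → mod-refl)) (ι-+ (fromℤ a) (fromℤ b))

    int-* : ∀ a b → int (a ℤ.* b) ≈ int a * int b
    int-* a b = trans (ι-cong (eq λ _ → mod-refl)) (ι-* (fromℤ a) (fromℤ b))

    int-neg : ∀ a → int (ℤ.- a) ≈ - int a
    int-neg a = trans (ι-cong (eq λ _ → mod-refl)) (ι-neg (fromℤ a))

  -- The coefficients 0, 1 and -1 are interpreted by the ring constants, so
  -- that the solver's goals match them definitionally.
  coeff : ℤ → Carrier
  coeff (+ 0)      = 0#
  coeff (+ 1)      = 1#
  coeff -[1+ 0 ]   = - 1#
  coeff a          = int a

  coeff≈int : ∀ a → coeff a ≈ int a
  coeff≈int (+ 0)             = sym int-0
  coeff≈int (+ 1)             = sym int-1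
  coeff≈int (+ suc (suc n))   = ≈-refl
  coeff≈int -[1+ 0 ]          = trans (-‿cong (sym int-1)) (sym (int-neg (+ 1)))
  coeff≈int -[1+ suc n ]      = ≈-refl

  coeff-morphism : ℤ.+-*-rawRing -Raw-AlmostCommutative⟶ fromCommutativeRing commRing
  coeff-morphism = record
    { ⟦_⟧    = coeff
    ; +-homo = λ a b → trans (coeff≈int (a ℤ.+ b))
        (trans (int-+ a b) (sym (+-cong (coeff≈int a) (coeff≈int b))))
    ; *-homo = λ a b → trans (coeff≈int (a ℤ.* b))
        (trans (int-* a b) (sym (*-cong (coeff≈int a) (coeff≈int b))))
    ; -‿homo = λ a → trans (coeff≈int (ℤ.- a)) (trans (int-neg a) (sym (-‿cong (coeff≈int a))))
    ; 0-homo = ≈-refl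
    ; 1-homo = ≈-refl }

  coeff-≟ : (a b : ℤ) → Maybe (coeff a ≈ coeff b)
  coeff-≟ a b with a ℤ.≟ b
  ... | yes refl = just ≈-refl
  ... | no _     = nothing

  open import Algebra.Solver.Ring ℤ.+-*-rawRing (fromCommutativeRing commRing) coeff-morphism coeff-≟ public
    using (solve; con; _:+_; _:*_; _:-_; :-_; _:=_; Polynomial)

  :1 : ∀ {n} → Polynomial n
  :1 = con (+ 1)

  infix 4 _≈?_

  -- The valuation is ∞ exactly at 0, and ∞ is told apart from finite values by its constructor. All
  -- case distinctions on values of characters rest on this test.
  _≈?_ : ∀ x y → Dec (x ≈ y)
  x ≈? y with ord (x - y) in eq
  ... | ⊤⁺    = yes (x-y≈0⇒x≈y x y (Equivalence.to (ord-∞ (x - y)) eq))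
  ... | [ q ] = no λ x≈y → contradiction
    (≡.trans (≡.sym eq) (Equivalence.from (ord-∞ (x - y)) (x≈y⇒x-y≈0 x≈y))) λ ()

  *-cancelˡ : ∀ {x y z} → ¬ x ≈ 0# → x * y ≈ x * z → y ≈ z
  *-cancelˡ {x} {y} {z} x≉0 xy≈xz with inverse x x≉0
  ... | x⁻¹ , xx⁻¹≈1 = begin
    y  ≈⟨ cancel y ⟨
    x⁻¹ * (x * y)  ≈⟨ *-congˡ xy≈xz ⟩
    x⁻¹ * (x * z)  ≈⟨ cancel z ⟩
    z  ∎
    where
    cancel : ∀ y → x⁻¹ * (x * y) ≈ y
    cancel y = begin
      x⁻¹ * (x * y)  ≈⟨ solve 3 (λ i x y → i :* (x :* y) := (x :* i) :* y) ≈-refl x⁻¹ x y ⟩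
      (x * x⁻¹) * y  ≈⟨ *-congʳ xx⁻¹≈1 ⟩
      1# * y  ≈⟨ *-identityˡ y ⟩
      y  ∎

  no-zero-divisors : ∀ {x y} → x * y ≈ 0# → ¬ x ≈ 0# → y ≈ 0#
  no-zero-divisors {x} xy≈0 x≉0 = *-cancelˡ x≉0 (trans xy≈0 (sym (zeroʳ x)))

  unit≉0 : (u : Unit commRing) → ¬ val u ≈ 0#
  unit≉0 u u≈0 = 1≉0 (trans (sym (val*inv u)) (trans (*-congʳ u≈0) (zeroˡ _)))

  1^n≈1 : ∀ n → 1# ^ n ≈ 1#
  1^n≈1 zero    = ≈-refl
  1^n≈1 (suc n) = trans (*-identityˡ _) (1^n≈1 n)

  ^-cong-1 : ∀ {x} n → x ≈ 1# → x ^ n ≈ 1#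
  ^-cong-1 n x≈1 = trans (^-congˡ n x≈1) (1^n≈1 n)

  ^-multiple-1 : ∀ {x} m n → x ^ m ≈ 1# → x ^ (m ℕ.* n) ≈ 1#
  ^-multiple-1 {x} m n xᵐ≈1 = trans (sym (^-assocʳ x m n)) (^-cong-1 n xᵐ≈1)

  ^-bézout-1 : ∀ {x m n} a b → x ^ m ≈ 1# → x ^ n ≈ 1# → 1 ℕ.+ b ℕ.* n ≡ a ℕ.* m → x ≈ 1#
  ^-bézout-1 {x} {m} {n} a b xᵐ≈1 xⁿ≈1 e = begin
    x  ≈⟨ *-identityʳ x ⟨
    x * 1#  ≈⟨ *-congˡ (^-multiple-1 n b xⁿ≈1) ⟨
    x * x ^ (n ℕ.* b)    ≡⟨ cong (λ k → x * x ^ k) (ℕ.*-comm n b) ⟩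
    x ^ (1 ℕ.+ b ℕ.* n)  ≡⟨ cong (x ^_) (≡.trans e (ℕ.*-comm a m)) ⟩
    x ^ (m ℕ.* a)  ≈⟨ ^-multiple-1 m a xᵐ≈1 ⟩
    1#  ∎

  ^-coprime-1 : ∀ {x m n} → ℕ.Coprime m n → x ^ m ≈ 1# → x ^ n ≈ 1# → x ≈ 1#
  ^-coprime-1 {x} {m} {n} c xᵐ≈1 xⁿ≈1 with ℕ.coprime-Bézout c
  ... | ℕ.Bézout.+- a b e = ^-bézout-1 {x} {m} {n} a b xᵐ≈1 xⁿ≈1 e
  ... | ℕ.Bézout.-+ a b e = ^-bézout-1 {x} {n} {m} b a xⁿ≈1 xᵐ≈1 e

  -- Geometric sums

  geo-telescope : ∀ n z → (1# - z) * geo commRing n z ≈ 1# - z ^ n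
  geo-telescope zero    z = solve 1 (λ z → (:1 :- z) :* con (+ 0) := :1 :- :1) ≈-refl z
  geo-telescope (suc n) z = begin
    (1# - z) * (1# + z * g)
      ≈⟨ solve 2 (λ z g → (:1 :- z) :* (:1 :+ z :* g) := (:1 :- z) :+ z :* ((:1 :- z) :* g)) ≈-refl z g ⟩
    (1# - z) + z * ((1# - z) * g)    ≈⟨ +-congˡ (*-congˡ (geo-telescope n z)) ⟩
    (1# - z) + z * (1# - z ^ n)
      ≈⟨ solve 2 (λ z y → (:1 :- z) :+ z :* (:1 :- y) := :1 :- z :* y) ≈-refl z (z ^ n) ⟩
    1# - z * z ^ n  ∎
    where g = geo commRing n z

  ^-geo : ∀ z n → z ^ n ≈ 1# + (z - 1#) * geo commRing n z
  ^-geo z n = begin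
    z ^ n  ≈⟨ solve 1 (λ y → y := :1 :- (:1 :- y)) ≈-refl (z ^ n) ⟩
    1# - (1# - z ^ n)  ≈⟨ +-congˡ (-‿cong (geo-telescope n z)) ⟨
    1# - (1# - z) * g  ≈⟨ solve 2 (λ z g → :1 :- (:1 :- z) :* g := :1 :+ (z :- :1) :* g) ≈-refl z g ⟩
    1# + (z - 1#) * g  ∎
    where g = geo commRing n z

  geo-cong : ∀ n {x y} → x ≈ y → geo commRing n x ≈ geo commRing n y
  geo-cong zero    x≈y = ≈-refl
  geo-cong (suc n) x≈y = +-congˡ (*-cong x≈y (geo-cong n x≈y))

  geo-1 : ∀ n → geo commRing n 1# ≈ int (+ n)
  geo-1 zero    = sym int-0
  geo-1 (suc n) = begin
    1# + 1# * geo commRing n 1#  ≈⟨ +-cong (sym int-1) (trans (*-identityˡ _) (geo-1 n)) ⟩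
    int (+ 1) + int (+ n)  ≈⟨ int-+ (+ 1) (+ n) ⟨
    int (+ suc n)  ∎

  geo-root-of-unity : ∀ {z} n → z ^ n ≈ 1# → ¬ z ≈ 1# → geo commRing n z ≈ 0#
  geo-root-of-unity {z} n zⁿ≈1 z≉1 = no-zero-divisors
    (trans (geo-telescope n z) (x≈y⇒x-y≈0 (sym zⁿ≈1)))
    (λ 1-z≈0 → z≉1 (sym (x-y≈0⇒x≈y 1# z 1-z≈0)))

  -- The difference quotient (g(x) - g(y))/(x - y) of the geometric sum g. As a polynomial in x and
  -- y it stays inside every subring, so it can serve as cofactor in ideal membership.
  geo-difference : ℕ → Carrier → Carrier → Carrier
  geo-difference zero    x y = 0#
  geo-difference (suc n) x y = geo commRing n x + y * geo-difference n x y

  geo-sub : ∀ n x y → geo commRing n x - geo commRing n y ≈ (x - y) * geo-difference n x y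
  geo-sub zero    x y = solve 2 (λ x y → con (+ 0) :- con (+ 0) := (x :- y) :* con (+ 0)) ≈-refl x y
  geo-sub (suc n) x y = begin
    (1# + x * gx) - (1# + y * gy)
      ≈⟨ solve 4 (λ x y gx gy → (:1 :+ x :* gx) :- (:1 :+ y :* gy) := (x :- y) :* gx :+ y :* (gx :- gy))
          ≈-refl x y gx gy ⟩
    (x - y) * gx + y * (gx - gy)
      ≈⟨ +-congˡ (*-congˡ (geo-sub n x y)) ⟩
    (x - y) * gx + y * ((x - y) * d)
      ≈⟨ solve 4 (λ x y gx d → (x :- y) :* gx :+ y :* ((x :- y) :* d) := (x :- y) :* (gx :+ y :* d)) ≈-refl
          x y gx d ⟩
    (x - y) * (gx + y * d) ∎
    where
    gx = geo commRing n x
    gy = geo commRing n y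
    d = geo-difference n x y

  -- Subrings containing ℤₚ

  record IsSubring (R : Carrier → Set) : Set where
    field
      ≈-mem    : ∀ {x y} → x ≈ y → R x → R y
      ι-mem    : ∀ z → R (ι z)
      +-mem    : ∀ {x y} → R x → R y → R (x + y)
      *-mem    : ∀ {x y} → R x → R y → R (x * y)

    int-mem : ∀ a → R (int a)
    int-mem a = subst R (≡.sym (int≡ι a)) (ι-mem (fromℤ a))

    0-mem : R 0#
    0-mem = ≈-mem int-0 (int-mem (+ 0))

    1-mem : R 1#
    1-mem = ≈-mem int-1 (int-mem (+ 1))

    neg-mem : ∀ {x} → R x → R (- x)
    neg-mem {x} Rx = ≈-mem (trans (*-congʳ (int-neg (+ 1))) (trans (*-congʳ (-‿cong int-1))
      (solve 1 (λ x → (:- :1) :* x := :- x) ≈-refl x))) (*-mem (int-mem (ℤ.- + 1)) Rx)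

    sub-mem : ∀ {x y} → R x → R y → R (x - y)
    sub-mem Rx Ry = +-mem Rx (neg-mem Ry)

    ^-mem : ∀ {x} n → R x → R (x ^ n)
    ^-mem zero    Rx = 1-mem
    ^-mem (suc n) Rx = *-mem Rx (^-mem n Rx)

    geo-mem : ∀ {x} n → R x → R (geo commRing n x)
    geo-mem zero    Rx = 0-mem
    geo-mem (suc n) Rx = +-mem 1-mem (*-mem Rx (geo-mem n Rx))

    geo-difference-mem : ∀ {x y} n → R x → R y → R (geo-difference n x y)
    geo-difference-mem zero    Rx Ry = 0-mem
    geo-difference-mem (suc n) Rx Ry = +-mem (geo-mem n Rx) (*-mem Ry (geo-difference-mem n Rx Ry))

  ℤₚ[]-isSubring : ∀ S → IsSubring (ℤₚ[_] C S)
  ℤₚ[]-isSubring S = record { ≈-mem = resp ; ι-mem = scalar ; +-mem = sum ; *-mem = prod }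

  adjoin-⊆ : ∀ {S R} → IsSubring R → (∀ {x} → S x → R x) → ∀ {x} → ℤₚ[_] C S x → R x
  adjoin-⊆ R S⊆R (scalar z)  = IsSubring.ι-mem R z
  adjoin-⊆ R S⊆R (gen s)     = S⊆R s
  adjoin-⊆ R S⊆R (sum x y)   = IsSubring.+-mem R (adjoin-⊆ R S⊆R x) (adjoin-⊆ R S⊆R y)
  adjoin-⊆ R S⊆R (prod x y)  = IsSubring.*-mem R (adjoin-⊆ R S⊆R x) (adjoin-⊆ R S⊆R y)
  adjoin-⊆ R S⊆R (resp e x)  = IsSubring.≈-mem R e (adjoin-⊆ R S⊆R x)

  -- Membership in the image of ℤₚ, not integrality over it.
  Integral : Carrier → Set
  Integral x = ∃[ z ] ι z ≈ x

  abstract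
    Integral-isSubring : IsSubring Integral
    Integral-isSubring = record
      { ≈-mem = λ x≈y (z , e) → z , trans e x≈y
      ; ι-mem = λ z → z , ≈-refl
      ; +-mem = λ (a , e) (b , f) → _ , trans (ι-+ a b) (+-cong e f)
      ; *-mem = λ (a , e) (b , f) → _ , trans (ι-* a b) (*-cong e f) }

  module Int = IsSubring Integral-isSubring

  Integral⊆ : ∀ {R} → IsSubring R → ∀ {x} → Integral x → R x
  Integral⊆ R (z , e) = IsSubring.≈-mem R e (IsSubring.ι-mem R z)

  record InvertibleIn (R : Carrier → Set) (x : Carrier) : Set where
    constructor invertible
    field
      {inverse′} : Carrier
      mem     : R x
      inv-mem : R inverse′
      inv≈    : x * inverse′ ≈ 1#

  module IdealIn {R I : Carrier → Set} (R-ring : IsSubring R) (I-ideal : IsIdeal C R I) where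
    open IsSubring R-ring
    open IsIdeal I-ideal

    neg-closed : ∀ {x} → I x → I (- x)
    neg-closed {x} Ix = I-resp (solve 1 (λ x → (:- :1) :* x := :- x) ≈-refl x)
      (*-closed (neg-mem 1-mem) Ix)

    sub-closed : ∀ {x y} → I x → I y → I (x - y)
    sub-closed Ix Iy = +-closed Ix (neg-closed Iy)

    *-closedʳ : ∀ {x r} → I x → R r → I (x * r)
    *-closedʳ Ix Rr = I-resp (*-comm _ _) (*-closed Rr Ix)

    *-≡1 : ∀ {x y} → R x → I (x - 1#) → I (y - 1#) → I (x * y - 1#)
    *-≡1 {x} {y} Rx Ix Iy = I-resp
      (solve 2 (λ x y → x :* (y :- :1) :+ (x :- :1) := x :* y :- :1) ≈-refl x y)
      (+-closed (*-closed Rx Iy) Ix)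

    cancel-invertible : ∀ {x u} → InvertibleIn R u → I (x * u) → I x
    cancel-invertible {x} {u} (invertible {w} _ Rw uw≈1) Ixu = I-resp
      (trans (*-assoc x u w) (trans (*-congˡ uw≈1) (*-identityʳ x))) (*-closedʳ Ixu Rw)

  Principal-isIdeal : ∀ {R} → IsSubring R → ∀ {α} → R α → IsIdeal C R (Principal C R α)
  Principal-isIdeal R-ring {α} Rα = record
    { ⊆R       = λ (r , Rr , e) → ≈-mem (sym e) (*-mem Rr Rα)
    ; I-resp   = λ x≈y (r , Rr , e) → r , Rr , trans (sym x≈y) e
    ; 0∈I      = 0# , 0-mem , sym (zeroˡ α)
    ; +-closed = λ (r , Rr , e) (t , Rt , f) →
        r + t , +-mem Rr Rt , trans (+-cong e f) (sym (distribʳ α r t))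
    ; *-closed = λ {s} Rs (r , Rr , e) →
        s * r , *-mem Rs Rr , trans (*-congˡ e) (sym (*-assoc s r α)) }
    where open IsSubring R-ring

-- Polynomials over ℂₚ and roots of unity

module Roots {p : ℕ} (C : ℂₚ p) where
  open ℂₚ C hiding (zero) renaming (refl to ≈-refl)
  open Field C
  open import Relation.Binary.Reasoning.Setoid setoid

  Distinct : ∀ {n} → (Fin n → Carrier) → Set
  Distinct x = ∀ {i j} → x i ≈ x j → i ≡ j

  eval : ∀ {n} → Vec Carrier n → Carrier → Carrier
  eval []      x = 0#
  eval (c ∷ f) x = c + x * eval f x

  Zero : ∀ {n} → Vec Carrier n → Set
  Zero f = ∀ i → lookup f i ≈ 0#

  eval-Zero : ∀ {n} (f : Vec Carrier n) → Zero f → ∀ x → eval f x ≈ 0#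
  eval-Zero []      f≈0 x = ≈-refl
  eval-Zero (c ∷ f) f≈0 x = begin
    c + x * eval f x ≈⟨ +-cong (f≈0 zero) (*-congˡ (eval-Zero f (λ i → f≈0 (suc i)) x)) ⟩
    0# + x * 0#      ≈⟨ solve 1 (λ x → con (+ 0) :+ x :* con (+ 0) := con (+ 0)) ≈-refl x ⟩
    0#  ∎

  -- Synthetic division by X - r: the coefficients are the values at r of the successive tails of f,
  -- and the remainder is f(r).
  quotient : ∀ {n} → Vec Carrier (suc n) → Carrier → Vec Carrier n
  quotient (c ∷ [])          r = []
  quotient (c ∷ f@(_ ∷ _))   r = eval f r ∷ quotient f r

  quotient-correct : ∀ {n} (f : Vec Carrier (suc n)) r y →
                     eval f y ≈ (y - r) * eval (quotient f r) y + eval f r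
  quotient-correct (c ∷ []) r y =
    solve 3 (λ c r y → c :+ y :* con (+ 0) := (y :- r) :* con (+ 0) :+ (c :+ r :* con (+ 0))) ≈-refl c r y
  quotient-correct (c ∷ f@(_ ∷ _)) r y = begin
    c + y * eval f y
      ≈⟨ +-congˡ (*-congˡ (quotient-correct f r y)) ⟩
    c + y * ((y - r) * q + fr)
      ≈⟨ solve 5 (λ c r y q fr → c :+ y :* ((y :- r) :* q :+ fr) := (y :- r) :* (fr :+ y :* q) :+
          (c :+ r :* fr)) ≈-refl c r y q fr ⟩
    (y - r) * (fr + y * q) + (c + r * fr) ∎
    where
    q = eval (quotient f r) y
    fr = eval f r

  constant≈0 : ∀ {c r e} → c + r * e ≈ 0# → e ≈ 0# → c ≈ 0#
  constant≈0 {c} {r} {e} c+re≈0 e≈0 = begin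
    c  ≈⟨ solve 2 (λ c r → c := c :+ r :* con (+ 0)) ≈-refl c r ⟩
    c + r * 0#  ≈⟨ +-congˡ (*-congˡ e≈0) ⟨
    c + r * e   ≈⟨ c+re≈0 ⟩
    0#  ∎

  -- The head of the quotient is the value at r of the next tail. Once it is zero, the value at r
  -- reduces to the constant coefficient, so the coefficients vanish one after the other.
  quotient-Zero : ∀ {n} (f : Vec Carrier (suc n)) r → eval f r ≈ 0# → Zero (quotient f r) → Zero f
  quotient-Zero (c ∷ [])        r fr≈0 q≈0 zero    = constant≈0 fr≈0 ≈-refl
  quotient-Zero (c ∷ f@(_ ∷ _)) r fr≈0 q≈0 zero    = constant≈0 fr≈0 (q≈0 zero)
  quotient-Zero (c ∷ f@(_ ∷ _)) r fr≈0 q≈0 (suc i) =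
    quotient-Zero f r (q≈0 zero) (λ j → q≈0 (suc j)) i

  vanishing⇒Zero : ∀ {n} (f : Vec Carrier n) (x : Fin n → Carrier) → Distinct x →
                   (∀ i → eval f (x i) ≈ 0#) → Zero f
  vanishing⇒Zero {zero}  f x d f≈0 ()
  vanishing⇒Zero {suc n} f x d f≈0 = quotient-Zero f r (f≈0 zero)
    (vanishing⇒Zero (quotient f r) (λ i → x (suc i)) (λ e → Fin.suc-injective (d e)) q≈0)
    where
    r = x zero
    q≈0 : ∀ i → eval (quotient f r) (x (suc i)) ≈ 0#
    q≈0 i = no-zero-divisors (begin
        (y - r) * q  ≈⟨ solve 2 (λ a b → a := (a :+ b) :- b) ≈-refl ((y - r) * q) (eval f r) ⟩
        (y - r) * q + eval f r - eval f r ≈⟨ +-congʳ (quotient-correct f r y) ⟨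
        eval f y - eval f r     ≈⟨ +-cong (f≈0 (suc i)) (-‿cong (f≈0 zero)) ⟩
        0# - 0#  ≈⟨ -‿inverseʳ 0# ⟩
        0#  ∎)
      (λ y-r≈0 → contradiction (d (x-y≈0⇒x≈y y r y-r≈0)) λ ())
      where
      y = x (suc i)
      q = eval (quotient f r) y

  monomial : ∀ n → Vec Carrier (suc n)
  monomial zero    = 1# ∷ []
  monomial (suc n) = 0# ∷ monomial n

  eval-monomial : ∀ n x → eval (monomial n) x ≈ x ^ n
  eval-monomial zero    x = solve 1 (λ x → :1 :+ x :* con (+ 0) := :1) ≈-refl x
  eval-monomial (suc n) x = trans (+-identityˡ _) (*-congˡ (eval-monomial n x))

  monomial-≉0 : ∀ n → ¬ Zero (monomial n)
  monomial-≉0 zero    z = 1≉0 (z zero)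
  monomial-≉0 (suc n) z = monomial-≉0 n (λ i → z (suc i))

  -- More than n such points would be too many zeros for the n + 1 coefficients of X^n - 1; the
  -- contradiction falls on the leading coefficient.
  roots-of-unity-bound : ∀ {m} n → n ≢ 0 → (x : Fin m → Carrier) → Distinct x →
                         (∀ i → x i ^ n ≈ 1#) → m ℕ.≤ n
  roots-of-unity-bound zero n≢0 x d xⁿ≈1 = contradiction refl n≢0
  roots-of-unity-bound {m} (suc n) _ x d xⁿ≈1 with m ℕ.≤? suc n
  ... | yes m≤n = m≤n
  ... | no m≰n  = contradiction
      (λ i → vanishing⇒Zero (- 1# ∷ monomial n) (λ i → x (Fin.inject≤ i n<m))
        (λ {i} {j} e → Fin.inject≤-injective n<m n<m i j (d e)) vanishes (suc i))
      (monomial-≉0 n)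
    where
    n<m : suc (suc n) ℕ.≤ m
    n<m = ℕ.≰⇒> m≰n
    vanishes : ∀ i → eval (- 1# ∷ monomial n) (x (Fin.inject≤ i n<m)) ≈ 0#
    vanishes i = begin
      - 1# + y * eval (monomial n) y ≈⟨ +-congˡ (*-congˡ (eval-monomial n y)) ⟩
      - 1# + y * y ^ n  ≈⟨ +-congˡ (xⁿ≈1 (Fin.inject≤ i n<m)) ⟩
      - 1# + 1#  ≈⟨ -‿inverseˡ 1# ⟩
      0#  ∎
      where y = x (Fin.inject≤ i n<m)

  root-of-unity≉0 : ∀ {x} n → n ≢ 0 → x ^ n ≈ 1# → ¬ x ≈ 0#
  root-of-unity≉0 zero    n≢0 _    _   = n≢0 refl
  root-of-unity≉0 (suc n) n≢0 xⁿ≈1 x≈0 = 1≉0 (trans (sym xⁿ≈1) (trans (*-congʳ x≈0) (zeroˡ _)))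

  ^≉0 : ∀ {x} n → ¬ x ≈ 0# → ¬ x ^ n ≈ 0#
  ^≉0 zero    x≉0 = 1≉0
  ^≉0 (suc n) x≉0 xⁿ≈0 = ^≉0 n x≉0 (no-zero-divisors xⁿ≈0 x≉0)

  ^-cancel : ∀ {x} m n → ¬ x ≈ 0# → x ^ m ≈ x ^ (m ℕ.+ n) → x ^ n ≈ 1#
  ^-cancel {x} m n x≉0 e = *-cancelˡ (^≉0 m x≉0)
    (trans (sym (^-homo-* x m n)) (trans (sym e) (sym (*-identityʳ _))))

  module _ {n ζ} (n≢0 : n ≢ 0) (primitive-ζ : PrimitiveRoot C n ζ) where
    powers-< : ∀ {i j} → i ℕ.< j → j ℕ.< n → ¬ ζ ^ i ≈ ζ ^ j
    powers-< {i} {j} i<j j<n ζⁱ≈ζʲ = proj₂ primitive-ζ (j ℕ.∸ i) (ℕ.m<n⇒0<n∸m i<j)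
      (ℕ.≤-<-trans (ℕ.m∸n≤m j i) j<n)
      (^-cancel i (j ℕ.∸ i) (root-of-unity≉0 n n≢0 (proj₁ primitive-ζ))
        (trans ζⁱ≈ζʲ (reflexive (cong (ζ ^_) (≡.sym (ℕ.m+[n∸m]≡n (ℕ.<⇒≤ i<j)))))))

    powers-Distinct : Distinct (λ (i : Fin n) → ζ ^ Fin.toℕ i)
    powers-Distinct {i} {j} e with ℕ.<-cmp (Fin.toℕ i) (Fin.toℕ j)
    ... | tri< i<j _ _ = contradiction e (powers-< i<j (Fin.toℕ<n j))
    ... | tri≈ _ i≡j _ = Fin.toℕ-injective i≡j
    ... | tri> _ _ j<i = contradiction (sym e) (powers-< j<i (Fin.toℕ<n i))

    -- Together with the n distinct powers of ζ, a root x outside them would give n + 1 roots of X^n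
    -- - 1.
    root-of-unity⇒power : ∀ {x} → x ^ n ≈ 1# → ∃[ i ] x ≈ ζ ^ i
    root-of-unity⇒power {x} xⁿ≈1 with Fin.any? (λ (i : Fin n) → x ≈? ζ ^ Fin.toℕ i)
    ... | yes (i , e) = Fin.toℕ i , e
    ... | no ∄i = contradiction (roots-of-unity-bound n n≢0 points distinct points^n) (ℕ.<⇒≱ (ℕ.n<1+n n))
      where
      points : Fin (suc n) → Carrier
      points zero    = x
      points (suc i) = ζ ^ Fin.toℕ i
      distinct : Distinct points
      distinct {zero}  {zero}  e = refl
      distinct {zero}  {suc j} e = contradiction (j , e) ∄i
      distinct {suc i} {zero}  e = contradiction (i , sym e) ∄i
      distinct {suc i} {suc j} e = cong suc (powers-Distinct e)
      points^n : ∀ i → points i ^ n ≈ 1#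
      points^n zero    = xⁿ≈1
      points^n (suc i) = begin
        (ζ ^ Fin.toℕ i) ^ n    ≈⟨ ^-assocʳ ζ (Fin.toℕ i) n ⟩
        ζ ^ (Fin.toℕ i ℕ.* n)  ≡⟨ cong (ζ ^_) (ℕ.*-comm (Fin.toℕ i) n) ⟩
        ζ ^ (n ℕ.* Fin.toℕ i)  ≈⟨ ^-multiple-1 n (Fin.toℕ i) (proj₁ primitive-ζ) ⟩
        1#  ∎

  -- Let ζ^m = 1 with m = p^i m′ and p ∤ m′. From m < p^(j+1) follows i ≤ j. The order of ζ^(p^i)
  -- divides both m′ and p^(j+1), so ζ^(p^i) = 1 and hence ζ^(p^j) = 1.
  prime-power-PrimitiveRoot : ℕ.Prime p → ∀ {ζ} j → ζ ^ (p ℕ.^ suc j) ≈ 1# → ¬ ζ ^ (p ℕ.^ j) ≈ 1# →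
                              PrimitiveRoot C (p ℕ.^ suc j) ζ
  prime-power-PrimitiveRoot pr {ζ} j ζ^≈1 ζ^≉1 = ζ^≈1 , λ m 0<m m<pʲ ζᵐ≈1 →
      let i , m′ , m≡ , p∤m′ = p-part (prime>1 pr) m (λ m≡0 → ℕ.<⇒≢ 0<m (≡.sym m≡0))
      in ζ^≉1 (lower i m′ m≡ p∤m′ m<pʲ ζᵐ≈1 0<m)
    where
    instance
      p≢0 = ℕ.prime⇒nonZero pr
    lower : ∀ {m} i m′ → m ≡ p ℕ.^ i ℕ.* m′ → ¬ p ℕ.∣ m′ → m ℕ.< p ℕ.^ suc j → ζ ^ m ≈ 1# → 0 ℕ.< m →
            ζ ^ (p ℕ.^ j) ≈ 1#
    lower i zero     refl p∤m′ _ _ _ = contradiction (p ℕ.∣0) p∤m′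
    lower i m′@(suc _) refl p∤m′ m<pʲ ζᵐ≈1 _ = begin
      ζ ^ (p ℕ.^ j)  ≡⟨ cong (λ k → ζ ^ (p ℕ.^ k)) (ℕ.m+[n∸m]≡n i≤j) ⟨
      ζ ^ (p ℕ.^ (i ℕ.+ (j ℕ.∸ i)))  ≡⟨ cong (ζ ^_) (ℕ.^-distribˡ-+-* p i (j ℕ.∸ i)) ⟩
      ζ ^ (p ℕ.^ i ℕ.* p ℕ.^ (j ℕ.∸ i))   ≈⟨ ^-multiple-1 (p ℕ.^ i) (p ℕ.^ (j ℕ.∸ i)) η≈1 ⟩
      1#  ∎
      where
      i≤j : i ℕ.≤ j
      i≤j = ℕ.≤-pred (ℕ.≰⇒> λ j<i → ℕ.<⇒≱ m<pʲ
        (ℕ.≤-trans (ℕ.^-monoʳ-≤ p j<i) (ℕ.m≤m*n (p ℕ.^ i) m′)))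
      η≈1 : ζ ^ (p ℕ.^ i) ≈ 1#
      η≈1 = ^-coprime-1 {m = p ℕ.^ suc j} {n = m′} (coprime-^ (prime∤⇒coprime pr p∤m′) (suc j))
        (begin
          (ζ ^ (p ℕ.^ i)) ^ (p ℕ.^ suc j)  ≈⟨ ^-assocʳ ζ (p ℕ.^ i) (p ℕ.^ suc j) ⟩
          ζ ^ (p ℕ.^ i ℕ.* p ℕ.^ suc j)    ≡⟨ cong (ζ ^_) (ℕ.*-comm (p ℕ.^ i) _) ⟩
          ζ ^ (p ℕ.^ suc j ℕ.* p ℕ.^ i)    ≈⟨ ^-multiple-1 (p ℕ.^ suc j) (p ℕ.^ i) ζ^≈1 ⟩
          1#  ∎)
        (trans (^-assocʳ ζ (p ℕ.^ i) m′) ζᵐ≈1)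

  -- Interpolation and finite sets closed under multiplication.

  times-linear-plus : ∀ {n} → Carrier → Carrier → Vec Carrier n → Vec Carrier (suc n)
  times-linear-plus c r []      = c ∷ []
  times-linear-plus c r (a ∷ g) = (c - r * a) ∷ times-linear-plus a r g

  eval-times-linear-plus : ∀ {n} c r (g : Vec Carrier n) y →
                           eval (times-linear-plus c r g) y ≈ (y - r) * eval g y + c
  eval-times-linear-plus c r [] y =
    solve 3 (λ c r y → c :+ y :* con (+ 0) := (y :- r) :* con (+ 0) :+ c) ≈-refl c r y
  eval-times-linear-plus c r (a ∷ g) y = begin
    (c - r * a) + y * eval (times-linear-plus a r g) y
      ≈⟨ +-congˡ (*-congˡ (eval-times-linear-plus a r g y)) ⟩
    (c - r * a) + y * ((y - r) * e + a)
      ≈⟨ solve 5 (λ c r a y e → (c :- r :* a) :+ y :* ((y :- r) :* e :+ a) := (y :- r) :* (a :+ y :* e) :+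
          c) ≈-refl c r a y e ⟩
    (y - r) * (a + y * e) + c ∎
    where e = eval g y

  -- Newton interpolation: f = y₀ + (X - x₀) g, where g interpolates the slopes (yᵢ - y₀)/(xᵢ - x₀)
  -- at the remaining points.
  interpolate : ∀ {n} (x : Fin n → Carrier) → Distinct x → (y : Fin n → Carrier) →
                ∃[ f ] ∀ i → eval {n} f (x i) ≈ y i
  interpolate {zero}  x d y = [] , λ ()
  interpolate {suc n} x d y = times-linear-plus y₀ x₀ g , correct
    where
    x₀ = x zero
    y₀ = y zero
    x-x₀≉0 : ∀ i → ¬ x (suc i) - x₀ ≈ 0#
    x-x₀≉0 i e = contradiction (d (x-y≈0⇒x≈y (x (suc i)) x₀ e)) λ ()
    slope : Fin n → Carrier
    slope i = proj₁ (inverse (x (suc i) - x₀) (x-x₀≉0 i)) * (y (suc i) - y₀)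
    g-spec = interpolate (λ i → x (suc i)) (λ e → Fin.suc-injective (d e)) slope
    g = proj₁ g-spec
    correct : ∀ i → eval (times-linear-plus y₀ x₀ g) (x i) ≈ y i
    correct zero = begin
      eval (times-linear-plus y₀ x₀ g) x₀ ≈⟨ eval-times-linear-plus y₀ x₀ g x₀ ⟩
      (x₀ - x₀) * eval g x₀ + y₀
        ≈⟨ solve 3 (λ x e y → (x :- x) :* e :+ y := y) ≈-refl x₀ (eval g x₀) y₀ ⟩
      y₀  ∎
    correct (suc i) = begin
      eval (times-linear-plus y₀ x₀ g) xᵢ  ≈⟨ eval-times-linear-plus y₀ x₀ g xᵢ ⟩
      (xᵢ - x₀) * eval g xᵢ + y₀  ≈⟨ +-congʳ (*-congˡ (proj₂ g-spec i)) ⟩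
      (xᵢ - x₀) * (w * (yᵢ - y₀)) + y₀     ≈⟨ +-congʳ (*-assoc _ _ _) ⟨
      (xᵢ - x₀) * w * (yᵢ - y₀) + y₀  ≈⟨ +-congʳ (*-congʳ (proj₂ (inverse (xᵢ - x₀) (x-x₀≉0 i)))) ⟩
      1# * (yᵢ - y₀) + y₀  ≈⟨ solve 2 (λ a b → :1 :* (a :- b) :+ b := a) ≈-refl yᵢ y₀ ⟩
      yᵢ  ∎
      where
      xᵢ = x (suc i)
      yᵢ = y (suc i)
      w = proj₁ (inverse (xᵢ - x₀) (x-x₀≉0 i))

  -- The coefficients of s f(uX) - v f(X); the accumulator s collects the powers of u.
  twist : ∀ {n} → Carrier → Carrier → Carrier → Vec Carrier n → Vec Carrier n
  twist u v s []      = []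
  twist u v s (c ∷ f) = (s * c - v * c) ∷ twist u v (s * u) f

  eval-twist : ∀ {n} u v s (f : Vec Carrier n) x →
               eval (twist u v s f) x ≈ s * eval f (u * x) - v * eval f x
  eval-twist u v s [] x = solve 2 (λ s v → con (+ 0) := s :* con (+ 0) :- v :* con (+ 0)) ≈-refl s v
  eval-twist u v s (c ∷ f) x = begin
    (s * c - v * c) + x * eval (twist u v (s * u) f) x
      ≈⟨ +-congˡ (*-congˡ (eval-twist u v (s * u) f x)) ⟩
    (s * c - v * c) + x * (s * u * e₁ - v * e₂)
      ≈⟨ solve 7 (λ s c v u x e₁ e₂ → (s :* c :- v :* c) :+ x :* (s :* u :* e₁ :- v :* e₂)
           := s :* (c :+ u :* x :* e₁) :- v :* (c :+ x :* e₂)) ≈-refl s c v u x e₁ e₂ ⟩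
    s * (c + u * x * e₁) - v * (c + x * e₂) ∎
    where
    e₁ = eval f (u * x)
    e₂ = eval f x

  lookup-twist : ∀ {n} u v s (f : Vec Carrier n) i →
                 lookup (twist u v s f) i ≈ lookup f i * (s * u ^ Fin.toℕ i) - lookup f i * v
  lookup-twist u v s (c ∷ f) zero    = solve 3 (λ s c v → s :* c :- v :* c := c :* (s :* :1) :- c :* v)
      ≈-refl s c v
  lookup-twist u v s (c ∷ f) (suc i) = trans (lookup-twist u v (s * u) f i)
    (+-congʳ (*-congˡ (*-assoc s u _)))

  -- A function y of x ∈ {x₀, …, xₙ₋₁} multiplicative in x agrees with a
  -- power of x: if f interpolates it then f(u X) = y(u) f(X) as polynomials,
  -- and a nonzero coefficient of f in degree i gives y(u) = uⁱ.
  multiplicative⇒power : ∀ {n} (x y : Fin n → Carrier) → Distinct x →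
    (∀ i j → ∃[ k ] (x k ≈ x i * x j × y k ≈ y i * y j)) → ∀ i₀ → ¬ y i₀ ≈ 0# →
    ∃[ e ] (e ℕ.< n × (∀ i → y i ≈ x i ^ e))
  multiplicative⇒power {n} x y d closed i₀ y≉0
    with interpolate x d y
  ... | f , f-spec with Fin.any? (λ (e : Fin n) → ¬? (lookup f e ≈? 0#))
  ... | no ∄e = contradiction (trans (sym (f-spec i₀)) (eval-Zero f f≈0 (x i₀))) y≉0
    where
    f≈0 : Zero f
    f≈0 e with lookup f e ≈? 0#
    ... | yes z = z
    ... | no nz = contradiction (e , nz) ∄e
  ... | yes (e , fₑ≉0) = Fin.toℕ e , Fin.toℕ<n e , λ i → sym (*-cancelˡ fₑ≉0
      (trans (*-congˡ (sym (*-identityˡ _))) (x-y≈0⇒x≈y _ _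
        (trans (sym (lookup-twist (x i) (y i) 1# f e))
          (vanishing⇒Zero (twist (x i) (y i) 1# f) x d (vanishes i) e)))))
    where
    eval-cong : ∀ {m} (g : Vec Carrier m) {a b} → a ≈ b → eval g a ≈ eval g b
    eval-cong []      a≈b = ≈-refl
    eval-cong (c ∷ g) a≈b = +-congˡ (*-cong a≈b (eval-cong g a≈b))
    vanishes : ∀ i j → eval (twist (x i) (y i) 1# f) (x j) ≈ 0#
    vanishes i j with closed i j
    ... | k , xₖ≈ , yₖ≈ = begin
      eval (twist (x i) (y i) 1# f) (x j)
        ≈⟨ eval-twist (x i) (y i) 1# f (x j) ⟩
      1# * eval f (x i * x j) - y i * eval f (x j)
        ≈⟨ +-cong (*-congˡ (eval-cong f (sym xₖ≈))) (-‿cong (*-congˡ (f-spec j))) ⟩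
      1# * eval f (x k) - y i * y j
        ≈⟨ +-cong (trans (*-identityˡ _) (f-spec k)) (-‿cong (sym yₖ≈)) ⟩
      y k - y k
        ≈⟨ -‿inverseʳ (y k) ⟩
      0# ∎

  -- The map x ↦ x^n is multiplicative, hence equal on these points to x ↦ x^e for some e < n. If e
  -- > 0, then x^(n-e) = 1 at n distinct points, more than there are roots.
  fermat : ∀ {n} (x : Fin n → Carrier) → Distinct x →
           (∀ i j → ∃[ k ] x k ≈ x i * x j) → (∀ i → ¬ x i ≈ 0#) → ∀ i → x i ^ n ≈ 1#
  fermat {zero} x d closed x≉0 ()
  fermat {n@(suc n′)} x d closed x≉0
    with multiplicative⇒power x (λ i → x i ^ n) d
           (λ i j → let k , e = closed i j in k , e , trans (^-congˡ n e) (^-distrib-* (x i) (x j) n))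
           zero (^≉0 n (x≉0 zero))
  ... | zero  , e<n , xⁿ≈ = xⁿ≈
  ... | suc e , e<n , xⁿ≈ = contradiction
      (roots-of-unity-bound (n ℕ.∸ suc e) (ℕ.m>n⇒m∸n≢0 e<n) x d λ i →
        ^-cancel (suc e) (n ℕ.∸ suc e) (x≉0 i) (trans (sym (xⁿ≈ i))
          (reflexive (cong (x i ^_) (≡.sym (ℕ.m+[n∸m]≡n (ℕ.<⇒≤ e<n)))))))
      (ℕ.<⇒≱ (ℕ.s≤s (ℕ.m∸n≤m n′ e)))

  -- Multiplication by y permutes the points, with multiplication by z as the inverse permutation.
  -- Comparing the products of all points gives y^n ∏ x = ∏ x, and ∏ x is nonzero.
  lagrange : ∀ {n} (x : Fin n → Carrier) → Distinct x → (∀ i → ¬ x i ≈ 0#) →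
             ∀ {y z} → y * z ≈ 1# → (∀ i → ∃[ k ] x k ≈ y * x i) → (∀ i → ∃[ k ] x k ≈ z * x i) →
             y ^ n ≈ 1#
  lagrange {n} x d x≉0 {y} {z} yz≈1 closed-y closed-z =
    *-cancelˡ (∏≉0 x x≉0) (begin
      ∏ x * y ^ n  ≈⟨ *-comm _ _ ⟩
      y ^ n * ∏ x  ≈⟨ ∏-scale n x ⟨
      ∏ (λ i → y * x i)      ≈⟨ ∏-cong (λ i → proj₂ (closed-y i)) ⟨
      ∏ (λ i → x (π i))      ≈⟨ sum-permute x (permutation π π⁻¹ ππ⁻¹ π⁻¹π) ⟨
      ∏ x  ≈⟨ *-identityʳ _ ⟨
      ∏ x * 1#  ∎)
    where
    open import Algebra.Properties.CommutativeMonoid.Sum *-commutativeMonoid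
      using (sum-permute) renaming (sum to ∏; sum-cong-≋ to ∏-cong)
    π : Fin n → Fin n
    π i = proj₁ (closed-y i)
    π⁻¹ : Fin n → Fin n
    π⁻¹ i = proj₁ (closed-z i)
    cancel : ∀ {a b} c → a * b ≈ 1# → a * (b * c) ≈ c
    cancel c ab≈1 = trans (sym (*-assoc _ _ c)) (trans (*-congʳ ab≈1) (*-identityˡ c))
    ππ⁻¹ : ∀ i → π (π⁻¹ i) ≡ i
    ππ⁻¹ i = d (trans (proj₂ (closed-y (π⁻¹ i))) (trans (*-congˡ (proj₂ (closed-z i))) (cancel (x i) yz≈1)))
    π⁻¹π : ∀ i → π⁻¹ (π i) ≡ i
    π⁻¹π i = d (trans (proj₂ (closed-z (π i)))
        (trans (*-congˡ (proj₂ (closed-y i))) (cancel (x i) (trans (*-comm z y) yz≈1))))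
    ∏-scale : ∀ m (f : Fin m → Carrier) → ∏ (λ i → y * f i) ≈ y ^ m * ∏ f
    ∏-scale zero    f = sym (*-identityˡ _)
    ∏-scale (suc m) f = trans (*-congˡ (∏-scale m (λ i → f (suc i))))
      (solve 4 (λ y a b c → y :* a :* (b :* c) := y :* b :* (a :* c)) ≈-refl y (f zero) (y ^ m)
          (∏ (λ i → f (suc i))))
    ∏≉0 : ∀ {m} (f : Fin m → Carrier) → (∀ i → ¬ f i ≈ 0#) → ¬ ∏ f ≈ 0#
    ∏≉0 {zero}  f f≉0 = 1≉0
    ∏≉0 {suc m} f f≉0 ∏f≈0 = ∏≉0 (λ i → f (suc i)) (λ i → f≉0 (suc i)) (no-zero-divisors ∏f≈0 (f≉0 zero))

-- One-units and their powers

module OneUnits {p : ℕ} (C : ℂₚ p) where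
  open ℂₚ C hiding (zero) renaming (refl to ≈-refl)
  open Field C
  open Padic p
  open UnitPowers commRing
  open import Algebra.Definitions.RawMonoid (AbelianGroup.rawMonoid (commRing ˣ)) using () renaming
      (_×_ to _·_)
  open import Relation.Binary.Reasoning.Setoid setoid

  P : Carrier
  P = int (+ p)

  P^ : ℕ → Carrier
  P^ n = int (+ (p ℕ.^ n))

  P^-+ : ∀ m n → P^ (m ℕ.+ n) ≈ P^ m * P^ n
  P^-+ m n = trans (reflexive (cong int
      (≡.trans (cong +_ (ℕ.^-distribˡ-+-* p m n)) (ℤ.pos-* (p ℕ.^ m) (p ℕ.^ n)))))
    (int-* (+ (p ℕ.^ m)) (+ (p ℕ.^ n)))

  P^-suc : ∀ n → P^ (suc n) ≈ P * P^ n
  P^-suc n = trans (reflexive (cong int (ℤ.pos-* p (p ℕ.^ n)))) (int-* (+ p) (+ (p ℕ.^ n)))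

  open UnitMap (ℤₚ-ring p) commRing ι ι-isHom public
    using () renaming (mapᵘ to ιᵘ; map-^ᵘ to ι-^ᵘ)

  inv-· : ∀ (w : Unit commRing) n → inv (n · w) ≡ inv w ^ n
  inv-· w zero    = refl
  inv-· w (suc n) = cong (inv w *_) (inv-· w n)

  ι-affine : ∀ a b t → ι (affine a b t) ≈ int a + int b * ι t
  ι-affine a b t = trans (reflexive (cong ι (affine-unfold a b t)))
    (trans (ι-+ (fromℤ a) (CommutativeRing._*_ (ℤₚ-ring p) (fromℤ b) t))
      (+-cong (reflexive (≡.sym (int≡ι a)))
        (trans (ι-* (fromℤ b) t) (*-congʳ (reflexive (≡.sym (int≡ι b)))))))

  ι-≡ : .{{_ : ℕ.NonZero p}} → ∀ z a m → seq z m ≡ a [mod p ℕ.^ m ] →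
        ∃[ t ] (Integral t × ι z ≈ int a + P^ m * t)
  ι-≡ z a m z≡a = let t , z≈ = divide z a m z≡a in
    ι t , (t , ≈-refl) , trans (ι-cong {z} {affine a (+ (p ℕ.^ m)) t}
        (eq λ n → mod-trans (z≈ n) (≡⇒≡mod (≡.sym (seq-affine a _ t n))))) (ι-affine a _ t)

  ι-≡1 : .{{_ : ℕ.NonZero p}} → ∀ z m → seq z m ≡ + 1 [mod p ℕ.^ m ] →
         ∃[ t ] (Integral t × ι z ≈ 1# + P^ m * t)
  ι-≡1 z m z≡1 = let t , It , e = ι-≡ z (+ 1) m z≡1 in t , It , trans e (+-congʳ int-1)

  InvertibleIn-≈ : ∀ {R} → IsSubring R → ∀ {x y} → x ≈ y → InvertibleIn R x → InvertibleIn R y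
  InvertibleIn-≈ R x≈y (invertible m i e) = invertible (IsSubring.≈-mem R x≈y m) i
      (trans (*-congʳ (sym x≈y)) e)

  InvertibleIn⊆ : ∀ {R} → IsSubring R → ∀ {x} → InvertibleIn Integral x → InvertibleIn R x
  InvertibleIn⊆ R (invertible m i e) = invertible (Integral⊆ R m) (Integral⊆ R i) e

  InvertibleIn-* : ∀ {R} → IsSubring R → ∀ {x y} → InvertibleIn R x → InvertibleIn R y → InvertibleIn R
      (x * y)
  InvertibleIn-* R {x} {y} (invertible {x′} Rx Rx′ xx′≈1) (invertible {y′} Ry Ry′ yy′≈1) =
    invertible (IsSubring.*-mem R Rx Ry) (IsSubring.*-mem R Rx′ Ry′) (begin
      (x * y) * (x′ * y′)  ≈⟨ solve 4 (λ x y a b → (x :* y) :* (a :* b) := (x :* a) :* (y :* b)) ≈-refl x y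
          x′ y′ ⟩
      (x * x′) * (y * y′)  ≈⟨ *-cong xx′≈1 yy′≈1 ⟩
      1# * 1#  ≈⟨ *-identityˡ 1# ⟩
      1#  ∎)

  unit⇒invertible : ∀ w → InvertibleIn Integral (ι (valₚ w))
  unit⇒invertible w = invertible (valₚ w , ≈-refl) (invₚ w , ≈-refl) (val*inv (ιᵘ w))

  invertible-mod-p : ∀ m y → m ℤ.* y ≡ + 1 [mod p ] → ∀ {g} → Integral g →
                     InvertibleIn Integral (int m + P * g)
  invertible-mod-p m y my≡1 {g} (γ , ιγ≈g) = InvertibleIn-≈ Integral-isSubring
    (trans (reflexive (cong ι (val-unitₚ z y zy≡1))) (trans (ι-affine m (+ p) γ) (+-congˡ (*-congˡ ιγ≈g))))
    (unit⇒invertible (unitₚ z y zy≡1))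
    where
    z : ℤₚ p
    z = affine m (+ p) γ
    lem : ∀ m p g → m ℤ.+ p ℤ.* g ℤ.- m ≡ g ℤ.* p
    lem = ℤ-solver.solve-∀
    z≡m : seq z 1 ≡ m [mod p ]
    z≡m = subst (λ x → x ≡ m [mod p ]) (≡.sym (seq-affine m (+ p) γ 1))
      (mod (ℤ.divides (seq γ 1) (lem m (+ p) (seq γ 1))))
    zy≡1 : seq z 1 ℤ.* y ≡ + 1 [mod p ]
    zy≡1 = mod-trans (mod-* {u = y} {v = y} z≡m mod-refl) my≡1

  invertible-1+P : ∀ {e} → Integral e → InvertibleIn Integral (1# + P * e)
  invertible-1+P Ie = InvertibleIn-≈ Integral-isSubring (+-congʳ int-1)
    (invertible-mod-p (+ 1) (+ 1) mod-refl Ie)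

  geo-≡ : ∀ n {x} → Integral x → ∃[ g ] (Integral g × geo commRing n (1# + P * x) ≈ int (+ n) + P * g)
  geo-≡ zero    Ix = 0# , Int.0-mem , trans (sym int-0)
      (solve 2 (λ z P → z := z :+ P :* con (+ 0)) ≈-refl (int (+ 0)) P)
  geo-≡ (suc n) {x} Ix with geo-≡ n Ix
  ... | g , Ig , e = x * (int (+ n) + P * g) + g
      , Int.+-mem (Int.*-mem Ix (Int.+-mem (Int.int-mem _) (Int.*-mem (Int.int-mem _) Ig))) Ig , (begin
    1# + (1# + P * x) * geo commRing n (1# + P * x) ≈⟨ +-congˡ (*-congˡ e) ⟩
    1# + (1# + P * x) * (N + P * g)
      ≈⟨ solve 4 (λ P x N g → :1 :+ (:1 :+ P :* x) :* (N :+ P :* g) := (:1 :+ N) :+ P :*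
          (x :* (N :+ P :* g) :+ g)) ≈-refl P x N g ⟩
    (1# + N) + P * (x * (N + P * g) + g) ≈⟨ +-congʳ (trans (int-+ (+ 1) (+ n)) (+-congʳ int-1)) ⟨
    int (+ suc n) + P * (x * (N + P * g) + g) ∎)
    where N = int (+ n)

  -- Order two is what `odd-gains` needs: for x divisible by p the remainder is divisible by p², so
  -- that only the linear coefficient has to be examined.
  geo-taylor : ∀ n {x} → Integral x → ∃[ h ] (Integral h ×
    geo commRing n (1# + x) ≈ int (+ n) + x * int (triangle n) + x * x * h)
  geo-taylor zero    {x} Ix = 0# , Int.0-mem ,
    trans (solve 1 (λ x → con (+ 0) := con (+ 0) :+ x :* con (+ 0) :+ x :* x :* con (+ 0)) ≈-refl x)
      (+-congʳ (+-cong (sym int-0) (*-congˡ (sym int-0))))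
  geo-taylor (suc n) {x} Ix with geo-taylor n Ix
  ... | h , Ih , e = T + (1# + x) * h
      , Int.+-mem (Int.int-mem _) (Int.*-mem (Int.+-mem Int.1-mem Ix) Ih) , (begin
    1# + (1# + x) * geo commRing n (1# + x)  ≈⟨ +-congˡ (*-congˡ e) ⟩
    1# + (1# + x) * (N + x * T + x * x * h)
      ≈⟨ solve 4 (λ x N T h → :1 :+ (:1 :+ x) :* (N :+ x :* T :+ x :* x :* h)
           := (:1 :+ N) :+ x :* (T :+ N) :+ x :* x :* (T :+ (:1 :+ x) :* h)) ≈-refl x N T h ⟩
    (1# + N) + x * (T + N) + x * x * (T + (1# + x) * h)
      ≈⟨ +-congʳ (+-cong (trans (int-+ (+ 1) (+ n)) (+-congʳ int-1)) (*-congˡ (int-+ (triangle n) (+ n)))) ⟨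
    int (+ suc n) + x * int (triangle (suc n)) + x * x * (T + (1# + x) * h) ∎)
    where
    N = int (+ n)
    T = int (triangle n)

  -- Raising a unit ≡ 1 modulo pˢ to the p-th power gains exactly one factor
  -- p; this holds for s ≥ 1 when p is odd and for s ≥ 2 when p = 2.
  GainsOneFactor : ℕ → Set
  GainsOneFactor s = ∀ {t} → Integral t →
    ∃[ e ] (Integral e × geo commRing p (1# + P^ s * t) ≈ P * (1# + P * e))

  -- At x = pt the linear term is pt · p(p-1)/2 = pt · ph. It is divisible by p², as is the
  -- remainder, so after division by p the sum is 1 modulo p.
  odd-gains : ∀ h → p ≡ 1 ℕ.+ 2 ℕ.* h → GainsOneFactor 1
  odd-gains h p≡ {t} It with geo-taylor p (Int.*-mem (Int.int-mem (+ p)) It)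
  ... | g , Ig , e = t * int (+ h) + t * t * g
      , Int.+-mem (Int.*-mem It (Int.int-mem _)) (Int.*-mem (Int.*-mem It It) Ig) , (begin
    geo commRing p (1# + P^ 1 * t)
      ≈⟨ geo-cong p (+-congˡ (*-congʳ (reflexive (cong (λ q → int (+ q)) (ℕ.*-identityʳ p))))) ⟩
    geo commRing p (1# + P * t)     ≈⟨ e ⟩
    P + P * t * int (triangle p) + P * t * (P * t) * g
      ≈⟨ +-congʳ (+-congˡ (*-congˡ (trans (reflexive (cong int triangle≡)) (int-* (+ p) (+ h))))) ⟩
    P + P * t * (P * int (+ h)) + P * t * (P * t) * g
      ≈⟨ solve 4 (λ P t h g → P :+ P :* t :* (P :* h) :+ P :* t :* (P :* t) :* g
           := P :* (:1 :+ P :* (t :* h :+ t :* t :* g))) ≈-refl P t (int (+ h)) g ⟩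
    P * (1# + P * (t * int (+ h) + t * t * g)) ∎)
    where
    p-1≡ : + p ℤ.- + 1 ≡ + 2 ℤ.* + h
    p-1≡ = ≡.trans (cong (λ q → + q ℤ.- + 1) p≡)
        (≡.trans (cong (λ q → + 1 ℤ.+ q ℤ.- + 1) (ℤ.pos-* 2 h)) (lem (+ 2 ℤ.* + h)))
      where
      lem : ∀ x → + 1 ℤ.+ x ℤ.- + 1 ≡ x
      lem = ℤ-solver.solve-∀
    triangle≡ : triangle p ≡ + p ℤ.* + h
    triangle≡ = ℤ.*-cancelˡ-≡ (+ 2) (triangle p) (+ p ℤ.* + h)
      (≡.trans (2*triangle p) (≡.trans (cong (+ p ℤ.*_) p-1≡) (lem (+ p) (+ h))))
      where
      lem : ∀ p h → p ℤ.* (+ 2 ℤ.* h) ≡ + 2 ℤ.* (p ℤ.* h)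
      lem = ℤ-solver.solve-∀

  -- For z = 1 + 4t the sum is 1 + z = 2(1 + 2t). From z = 1 + 2t it would be 2(1 + t), where 1 + t
  -- may be even; this is why 4 takes the place of 2.
  two-gains : p ≡ 2 → GainsOneFactor 2
  two-gains refl {t} It = t , It , (begin
    1# + (1# + P^ 2 * t) * (1# + (1# + P^ 2 * t) * 0#)
      ≈⟨ solve 2 (λ f t → :1 :+ (:1 :+ f :* t) :* (:1 :+ (:1 :+ f :* t) :* con (+ 0)) := con (+ 2) :+ f :*
          t) ≈-refl (P^ 2) t ⟩
    P + P^ 2 * t      ≈⟨ +-congˡ (*-congʳ (int-* (+ 2) (+ 2))) ⟩
    P + P * P * t     ≈⟨ solve 2 (λ P t → P :+ P :* P :* t := P :* (:1 :+ P :* t)) ≈-refl P t ⟩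
    P * (1# + P * t)  ∎)

  -- The level is written as a successor because `P^ (suc s)` then splits as `P * P^ s`, which
  -- exhibits the factor p.
  module Gain (s : ℕ) (gains : GainsOneFactor (suc s)) where

    ^p-step : ∀ {y w} e → Integral w → y ≈ 1# + P^ (suc s ℕ.+ e) * w →
              ∃[ f ] (Integral f × y ^ p ≈ 1# + P^ (suc (suc s ℕ.+ e)) * (w * (1# + P * f)))
    ^p-step {y} {w} e Iw y≈ = let f , If , geo≈ = gains (Int.*-mem (Int.int-mem _) Iw) in f , If , (begin
      y ^ p  ≈⟨ ^-geo y p ⟩
      1# + (y - 1#) * geo commRing p y
        ≈⟨ +-congˡ (*-cong (+-congʳ y≈)
        (trans (geo-cong p (trans y≈ (+-congˡ (trans (*-congʳ (P^-+ (suc s) e)) (*-assoc _ _ _))))) geo≈)) ⟩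
      1# + (1# + Q * w - 1#) * (P * (1# + P * f))
        ≈⟨ solve 4 (λ Q w P f → :1 :+ (:1 :+ Q :* w :- :1) :* (P :* (:1 :+ P :* f)) := :1 :+ (P :* Q) :*
            (w :* (:1 :+ P :* f))) ≈-refl Q w P f ⟩
      1# + (P * Q) * (w * (1# + P * f))   ≈⟨ +-congˡ (*-congʳ (P^-suc (suc s ℕ.+ e))) ⟨
      1# + P^ (suc (suc s ℕ.+ e)) * (w * (1# + P * f)) ∎)
      where Q = P^ (suc s ℕ.+ e)

    ^p^ : ∀ {y t} → Integral t → y ≈ 1# + P^ (suc s) * t → ∀ e →
          ∃[ f ] (Integral f × y ^ (p ℕ.^ e) ≈ 1# + P^ (suc s ℕ.+ e) * (t * (1# + P * f)))
    ^p^ {y} {t} It y≈ zero = 0# , Int.0-mem , (begin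
      y * 1#  ≈⟨ *-identityʳ y ⟩
      y  ≈⟨ y≈ ⟩
      1# + P^ (suc s) * t  ≡⟨ cong (λ k → 1# + P^ k * t) (ℕ.+-identityʳ (suc s)) ⟨
      1# + P^ (suc s ℕ.+ 0) * t
        ≈⟨ +-congˡ (*-congˡ (solve 2 (λ t P → t := t :* (:1 :+ P :* con (+ 0))) ≈-refl t P)) ⟩
      1# + P^ (suc s ℕ.+ 0) * (t * (1# + P * 0#)) ∎)
    ^p^ {y} {t} It y≈ (suc e) =
      let f , If , yᵉ≈ = ^p^ It y≈ e
          g , Ig , yᵉᵖ≈ = ^p-step e (Int.*-mem It (Int.+-mem Int.1-mem (Int.*-mem (Int.int-mem (+ p)) If)))
              yᵉ≈
      in f + g + P * f * g
        , Int.+-mem (Int.+-mem If Ig) (Int.*-mem (Int.*-mem (Int.int-mem _) If) Ig) , (begin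
      y ^ (p ℕ.* p ℕ.^ e)  ≡⟨ cong (y ^_) (ℕ.*-comm p (p ℕ.^ e)) ⟩
      y ^ (p ℕ.^ e ℕ.* p)  ≈⟨ ^-assocʳ y (p ℕ.^ e) p ⟨
      (y ^ (p ℕ.^ e)) ^ p  ≈⟨ yᵉᵖ≈ ⟩
      1# + P^ (suc (suc s ℕ.+ e)) * (t * (1# + P * f) * (1# + P * g))
        ≈⟨ +-congˡ (*-congˡ (solve 4 (λ t P f g → t :* (:1 :+ P :* f) :* (:1 :+ P :* g) := t :*
            (:1 :+ P :* (f :+ g :+ P :* f :* g))) ≈-refl t P f g)) ⟩
      1# + P^ (suc (suc s ℕ.+ e)) * (t * (1# + P * (f + g + P * f * g)))
        ≡⟨ cong (λ k → 1# + P^ k * (t * (1# + P * (f + g + P * f * g)))) (ℕ.+-suc (suc s) e) ⟨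
      1# + P^ (suc s ℕ.+ suc e) * (t * (1# + P * (f + g + P * f * g))) ∎)

    -- The factor p^e of n raises the level by e. The factor m, prime to p, contributes 1 + Y + ...
    -- + Y^(m-1) ≡ m modulo p, a unit. Keeping t explicit serves two purposes: an arbitrary t bounds
    -- all y, and t = 1 attains the bound.
    lifting-exponent : ∀ {y t} → Integral t → y ≈ 1# + P^ (suc s) * t → ∀ {n} e m i →
      n ≡ p ℕ.^ e ℕ.* m → + m ℤ.* i ≡ + 1 [mod p ] →
      ∃[ u ] (InvertibleIn Integral u × y ^ n ≈ 1# + P^ (suc s ℕ.+ e) * (t * u))
    lifting-exponent {y} {t} It y≈ e m i refl mi≡1 =
      let f , If , yᵉ≈ = ^p^ It y≈ e
          g , Ig , geo≈ = geo-≡ m (Int.*-mem (Int.int-mem _)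
              (Int.*-mem It (Int.+-mem Int.1-mem (Int.*-mem (Int.int-mem (+ p)) If))))
          v = 1# + P * f
          G = int (+ m) + P * g
      in v * G
        , InvertibleIn-* Integral-isSubring (invertible-1+P If) (invertible-mod-p (+ m) i mi≡1 Ig) , (begin
      y ^ (p ℕ.^ e ℕ.* m)      ≈⟨ ^-assocʳ y (p ℕ.^ e) m ⟨
      Y ^ m  ≈⟨ ^-geo Y m ⟩
      1# + (Y - 1#) * geo commRing m Y
        ≈⟨ +-congˡ (*-cong (+-congʳ yᵉ≈)
            (trans (geo-cong m (trans yᵉ≈ (+-congˡ (trans (*-congʳ (P^-suc (s ℕ.+ e))) (*-assoc _ _ _)))))
            geo≈)) ⟩
      1# + (1# + Q * (t * v) - 1#) * G
        ≈⟨ solve 4 (λ Q t v G → :1 :+ (:1 :+ Q :* (t :* v) :- :1) :* G := :1 :+ Q :* (t :* (v :* G)))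
            ≈-refl Q t v G ⟩
      1# + Q * (t * (v * G)) ∎)
      where
      Y = y ^ (p ℕ.^ e)
      Q = P^ (suc s ℕ.+ e)

    inverse-≡1 : ∀ {y z a x} → y * z ≈ 1# → y ≈ 1# + a * x → z ≈ 1# + a * (- z * x)
    inverse-≡1 {y} {z} {a} {x} yz≈1 y≈ = begin
      z  ≈⟨ solve 3 (λ z a x → z := (:1 :+ a :* x) :* z :- a :* x :* z) ≈-refl z a x ⟩
      (1# + a * x) * z - a * x * z ≈⟨ +-congʳ (trans (*-congʳ (sym y≈)) yz≈1) ⟩
      1# - a * x * z  ≈⟨ solve 3 (λ z a x → :1 :- a :* x :* z := :1 :+ a :* (:- z :* x)) ≈-refl z a
          x ⟩
      1# + a * (- z * x)     ∎

    inv-^-Integral : ∀ (w : Unit commRing) → Integral (inv w) → ∀ n → Integral (inv (n · w))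
    inv-^-Integral w Iw n = subst Integral (≡.sym (inv-· w n)) (Int.^-mem n Iw)

    -- For negative k, inversion turns the factor t u into t(-z u). Here z is the inverse power,
    -- itself a unit of ℤₚ, so the valuation depends on ∣k∣ only.
    lifting-exponentᵘ : ∀ (w : Unit commRing) → Integral (val w) → Integral (inv w) →
      ∀ {t} → Integral t → val w ≈ 1# + P^ (suc s) * t → ∀ k e m i →
      ℤ.∣ k ∣ ≡ p ℕ.^ e ℕ.* m → + m ℤ.* i ≡ + 1 [mod p ] →
      ∃[ u ] (InvertibleIn Integral u × val (w ^ᵘ k) ≈ 1# + P^ (suc s ℕ.+ e) * (t * u))
    lifting-exponentᵘ w Iw Iw′ It w≈ (+ n) e m i k≡ mi≡1 =
      let u , U , wⁿ≈ = lifting-exponent It w≈ e m i k≡ mi≡1 in u , U , trans (reflexive (val-^ᵘ w n)) wⁿ≈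
    lifting-exponentᵘ w Iw Iw′ {t} It w≈ -[1+ n ] e m i k≡ mi≡1 =
      let u , U , wⁿ≈ = lifting-exponent It w≈ e m i k≡ mi≡1 in - z * u
        , InvertibleIn-* Integral-isSubring
            (invertible (Int.neg-mem Iz) (Int.neg-mem Iwⁿ)
                (trans (solve 2 (λ y z → (:- z) :* (:- y) := y :* z) ≈-refl (val (suc n · w)) z)
                (val*inv (suc n · w)))) U
        , trans (inverse-≡1 (val*inv (suc n · w)) (trans (reflexive (val-^ᵘ w (suc n))) wⁿ≈))
            (+-congˡ (*-congˡ (solve 3 (λ z t u → :- z :* (t :* u) := t :* (:- z :* u)) ≈-refl z t u)))
      where
      z = inv (suc n · w)
      Iz : Integral z
      Iz = inv-^-Integral w Iw′ (suc n)
      Iwⁿ : Integral (val (suc n · w))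
      Iwⁿ = subst Integral (≡.sym (val-^ᵘ w (suc n))) (Int.^-mem (suc n) Iw)

    ^-≡1 : ∀ {y t} → Integral t → y ≈ 1# + P^ (suc s) * t → ∀ n →
           ∃[ t′ ] (Integral t′ × y ^ n ≈ 1# + P^ (suc s) * t′)
    ^-≡1 {y} {t} It y≈ n = t * geo commRing n y
      , Int.*-mem It (Int.geo-mem n (Int.≈-mem (sym y≈)
          (Int.+-mem Int.1-mem (Int.*-mem (Int.int-mem _) It)))) , (begin
      y ^ n  ≈⟨ ^-geo y n ⟩
      1# + (y - 1#) * g  ≈⟨ +-congˡ (*-congʳ (+-congʳ y≈)) ⟩
      1# + (1# + Q * t - 1#) * g  ≈⟨ solve 3
          (λ Q t g → :1 :+ (:1 :+ Q :* t :- :1) :* g := :1 :+ Q :* (t :* g)) ≈-refl Q t g ⟩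
      1# + Q * (t * g)  ∎)
      where
      g = geo commRing n y
      Q = P^ (suc s)

    ^ᵘ-≡1 : ∀ (w : Unit commRing) → Integral (inv w) → ∀ {t} → Integral t → val w ≈ 1# + P^ (suc s) * t →
            ∀ k → ∃[ t′ ] (Integral t′ × val (w ^ᵘ k) ≈ 1# + P^ (suc s) * t′)
    ^ᵘ-≡1 w Iw′ It w≈ (+ n) = let t′ , It′ , e = ^-≡1 It w≈ n in t′ , It′ , trans (reflexive (val-^ᵘ w n)) e
    ^ᵘ-≡1 w Iw′ It w≈ -[1+ n ] = let t′ , It′ , e = ^-≡1 It w≈ (suc n) in - z * t′ , Int.*-mem
                                       (Int.neg-mem (inv-^-Integral w Iw′ (suc n))) It′
        , inverse-≡1 (val*inv (suc n · w)) (trans (reflexive (val-^ᵘ w (suc n))) e)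
      where z = inv (suc n · w)

    -- With q = pʲ and y = ζ^(-q), a primitive p-th root of unity,
    -- 1 + x + … + x^(p-1) vanishes at y and is p times a unit at c^q,
    -- while c^q - y is divisible by ζc - 1.
    P-from-ζc-1 : ℕ.Prime p → ∀ {R J} → IsSubring R → IsIdeal C R J → ∀ {ζ c t} j → R ζ →
      ζ ^ (p ℕ.^ suc j) ≈ 1# → ¬ ζ ^ (p ℕ.^ j) ≈ 1# → Integral t → c ≈ 1# + P^ (suc s) * t →
      J (ζ * c - 1#) → J P
    P-from-ζc-1 pr {R} {J} Rr Ji {ζ} {c} {t} j Rζ ζ^≈1 ζ^≉1 It c≈ Jζc
      = let t′ , It′ , x≈ = ^-≡1 It c≈ (p ℕ.^ j)
            e , Ie , geo≈ = gains It′
        in cancel-invertible (InvertibleIn⊆ Rr (invertible-1+P Ie))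
          (I-resp (trans (sym (geo-sub p x y))
              (trans (+-cong (trans (geo-cong p x≈) geo≈) (-‿cong (geo-root-of-unity p yᵖ≈1 y≉1)))
             (solve 1 (λ a → a :- con (+ 0) := a) ≈-refl _)))
            (*-closedʳ Jx-y (geo-difference-mem p Rx Ry)))
      where
      open IsSubring Rr
      open IsIdeal Ji
      open IdealIn Rr Ji
      q = p ℕ.^ j
      z = ζ ^ q
      x = c ^ q
      -- As z^p = 1, this is the inverse of z; written as a power, it visibly lies in `R`.
      y = z ^ ℕ.pred p
      instance p≢0 = ℕ.prime⇒nonZero pr
      zᵖ≈1 : z ^ p ≈ 1#
      zᵖ≈1 = trans (^-assocʳ ζ q p) (trans (reflexive (cong (ζ ^_) (ℕ.*-comm q p))) ζ^≈1)
      zy≈1 : z * y ≈ 1#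
      zy≈1 = trans (reflexive (cong (z ^_) (ℕ.suc-pred p))) zᵖ≈1
      yᵖ≈1 : y ^ p ≈ 1#
      yᵖ≈1 = trans (^-assocʳ z (ℕ.pred p) p)
          (trans (reflexive (cong (z ^_) (ℕ.*-comm (ℕ.pred p) p))) (^-multiple-1 p (ℕ.pred p) zᵖ≈1))
      y≉1 : ¬ y ≈ 1#
      y≉1 y≈1 = ζ^≉1 (trans (sym (*-identityʳ z)) (trans (*-congˡ (sym y≈1)) zy≈1))
      Rc : R c
      Rc = Integral⊆ Rr (Int.≈-mem (sym c≈) (Int.+-mem Int.1-mem (Int.*-mem (Int.int-mem _) It)))
      Rx : R x
      Rx = ^-mem q Rc
      Ry : R y
      Ry = ^-mem (ℕ.pred p) (^-mem q Rζ)
      -- The difference (ζc)^q - 1 = zx - 1 is a multiple of ζc - 1; multiplying by y, the inverse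
      -- of z, turns it into x - y.
      Jx-y : J (x - y)
      Jx-y = I-resp (begin
          y * ((ζ * c - 1#) * geo commRing q (ζ * c))
            ≈⟨ *-congˡ (solve 1 (λ a → a := (:1 :+ a) :- :1) ≈-refl _) ⟩
          y * (1# + (ζ * c - 1#) * geo commRing q (ζ * c) - 1#)
            ≈⟨ *-congˡ (+-congʳ (trans (sym (^-geo (ζ * c) q)) (^-distrib-* ζ c q))) ⟩
          y * (z * x - 1#)
            ≈⟨ solve 3 (λ x y z → y :* (z :* x :- :1) := (z :* y) :* x :- y) ≈-refl x y z ⟩
          (z * y) * x - y
            ≈⟨ +-congʳ (trans (*-congʳ zy≈1) (*-identityˡ x)) ⟩
          x - y ∎)
        (*-closed Ry (*-closedʳ Jζc (geo-mem q (*-mem Rζ Rc))))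

    -- 1 - ζ = ζ(c - 1) - (ζc - 1), and c - 1 is a multiple of p, which lies in `J` by
    -- `P-from-ζc-1`.
    1-ζ-from-ζc-1 : ℕ.Prime p → ∀ {R J} → IsSubring R → IsIdeal C R J → ∀ {ζ c t} j → R ζ →
      ζ ^ (p ℕ.^ suc j) ≈ 1# → ¬ ζ ^ (p ℕ.^ j) ≈ 1# → Integral t → c ≈ 1# + P^ (suc s) * t →
      J (ζ * c - 1#) → J (1# - ζ)
    1-ζ-from-ζc-1 pr {R} {J} Rr Ji {ζ} {c} {t} j Rζ ζ^≈1 ζ^≉1 It c≈ Jζc = I-resp (begin
        ζ * (P * (P^ s * t)) - (ζ * c - 1#)  ≈⟨ +-congʳ (*-congˡ (*-assoc P (P^ s) t)) ⟨
        ζ * (P * P^ s * t) - (ζ * c - 1#)  ≈⟨ +-congʳ (*-congˡ (*-congʳ (P^-suc s))) ⟨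
        ζ * (P^ (suc s) * t) - (ζ * c - 1#)  ≈⟨ +-congˡ (-‿cong (+-congʳ (*-congˡ c≈))) ⟩
        ζ * (P^ (suc s) * t) - (ζ * (1# + P^ (suc s) * t) - 1#)
          ≈⟨ solve 2 (λ ζ a → ζ :* a :- (ζ :* (:1 :+ a) :- :1) := :1 :- ζ) ≈-refl ζ (P^ (suc s) * t) ⟩
        1# - ζ ∎)
      (sub-closed (*-closed Rζ (*-closedʳ JP (Integral⊆ Rr (Int.*-mem (Int.int-mem _) It)))) Jζc)
      where
      open IsSubring Rr
      open IsIdeal Ji
      open IdealIn Rr Ji
      JP : J P
      JP = P-from-ζc-1 pr Rr Ji j Rζ ζ^≈1 ζ^≉1 It c≈ Jζc

  -- The polynomial 1 + X + ... + X^(n-1) takes the value n at 1 and 0 at ζ, so n is a difference of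
  -- two of its values.
  n∈⟨1-ζ⟩ : ∀ {R} → IsSubring R → ∀ {ζ} n → R ζ → ζ ^ n ≈ 1# → ¬ ζ ≈ 1# → Principal C R (1# - ζ) (int (+ n))
  n∈⟨1-ζ⟩ Rr {ζ} n Rζ ζⁿ≈1 ζ≉1 = geo-difference n 1# ζ , geo-difference-mem n 1-mem Rζ , (begin
    int (+ n)  ≈⟨ geo-1 n ⟨
    geo commRing n 1#  ≈⟨ solve 1 (λ a → a := a :- con (+ 0)) ≈-refl _ ⟩
    geo commRing n 1# - 0#  ≈⟨ +-congˡ (-‿cong (geo-root-of-unity n ζⁿ≈1 ζ≉1)) ⟨
    geo commRing n 1# - geo commRing n ζ ≈⟨ geo-sub n 1# ζ ⟩
    (1# - ζ) * geo-difference n 1# ζ ≈⟨ *-comm _ _ ⟩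
    geo-difference n 1# ζ * (1# - ζ) ∎)
    where open IsSubring Rr

  1-ζ^i∈⟨1-ζ⟩ : ∀ {R} → IsSubring R → ∀ {ζ} i → R ζ → Principal C R (1# - ζ) (1# - ζ ^ i)
  1-ζ^i∈⟨1-ζ⟩ Rr {ζ} i Rζ = geo commRing i ζ , IsSubring.geo-mem Rr i Rζ ,
    trans (sym (geo-telescope i ζ)) (*-comm _ _)

  -- The power ζ^(p^j) is a p-th root of unity other than 1, so 1 - ζ^(p^j) divides p; and 1 - ζ
  -- divides 1 - ζ^(p^j).
  P∈⟨1-ζ⟩ : ∀ {R} → IsSubring R → ∀ {ζ} j → R ζ → ζ ^ (p ℕ.^ suc j) ≈ 1# → ¬ ζ ^ (p ℕ.^ j) ≈ 1# →
            Principal C R (1# - ζ) P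
  P∈⟨1-ζ⟩ Rr {ζ} j Rζ ζ^≈1 ζ^≉1 =
    let r , Rr₁ , e = n∈⟨1-ζ⟩ Rr p (IsSubring.^-mem Rr (p ℕ.^ j) Rζ)
          (trans (^-assocʳ ζ (p ℕ.^ j) p) (trans (reflexive (cong (ζ ^_) (ℕ.*-comm (p ℕ.^ j) p))) ζ^≈1))
              ζ^≉1
        r₂ , Rr₂ , e₂ = 1-ζ^i∈⟨1-ζ⟩ Rr (p ℕ.^ j) Rζ
    in r * r₂ , IsSubring.*-mem Rr Rr₁ Rr₂ , trans e (trans (*-congˡ e₂) (sym (*-assoc r r₂ _)))

  1-from-root-of-unity : ∀ {R J} → IsSubring R → IsIdeal C R J → ∀ {ζ} n y → + n ℤ.* y ≡ + 1 [mod p ] →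
    R ζ → ζ ^ n ≈ 1# → ¬ ζ ≈ 1# → J (ζ - 1#) → J 1#
  1-from-root-of-unity Rr Ji {ζ} n y ny≡1 Rζ ζⁿ≈1 ζ≉1 Jζ
    = let r , Rr′ , e = n∈⟨1-ζ⟩ Rr n Rζ ζⁿ≈1 ζ≉1
          invertible {n⁻¹} _ Ii inv≈ = invertible-mod-p (+ n) y ny≡1 Int.0-mem
      in I-resp (begin
      (- r) * (ζ - 1#) * n⁻¹  ≈⟨ *-congʳ
          (solve 2 (λ r ζ → (:- r) :* (ζ :- :1) := r :* (:1 :- ζ)) ≈-refl r ζ) ⟩
      r * (1# - ζ) * n⁻¹  ≈⟨ *-congʳ e ⟨
      int (+ n) * n⁻¹  ≈⟨ *-congʳ
          (solve 2 (λ a b → a := a :+ b :* con (+ 0)) ≈-refl (int (+ n)) P) ⟩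
      (int (+ n) + P * 0#) * n⁻¹    ≈⟨ inv≈ ⟩
      1#  ∎)
    (*-closedʳ (*-closed (neg-mem Rr′) Jζ) (Integral⊆ Rr Ii))
    where
    open IsSubring Rr
    open IsIdeal Ji
    open IdealIn Rr Ji

-- Arithmetic of units modulo N

-- In a^p - 1 = (a - 1)(1 + a + ... + a^(p-1)) the second factor is p modulo p, hence divisible by
-- p. Only divisibility is claimed, so p = 2 may start at m = 0.
mod-^p : ∀ {p a} m → a ≡ + 1 [mod p ℕ.^ suc m ] → a ℤ.^ p ≡ + 1 [mod p ℕ.^ suc (suc m) ]
mod-^p {p} {a} m a≡1@(mod (ℤ.divides c a-1≡)) with mod-trans (geoℤ-cong p a≡1-mod-p) (≡⇒≡mod (geoℤ-1 p))
  where
  a≡1-mod-p : a ≡ + 1 [mod p ]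
  a≡1-mod-p = mod-weaken (ℕ.m∣m*n (p ℕ.^ m)) a≡1
  geoℤ-1 : ∀ n → geoℤ n (+ 1) ≡ + n
  geoℤ-1 zero    = refl
  geoℤ-1 (suc n) = cong (λ g → + 1 ℤ.+ g) (≡.trans (ℤ.*-identityˡ _) (geoℤ-1 n))
... | mod (ℤ.divides d geo-p≡) = mod (ℤ.divides (c ℤ.* (d ℤ.+ + 1)) (begin
  a ℤ.^ p ℤ.- + 1  ≡⟨ lem₁ (a ℤ.^ p) ⟩
  ℤ.- (+ 1 ℤ.- a ℤ.^ p)  ≡⟨ cong ℤ.-_ (geoℤ-telescope p a) ⟨
  ℤ.- ((+ 1 ℤ.- a) ℤ.* g)  ≡⟨ lem₂ a g (+ p) ⟩
  (a ℤ.- + 1) ℤ.* ((g ℤ.- + p) ℤ.+ + p)  ≡⟨ cong₂ (λ x y → x ℤ.* (y ℤ.+ + p)) a-1≡ geo-p≡ ⟩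
  (c ℤ.* + (p ℕ.^ suc m)) ℤ.* (d ℤ.* + p ℤ.+ + p) ≡⟨ lem₃ c (+ (p ℕ.^ suc m)) d (+ p) ⟩
  (c ℤ.* (d ℤ.+ + 1)) ℤ.* (+ p ℤ.* + (p ℕ.^ suc m))
    ≡⟨ cong ((c ℤ.* (d ℤ.+ + 1)) ℤ.*_) (ℤ.pos-* p (p ℕ.^ suc m)) ⟨
  (c ℤ.* (d ℤ.+ + 1)) ℤ.* + (p ℕ.^ suc (suc m)) ∎))
  where
  open ≡.≡-Reasoning
  g = geoℤ p a
  lem₁ : ∀ x → x ℤ.- + 1 ≡ ℤ.- (+ 1 ℤ.- x)
  lem₁ = ℤ-solver.solve-∀
  lem₂ : ∀ a g p → ℤ.- ((+ 1 ℤ.- a) ℤ.* g) ≡ (a ℤ.- + 1) ℤ.* ((g ℤ.- p) ℤ.+ p)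
  lem₂ = ℤ-solver.solve-∀
  lem₃ : ∀ c P d p → (c ℤ.* P) ℤ.* (d ℤ.* p ℤ.+ p) ≡ (c ℤ.* (d ℤ.+ + 1)) ℤ.* (p ℤ.* P)
  lem₃ = ℤ-solver.solve-∀

mod-^p^ : ∀ {p a} m e → a ≡ + 1 [mod p ℕ.^ suc m ] → a ℤ.^ (p ℕ.^ e) ≡ + 1 [mod p ℕ.^ (suc m ℕ.+ e) ]
mod-^p^ {p} {a} m zero a≡1 = subst (λ k → a ℤ.* + 1 ≡ + 1 [mod p ℕ.^ k ]) (≡.sym (ℕ.+-identityʳ (suc m)))
  (mod-trans (≡⇒≡mod (ℤ.*-identityʳ a)) a≡1)
mod-^p^ {p} {a} m (suc e) a≡1 = subst (λ k → a ℤ.^ (p ℕ.* p ℕ.^ e) ≡ + 1 [mod p ℕ.^ k ])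
    (≡.sym (ℕ.+-suc (suc m) e))
  (mod-trans (≡⇒≡mod (≡.trans (cong (a ℤ.^_) (ℕ.*-comm p (p ℕ.^ e))) (≡.sym (ℤ.^-*-assoc a (p ℕ.^ e) p))))
    (mod-^p {p} (m ℕ.+ e) (mod-^p^ {p} m e a≡1)))

mod-square : ∀ p m c → (+ (p ℕ.^ suc m)) ℤ.* (+ (p ℕ.^ suc m)) ℤ.* c ≡ + 0 [mod p ℕ.^ suc (suc m) ]
mod-square p m c = mod (ℤ.divides (+ (p ℕ.^ m) ℤ.* c) (≡.trans
  (cong (λ x → x ℤ.* + (p ℕ.^ suc m) ℤ.* c ℤ.- + 0) (ℤ.pos-* p (p ℕ.^ m)))
  (≡.trans (lem (+ p) (+ (p ℕ.^ m)) (+ (p ℕ.^ suc m)) c)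
    (cong (+ (p ℕ.^ m) ℤ.* c ℤ.*_) (≡.sym (ℤ.pos-* p (p ℕ.^ suc m)))))))
  where
  lem : ∀ p a b c → p ℤ.* a ℤ.* b ℤ.* c ℤ.- + 0 ≡ a ℤ.* c ℤ.* (p ℤ.* b)
  lem = ℤ-solver.solve-∀

mod-binomial : ∀ p m μ i → (+ 1 ℤ.+ + (p ℕ.^ suc m) ℤ.* μ) ℤ.^ i ≡
               + 1 ℤ.+ + (p ℕ.^ suc m) ℤ.* (+ i ℤ.* μ) [mod p ℕ.^ suc (suc m) ]
mod-binomial p m μ zero    = ≡⇒≡mod (lem (+ (p ℕ.^ suc m)) μ)
  where
  lem : ∀ P μ → + 1 ≡ + 1 ℤ.+ P ℤ.* (+ 0 ℤ.* μ)
  lem = ℤ-solver.solve-∀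
mod-binomial p m μ (suc i) = mod-trans (mod-* {x = y} {y = y} mod-refl (mod-binomial p m μ i))
  (mod-trans (≡⇒≡mod (lem Q μ (+ i)))
    (mod-trans (mod-+ {x = + 1 ℤ.+ Q ℤ.* ((+ 1 ℤ.+ + i) ℤ.* μ)} mod-refl
        (mod-square p m (μ ℤ.* (+ i ℤ.* μ))))
      (≡⇒≡mod (ℤ.+-identityʳ _))))
  where
  Q = + (p ℕ.^ suc m)
  y = + 1 ℤ.+ Q ℤ.* μ
  lem : ∀ Q μ i → (+ 1 ℤ.+ Q ℤ.* μ) ℤ.* (+ 1 ℤ.+ Q ℤ.* (i ℤ.* μ)) ≡
          (+ 1 ℤ.+ Q ℤ.* ((+ 1 ℤ.+ i) ℤ.* μ)) ℤ.+ Q ℤ.* Q ℤ.* (μ ℤ.* (i ℤ.* μ))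
  lem = ℤ-solver.solve-∀

≡mod⇒≡-≤ : ∀ {m n N} → m ℕ.≤ n → n ℕ.< N → + n ≡ + m [mod N ] → m ≡ n
≡mod⇒≡-≤ {m} {n} {N} m≤n n<N (mod d) with n ℕ.∸ m in n-m≡
... | zero  = ℕ.≤-antisym m≤n (ℕ.m∸n≡0⇒m≤n n-m≡)
... | suc e = contradiction (ℕ.∣⇒≤ (subst (N ℕ.∣_)
        (≡.trans (≡.trans (ℤ.∣m⊖n∣≡∣n⊖m∣ n m) (ℤ.∣⊖∣-≤ m≤n)) n-m≡)
        (subst (λ z → N ℕ.∣ ℤ.∣ z ∣) (ℤ.m-n≡m⊖n n m) (ℤ.∣⇒∣ᵤ d))))
      (ℕ.<⇒≱ (ℕ.≤-<-trans (subst (ℕ._≤ n) n-m≡ (ℕ.m∸n≤m n m)) n<N))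

≡mod⇒≡ : ∀ {m n N} → m ℕ.< N → n ℕ.< N → + m ≡ + n [mod N ] → m ≡ n
≡mod⇒≡ {m} {n} m<N n<N m≡n with ℕ.≤-total m n
... | inj₁ m≤n = ≡mod⇒≡-≤ m≤n n<N (mod-sym m≡n)
... | inj₂ n≤m = ≡.sym (≡mod⇒≡-≤ n≤m m<N m≡n)

≡%ℕ : ∀ a N .{{_ : ℕ.NonZero N}} → a ≡ + (a ℤ.%ℕ N) [mod N ]
≡%ℕ a N = mod (ℤ.divides (a ℤ./ℕ N)
    (≡.trans (cong (ℤ._- + (a ℤ.%ℕ N)) (ℤ.a≡a%ℕn+[a/ℕn]*n a N)) (lem (+ (a ℤ.%ℕ N)) (a ℤ./ℕ N ℤ.* + N))))
  where
  lem : ∀ x y → x ℤ.+ y ℤ.- x ≡ y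
  lem = ℤ-solver.solve-∀

≡mod? : ∀ x y N → Dec (x ≡ y [mod N ])
≡mod? x y N with + N ℤ.∣? x ℤ.- y
... | yes d = yes (mod d)
... | no ¬d = no λ (mod d) → ¬d d

unit≢0 : ∀ {N} → 1 ℕ.< N → (u : Unit (ℤ/ N)) → ¬ val u ≡ + 0 [mod N ]
unit≢0 {N} 1<N u u≡0 = contradiction
  (≡mod⇒≡ (ℕ.<-trans (ℕ.s≤s ℕ.z≤n) 1<N) 1<N
    (mod-trans (mod-sym (mod-* {u = inv u} {v = inv u} u≡0 mod-refl)) (val*inv u)))
  λ ()

abstract
  ^-inverse : ∀ {N} a b n → a ℤ.* b ≡ + 1 [mod N ] → a ℤ.^ n ℤ.* b ℤ.^ n ≡ + 1 [mod N ]
  ^-inverse a b n ab≡1 = mod-trans (≡⇒≡mod (≡.sym (^-distrib a b n)))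
    (mod-trans (mod-^ ab≡1 n) (≡⇒≡mod (ℤ.^-zeroˡ n)))

^-unit : ∀ {N} → Unit (ℤ/ N) → ℕ → Unit (ℤ/ N)
^-unit u n = record
  { val = val u ℤ.^ n ; inv = inv u ℤ.^ n ; val*inv = ^-inverse (val u) (inv u) n (val*inv u) }

-- Newton's step for the inverse.
abstract
  newton-inverse : ∀ p m a b → a ℤ.* b ≡ + 1 [mod p ℕ.^ suc m ] →
                   a ℤ.* (b ℤ.* (+ 2 ℤ.- a ℤ.* b)) ≡ + 1 [mod p ℕ.^ suc (suc m) ]
  newton-inverse p m a b (mod (ℤ.divides c e)) =
    mod-trans (≡⇒≡mod (≡.trans (lem₁ a b) (cong (λ x → + 1 ℤ.- x ℤ.* x) e)))
      (mod-trans (≡⇒≡mod (lem₂ c (+ (p ℕ.^ suc m))))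
        (mod-+ {x = + 1} {y = + 1} mod-refl (mod-neg (mod-square p m (c ℤ.* c)))))
    where
    lem₁ : ∀ a b → a ℤ.* (b ℤ.* (+ 2 ℤ.- a ℤ.* b)) ≡ + 1 ℤ.- (a ℤ.* b ℤ.- + 1) ℤ.* (a ℤ.* b ℤ.- + 1)
    lem₁ = ℤ-solver.solve-∀
    lem₂ : ∀ c Q → + 1 ℤ.- (c ℤ.* Q) ℤ.* (c ℤ.* Q) ≡ + 1 ℤ.+ ℤ.- (Q ℤ.* Q ℤ.* (c ℤ.* c))
    lem₂ = ℤ-solver.solve-∀

-- The integer representing the unit is kept and only its inverse corrected, so that reduction
-- followed by lifting changes no residue.
lift-unit : ∀ p m → Unit (ℤ/ (p ℕ.^ suc m)) → Unit (ℤ/ (p ℕ.^ suc (suc m)))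
lift-unit p m u = record
  { val = val u ; inv = inv u ℤ.* (+ 2 ℤ.- val u ℤ.* inv u)
  ; val*inv = newton-inverse p m (val u) (inv u) (val*inv u) }

crt : ∀ {M N} → ℕ.Coprime M N → ∀ x y →
      ∃[ z ] ((∀ {a b} → x ≡ a [mod M ] → y ≡ b [mod N ] → z ≡ a [mod M ] × z ≡ b [mod N ]))
crt {M} {N} c x y with bézout c
... | m , n , e = x ℤ.* (n ℤ.* + N) ℤ.+ y ℤ.* (m ℤ.* + M) , λ x≡a y≡b →
  mod-trans (mod (ℤ.divides ((y ℤ.- x) ℤ.* m)
      (≡.trans (cong (λ t → x ℤ.* t ℤ.+ y ℤ.* (m ℤ.* + M) ℤ.- x) nN≡) (lem₁ x y m (+ M))))) x≡a ,
  mod-trans (mod (ℤ.divides ((x ℤ.- y) ℤ.* n)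
      (≡.trans (cong (λ t → x ℤ.* (n ℤ.* + N) ℤ.+ y ℤ.* t ℤ.- y) mM≡) (lem₂ x y n (+ N))))) y≡b
  where
  lem : ∀ a b → b ≡ (a ℤ.+ b) ℤ.- a
  lem = ℤ-solver.solve-∀
  lem′ : ∀ a b → a ≡ (a ℤ.+ b) ℤ.- b
  lem′ = ℤ-solver.solve-∀
  nN≡ : n ℤ.* + N ≡ + 1 ℤ.- m ℤ.* + M
  nN≡ = ≡.trans (lem (m ℤ.* + M) (n ℤ.* + N)) (cong (ℤ._- m ℤ.* + M) e)
  mM≡ : m ℤ.* + M ≡ + 1 ℤ.- n ℤ.* + N
  mM≡ = ≡.trans (lem′ (m ℤ.* + M) (n ℤ.* + N)) (cong (ℤ._- n ℤ.* + N) e)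
  lem₁ : ∀ x y m M → x ℤ.* (+ 1 ℤ.- m ℤ.* M) ℤ.+ y ℤ.* (m ℤ.* M) ℤ.- x ≡ (y ℤ.- x) ℤ.* m ℤ.* M
  lem₁ = ℤ-solver.solve-∀
  lem₂ : ∀ x y n N → x ℤ.* (n ℤ.* N) ℤ.+ y ℤ.* (+ 1 ℤ.- n ℤ.* N) ℤ.- y ≡ (x ℤ.- y) ℤ.* n ℤ.* N
  lem₂ = ℤ-solver.solve-∀

≡mod-* : ∀ {M N x y} → ℕ.Coprime M N → x ≡ y [mod M ] → x ≡ y [mod N ] → x ≡ y [mod M ℕ.* N ]
≡mod-* {M} {N} {x} {y} c (mod d) (mod e) = mod (ℤ.∣ᵤ⇒∣ (combine (ℤ.∣⇒∣ᵤ d) (ℤ.∣⇒∣ᵤ e)))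
  where
  combine : M ℕ.∣ ℤ.∣ x ℤ.- y ∣ → N ℕ.∣ ℤ.∣ x ℤ.- y ∣ → M ℕ.* N ℕ.∣ ℤ.∣ x ℤ.- y ∣
  combine (ℕ.divides q e) N∣ = subst (M ℕ.* N ℕ.∣_) (≡.trans (ℕ.*-comm M q) (≡.sym e))
    (ℕ.*-monoʳ-∣ M (ℕ.coprime-divisor {o = q} (ℕ.sym c) (subst (N ℕ.∣_) (≡.trans e (ℕ.*-comm q M)) N∣)))

crt-unit : ∀ {M N} → ℕ.Coprime M N → (a : Unit (ℤ/ M)) (b : Unit (ℤ/ N)) →
           ∃[ u ] (val {ℤ/ (M ℕ.* N)} u ≡ val a [mod M ] × val u ≡ val b [mod N ])
crt-unit {M} {N} c a b =
  let z , z≡ = crt c (val a) (val b)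
      i , i≡ = crt c (inv a) (inv b)
      z≡a , z≡b = z≡ mod-refl mod-refl
      i≡a , i≡b = i≡ mod-refl mod-refl
  in record { val = z ; inv = i ; val*inv = ≡mod-* c
        (mod-trans (mod-* z≡a i≡a) (val*inv a)) (mod-trans (mod-* z≡b i≡b) (val*inv b)) }
   , z≡a , z≡b

module UnitSearch (N : ℕ) .{{_ : ℕ.NonZero N}} where
  residue : ℤ → Fin N
  residue a = Fin.fromℕ< (ℤ.n%ℕd<d a N)

  residue-≡ : ∀ a → a ≡ + Fin.toℕ (residue a) [mod N ]
  residue-≡ a = mod-trans (≡%ℕ a N) (≡⇒≡mod (cong +_ (≡.sym (Fin.toℕ-fromℕ< (ℤ.n%ℕd<d a N)))))

  -- A unit carries its inverse as data, so the search runs over pairs of residues with product 1.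
  -- Invariance of S under congruence moves a given unit to such a pair.
  any-unit? : (S : Unit (ℤ/ N) → Set) → (∀ {u w} → val u ≡ val w [mod N ] → S u → S w) →
              (∀ u → Dec (S u)) → Dec (∃[ u ] S u)
  any-unit? S S-resp S? with Fin.any? (λ i → Fin.any? (λ j → witness? i j))
    where
    Witness : Fin N → Fin N → Set
    Witness i j = Σ ((+ Fin.toℕ i ℤ.* + Fin.toℕ j) ≡ + 1 [mod N ]) λ e →
      S (record { val = + Fin.toℕ i ; inv = + Fin.toℕ j ; val*inv = e })
    witness? : ∀ i j → Dec (Witness i j)
    witness? i j with ≡mod? (+ Fin.toℕ i ℤ.* + Fin.toℕ j) (+ 1) N
    ... | no ¬e = no λ (e , _) → ¬e e
    ... | yes e with S? (record { val = + Fin.toℕ i ; inv = + Fin.toℕ j ; val*inv = e })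
    ...   | yes s = yes (e , s)
    ...   | no ¬s = no λ (e′ , s) → ¬s (S-resp mod-refl s)
  ... | yes (i , j , e , s) = yes (_ , s)
  ... | no none = no λ (u , s) → none (residue (val u) , residue (inv u)
      , mod-trans (mod-sym (mod-* (residue-≡ (val u)) (residue-≡ (inv u)))) (val*inv u)
      , S-resp (residue-≡ (val u)) s)

  -- Two of the N + 1 powers a^0, ..., a^N agree, so a^d ≡ 1 for some 0 < d ≤ N, and d divides N!.
  -- This crude exponent suffices, as it is only split into a power of 2 and an odd factor later.
  unit-exponent : (u : Unit (ℤ/ N)) → val u ℤ.^ (N ℕ.!) ≡ + 1 [mod N ]
  unit-exponent u with Fin.pigeonhole (ℕ.n<1+n N) (λ i → residue (val u ℤ.^ Fin.toℕ i))
  ... | i , j , i<j , same = power-divides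
      (dvd (j′ ℕ.∸ i′) (ℕ.m<n⇒0<n∸m i<j) (ℕ.≤-trans (ℕ.m∸n≤m j′ i′) (ℕ.≤-pred (Fin.toℕ<n j))))
    where
    i′ = Fin.toℕ i
    j′ = Fin.toℕ j
    dvd : ∀ d → 0 ℕ.< d → d ℕ.≤ N → d ℕ.∣ N ℕ.!
    dvd (suc d) _ d≤N = ℕ.∣-trans (ℕ.m∣m*n (d ℕ.!)) (ℕ.m≤n⇒m!∣n! d≤N)
    a = val u
    b = inv u
    aⁱ≡aʲ : a ℤ.^ j′ ≡ a ℤ.^ i′ [mod N ]
    aⁱ≡aʲ = mod-trans (residue-≡ (a ℤ.^ j′))
        (mod-trans (≡⇒≡mod (cong (λ x → + Fin.toℕ x) (≡.sym same))) (mod-sym (residue-≡ (a ℤ.^ i′))))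
    aⁱbⁱ≡1 : a ℤ.^ i′ ℤ.* b ℤ.^ i′ ≡ + 1 [mod N ]
    aⁱbⁱ≡1 = val*inv (^-unit u i′)
    a^[j-i]≡1 : a ℤ.^ (j′ ℕ.∸ i′) ≡ + 1 [mod N ]
    a^[j-i]≡1 = mod-trans (mod-sym (mod-trans (mod-* {x = a ℤ.^ (j′ ℕ.∸ i′)} mod-refl aⁱbⁱ≡1)
        (≡⇒≡mod (ℤ.*-identityʳ _))))
      (mod-trans (≡⇒≡mod (≡.trans (lem (a ℤ.^ (j′ ℕ.∸ i′)) (a ℤ.^ i′) (b ℤ.^ i′))
          (cong (ℤ._* b ℤ.^ i′) (≡.trans (≡.sym (ℤ.^-distribˡ-+-* a i′ (j′ ℕ.∸ i′)))
              (cong (a ℤ.^_) (ℕ.m+[n∸m]≡n (ℕ.<⇒≤ i<j)))))))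
        (mod-trans (mod-* {u = b ℤ.^ i′} {v = b ℤ.^ i′} aⁱ≡aʲ mod-refl) aⁱbⁱ≡1))
      where
      lem : ∀ x y z → x ℤ.* (y ℤ.* z) ≡ (y ℤ.* x) ℤ.* z
      lem = ℤ-solver.solve-∀
    power-divides : (j′ ℕ.∸ i′) ℕ.∣ N ℕ.! → a ℤ.^ (N ℕ.!) ≡ + 1 [mod N ]
    power-divides (ℕ.divides q e) = mod-trans
        (≡⇒≡mod (≡.trans (cong (a ℤ.^_) (≡.trans e (ℕ.*-comm q _))) (≡.sym (ℤ.^-*-assoc a (j′ ℕ.∸ i′) q))))
      (mod-trans (mod-^ a^[j-i]≡1 q) (≡⇒≡mod (ℤ.^-zeroˡ q)))

-- Dirichlet characters

module Characters {p : ℕ} (C : ℂₚ p) where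
  open ℂₚ C hiding (zero) renaming (refl to ≈-refl)
  open Field C
  open Roots C
  open Padic p
  open OneUnits C
  open AddSupremum ℚ._≤_ using (_≤⊤⁺)
  open import Relation.Binary.Reasoning.Setoid setoid

  -- The valuation of 0 is ∞, above every n, and `ord-ι` turns the bound n into a congruence modulo
  -- p^n.
  ι≈0⇒≡0 : ∀ {z} → ι z ≈ 0# → ∀ n → seq z n ≡ + 0 [mod p ℕ.^ n ]
  ι≈0⇒≡0 {z} ιz≈0 n = Equivalence.to (ord-ι z n)
    (subst (fromℕ∞ n ≤∞_) (≡.sym (Equivalence.from (ord-∞ (ι z)) ιz≈0)) (fromℕ∞ n ≤⊤⁺))

  ι-injective : ∀ {y z} → ι y ≈ ι z → ∀ n → seq y n ≡ seq z n [mod p ℕ.^ n ]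
  ι-injective {y} {z} ιy≈ιz n = mod-trans (≡⇒≡mod (lem (seq y n) (seq z n)))
    (mod-trans (mod-+ {u = seq z n} {v = seq z n} (y-z≡0 n) mod-refl) (≡⇒≡mod (ℤ.+-identityˡ _)))
    where
    open CommutativeRing (ℤₚ-ring p) using () renaming (_+_ to _+ₚ_; -_ to -ₚ_)
    lem : ∀ y z → y ≡ (y ℤ.+ ℤ.- z) ℤ.+ z
    lem = ℤ-solver.solve-∀
    y-z≡0 : ∀ n → (seq y n ℤ.+ ℤ.- seq z n) ≡ + 0 [mod p ℕ.^ n ]
    y-z≡0 = ι≈0⇒≡0 (trans (ι-+ y (-ₚ z)) (trans (+-cong ιy≈ιz (ι-neg z)) (-‿inverseʳ (ι z))))

  int-^ : ∀ a n → int (a ℤ.^ n) ≈ int a ^ n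
  int-^ a zero    = int-1
  int-^ a (suc n) = trans (int-* a (a ℤ.^ n)) (*-congˡ (int-^ a n))

  infix 9 _⟨_⟩

  _⟨_⟩ : ∀ {N} → Character C N → Unit (ℤ/ N) → Carrier
  χ ⟨ u ⟩ = val (⟦ χ ⟧ u)

  module _ {N} (χ : Character C N) where
    private module χ = GroupMorphisms.IsGroupHomomorphism (Character.isHom χ)

    χ-cong : ∀ {u w} → val u ≡ val w [mod N ] → χ ⟨ u ⟩ ≈ χ ⟨ w ⟩
    χ-cong {u} {w} e = χ.⟦⟧-cong {u} {w} e

    χ-∙ : ∀ u w {t} → val t ≡ val u ℤ.* val w [mod N ] → χ ⟨ t ⟩ ≈ χ ⟨ u ⟩ * χ ⟨ w ⟩
    χ-∙ u w {t} e = trans (χ-cong {t} {AbelianGroup._∙_ ((ℤ/ N) ˣ) u w} e) (χ.homo u w)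

    χ-1 : ∀ {u} → val u ≡ + 1 [mod N ] → χ ⟨ u ⟩ ≈ 1#
    χ-1 {u} e = trans (χ-cong {u} {AbelianGroup.ε ((ℤ/ N) ˣ)} e) χ.ε-homo

    χ-^ : ∀ u n {t} → val t ≡ val u ℤ.^ n [mod N ] → χ ⟨ t ⟩ ≈ χ ⟨ u ⟩ ^ n
    χ-^ u zero    {t} e = χ-1 {t} e
    χ-^ u (suc n) {t} e = trans (χ-∙ u (^-unit u n) {t} e) (*-congˡ (χ-^ u n {^-unit u n} mod-refl))

    χ-^≈1 : ∀ u n → val u ℤ.^ n ≡ + 1 [mod N ] → χ ⟨ u ⟩ ^ n ≈ 1#
    χ-^≈1 u n e = trans (sym (χ-^ u n {^-unit u n} mod-refl)) (χ-1 {^-unit u n} e)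

    χ-≡ : ∀ u w → (∀ d → val d ≡ val u ℤ.* inv w [mod N ] → χ ⟨ d ⟩ ≈ 1#) → χ ⟨ u ⟩ ≈ χ ⟨ w ⟩
    χ-≡ u w χ≈1 = begin
      χ ⟨ u ⟩  ≈⟨ χ-∙ d w {u} (mod-trans (≡⇒≡mod (≡.sym (ℤ.*-identityʳ _)))
                                (mod-trans (mod-* {x = val u} mod-refl (mod-sym (val*inv w)))
                                  (≡⇒≡mod (lem (val u) (val w) (inv w))))) ⟩
      χ ⟨ d ⟩ * χ ⟨ w ⟩    ≈⟨ *-congʳ (χ≈1 d mod-refl) ⟩
      1# * χ ⟨ w ⟩  ≈⟨ *-identityˡ _ ⟩
      χ ⟨ w ⟩  ∎
      where
      open AbelianGroup ((ℤ/ N) ˣ) using (_∙_; _⁻¹)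
      d = u ∙ (w ⁻¹)
      lem : ∀ u w v → u ℤ.* (w ℤ.* v) ≡ (u ℤ.* v) ℤ.* w
      lem = ℤ-solver.solve-∀

  character : ∀ {N} (f : Unit (ℤ/ N) → Unit commRing) →
    (∀ u w → val u ≡ val w [mod N ] → val (f u) ≈ val (f w)) →
    (∀ u w t → val t ≡ val u ℤ.* val w → val (f t) ≈ val (f u) * val (f w)) → Character C N
  character {N} f f-cong f-∙ = record
    { ⟦_⟧ = f
    ; isHom = record
      { isMonoidHomomorphism = record
        { isMagmaHomomorphism = record
          { isRelHomomorphism = record { cong = λ {u} {w} → f-cong u w }
          ; homo = λ u w → f-∙ u w _ refl }
        ; ε-homo = f-ε }
      ; ⁻¹-homo = λ u → *-cancelˡ (unit≉0 (f u)) (trans (sym (f-∙ u (u ⁻¹) (u ∙ (u ⁻¹)) refl))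
          (trans (f-cong (u ∙ (u ⁻¹)) ε (val*inv u)) (trans f-ε (sym (val*inv (f u)))))) } }
    where
    open AbelianGroup ((ℤ/ N) ˣ) using (ε; _∙_; _⁻¹)
    f-ε : val (f ε) ≈ 1#
    f-ε = *-cancelˡ (unit≉0 (f ε)) (trans (sym (f-∙ ε ε ε refl)) (sym (*-identityʳ _)))

  -- The trivial character factors through modulus 1.
  primitive-nontrivial : ∀ {N} (χ : Character C N) → Primitive χ → N ≢ 1 → ¬ (∀ u → χ ⟨ u ⟩ ≈ 1#)
  primitive-nontrivial {N} χ χ-primitive N≢1 χ≈1 =
    N≢1 (≡.sym (χ-primitive (ℕ.1∣ N)
        (character (λ _ → 1ᵘ) (λ _ _ _ → ≈-refl) (λ _ _ _ _ → sym (*-identityˡ 1#)) , χ≈1)))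
    where
    1ᵘ : Unit commRing
    1ᵘ = AbelianGroup.ε (commRing ˣ)

  -- The factor is χ evaluated at `lift-unit`, a section of the reduction. Triviality of χ on the
  -- kernel makes it independent of the representative.
  factors-through : ∀ m (χ : Character C (p ℕ.^ suc (suc m))) →
    (∀ u → val u ≡ + 1 [mod p ℕ.^ suc m ] → χ ⟨ u ⟩ ≈ 1#) →
    FactorsThrough {N = p ℕ.^ suc (suc m)} {M = p ℕ.^ suc m} (ℕ.n∣m*n p) χ
  factors-through m χ χ≈1 = character (λ u → ⟦ χ ⟧ (lift u)) cong-lift
      (λ u w t e → χ-∙ χ (lift u) (lift w) {lift t} (≡⇒≡mod e))
    , λ u → χ-cong χ {u} {lift (reduce pᵐ⁺¹∣pᵐ⁺² u)} mod-refl
    where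
    lift = lift-unit p m
    pᵐ⁺¹∣pᵐ⁺² = ℕ.n∣m*n p {p ℕ.^ suc m}
    cong-lift : ∀ u w → val u ≡ val w [mod p ℕ.^ suc m ] → χ ⟨ lift u ⟩ ≈ χ ⟨ lift w ⟩
    cong-lift u w u≡w = χ-≡ χ (lift u) (lift w) λ d d≡ → χ≈1 d
      (mod-trans (mod-weaken pᵐ⁺¹∣pᵐ⁺² d≡) (mod-trans
        (mod-* {u = inv (lift w)} {v = inv (lift w)}
          u≡w mod-refl)
        (mod-weaken pᵐ⁺¹∣pᵐ⁺² (val*inv (lift w)))))

  abstract
    one-plus-P^ : ℕ.Prime p → ∀ r → ∃[ γ ] ∀ n → seq {p} (valₚ γ) n ≡ + 1 ℤ.+ + (p ℕ.^ suc r)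
    one-plus-P^ pr r = unitₚ x (+ 1) x≡1 , λ n → cong (λ z → seq z n) (val-unitₚ x (+ 1) x≡1)
      where
      x : ℤₚ p
      x = fromℤ (+ 1 ℤ.+ + (p ℕ.^ suc r))
      lem : ∀ a b → (+ 1 ℤ.+ a ℤ.* b) ℤ.* + 1 ℤ.- + 1 ≡ b ℤ.* a
      lem = ℤ-solver.solve-∀
      x≡1 : (+ 1 ℤ.+ + (p ℕ.^ suc r)) ℤ.* + 1 ≡ + 1 [mod p ]
      x≡1 = mod (ℤ.divides (+ (p ℕ.^ r)) (≡.trans
        (cong (λ y → (+ 1 ℤ.+ y) ℤ.* + 1 ℤ.- + 1) (ℤ.pos-* p (p ℕ.^ r))) (lem (+ p) (+ (p ℕ.^ r)))))

  module _ (pr : ℕ.Prime p) (r : ℕ) (gains : GainsOneFactor (suc r)) where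
    open Gain r gains

    private instance
      p≢0 = ℕ.prime⇒nonZero pr

    -- (1 + p^(r+1))^(p^j) ≡ 1 + p^(r+1+j) μ with μ invertible, so its powers
    -- exhaust the units ≡ 1 modulo p^(r+1+j).
    one-plus-generates : ∀ j (u : ℤ) → u ≡ + 1 [mod p ℕ.^ suc (r ℕ.+ j) ] →
      ∃[ i ] u ≡ (+ 1 ℤ.+ + (p ℕ.^ suc r)) ℤ.^ (p ℕ.^ j ℕ.* i) [mod p ℕ.^ suc (suc (r ℕ.+ j)) ]
    one-plus-generates j u (mod (ℤ.divides t u-1≡))
      = let w , invertible {w⁻¹} (μ , ιμ≈w) (ν , ιν≈w⁻¹) ww⁻¹≈1 , a^≈ =
              lifting-exponent {int a} {1#} Int.1-mem int-a≈ {p ℕ.^ j} j 1 (+ 1) (≡.sym (ℕ.*-identityʳ _))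
                  mod-refl
            μν≡1 : ∀ n → seq μ n ℤ.* seq ν n ≡ + 1 [mod p ℕ.^ n ]
            μν≡1 = ι-injective {CommutativeRing._*_ (ℤₚ-ring p) μ ν} {fromℤ (+ 1)}
              (trans (ι-* μ ν) (trans (*-cong ιμ≈w ιν≈w⁻¹) (trans ww⁻¹≈1 (sym ι-1))))
            a^≡ : a ℤ.^ (p ℕ.^ j) ≡ + 1 ℤ.+ Q ℤ.* seq μ m [mod p ℕ.^ m ]
            a^≡ = mod-trans (ι-injective {fromℤ (a ℤ.^ (p ℕ.^ j))} {affine (+ 1) Q μ} (begin
                    ι (fromℤ (a ℤ.^ (p ℕ.^ j)))  ≡⟨ int≡ι _ ⟨
                    int (a ℤ.^ (p ℕ.^ j))  ≈⟨ int-^ a (p ℕ.^ j) ⟩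
                    int a ^ (p ℕ.^ j)  ≈⟨ a^≈ ⟩
                    1# + int Q * (1# * w)  ≈⟨ +-cong (sym int-1)
                        (*-congˡ (trans (*-identityˡ w) (sym ιμ≈w))) ⟩
                    int (+ 1) + int Q * ι μ      ≈⟨ ι-affine (+ 1) Q μ ⟨
                    ι (affine (+ 1) Q μ)  ∎) m)
                  (≡⇒≡mod (seq-affine (+ 1) Q μ m))
        in finish (seq μ m) (seq ν m) (μν≡1 m) a^≡
      where
      m = suc (suc (r ℕ.+ j))
      a = + 1 ℤ.+ + (p ℕ.^ suc r)
      Q = + (p ℕ.^ suc (r ℕ.+ j))
      int-a≈ : int a ≈ 1# + P^ (suc r) * 1#
      int-a≈ = trans (int-+ (+ 1) (+ (p ℕ.^ suc r))) (+-cong int-1 (sym (*-identityʳ _)))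
      finish : ∀ μ ν → μ ℤ.* ν ≡ + 1 [mod p ℕ.^ m ] → a ℤ.^ (p ℕ.^ j) ≡ + 1 ℤ.+ Q ℤ.* μ [mod p ℕ.^ m ] →
               ∃[ i ] u ≡ a ℤ.^ (p ℕ.^ j ℕ.* i) [mod p ℕ.^ m ]
      finish μ ν μν≡1 a^≡ = i , mod-sym (mod-trans (≡⇒≡mod (≡.sym (ℤ.^-*-assoc a (p ℕ.^ j) i)))
          (mod-trans (mod-^ a^≡ i) (mod-trans (mod-binomial p (r ℕ.+ j) μ i) (iμ⇒u iμ≡t))))
        where
        -- With u = 1 + Qt and the i-th power equal to 1 + Q·iμ modulo pQ, what is wanted is iμ ≡ t
        -- modulo p; ν is the inverse of μ.
        i = (t ℤ.* ν) ℤ.%ℕ p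
        lem₁ : ∀ t ν μ → t ℤ.* ν ℤ.* μ ≡ t ℤ.* (μ ℤ.* ν)
        lem₁ = ℤ-solver.solve-∀
        lem₂ : ∀ Q x t u → + 1 ℤ.+ Q ℤ.* x ℤ.- u ≡ (+ 1 ℤ.+ Q ℤ.* (x ℤ.- t)) ℤ.+ Q ℤ.* t ℤ.- u
        lem₂ = ℤ-solver.solve-∀
        lem₃ : ∀ Q c p t u → (+ 1 ℤ.+ Q ℤ.* (c ℤ.* p)) ℤ.+ t ℤ.* Q ℤ.- u ≡ c ℤ.* (p ℤ.* Q) ℤ.+
            (t ℤ.* Q ℤ.- (u ℤ.- + 1))
        lem₃ = ℤ-solver.solve-∀
        iμ≡t : + i ℤ.* μ ≡ t [mod p ]
        iμ≡t = mod-trans (mod-* {u = μ} {v = μ} (mod-sym (≡%ℕ (t ℤ.* ν) p)) mod-refl)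
          (mod-trans (≡⇒≡mod (lem₁ t ν μ))
            (mod-trans (mod-* {x = t} {y = t} mod-refl (mod-weaken (ℕ.m∣m*n (p ℕ.^ suc (r ℕ.+ j))) μν≡1))
              (≡⇒≡mod (ℤ.*-identityʳ t))))
        iμ⇒u : + i ℤ.* μ ≡ t [mod p ] → + 1 ℤ.+ Q ℤ.* (+ i ℤ.* μ) ≡ u [mod p ℕ.^ m ]
        iμ⇒u (mod (ℤ.divides c e)) = mod (ℤ.divides c (≡.trans (lem₂ Q (+ i ℤ.* μ) t u)
          (≡.trans (cong₂ (λ x y → (+ 1 ℤ.+ Q ℤ.* x) ℤ.+ y ℤ.- u) e (ℤ.*-comm Q t))
            (≡.trans (lem₃ Q c (+ p) t u)
              (≡.trans (cong (λ z → c ℤ.* (+ p ℤ.* Q) ℤ.+ (t ℤ.* Q ℤ.- z)) u-1≡)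
                (≡.trans (cong (λ z → c ℤ.* (+ p ℤ.* Q) ℤ.+ z) (ℤ.+-inverseʳ (t ℤ.* Q)))
                  (≡.trans (ℤ.+-identityʳ _) (cong (c ℤ.*_)
                      (≡.sym (ℤ.pos-* p (p ℕ.^ suc (r ℕ.+ j))))))))))))

    -- If this power were 1, χ would be trivial on the powers of γ^(p^j). By `one-plus-generates`
    -- these fill the kernel of reduction modulo p^(v-1), so χ would factor through that modulus.
    primitive-on-one-units : ∀ {v} j → v ≡ suc (suc (r ℕ.+ j)) → (χ : Character C (p ℕ.^ v)) → Primitive χ →
      ∀ γ → val γ ≡ + 1 ℤ.+ + (p ℕ.^ suc r) → ¬ χ ⟨ γ ⟩ ^ (p ℕ.^ j) ≈ 1#
    primitive-on-one-units j refl χ χ-primitive γ γ≡ χγ≈1 = contradiction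
      (χ-primitive (ℕ.n∣m*n p) (factors-through (r ℕ.+ j) χ χ≈1))
      (ℕ.<⇒≢ (ℕ.^-monoʳ-< p (prime>1 pr) (ℕ.n<1+n (suc (r ℕ.+ j)))))
      where
      χ≈1 : ∀ u → val u ≡ + 1 [mod p ℕ.^ suc (r ℕ.+ j) ] → χ ⟨ u ⟩ ≈ 1#
      χ≈1 u u≡1 = let i , u≡ = one-plus-generates j (val u) u≡1 in begin
        χ ⟨ u ⟩  ≈⟨ χ-^ χ γ (p ℕ.^ j ℕ.* i) {u}
            (mod-trans u≡ (≡⇒≡mod (cong (ℤ._^ (p ℕ.^ j ℕ.* i)) (≡.sym γ≡)))) ⟩
        χ ⟨ γ ⟩ ^ (p ℕ.^ j ℕ.* i)      ≈⟨ ^-multiple-1 (p ℕ.^ j) i χγ≈1 ⟩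
        1#  ∎

  -- The value group has exponent exactly p^j. The second clause, void for j = 0, provides a value
  -- of order p^j.
  PExponent : ∀ {N} → Character C N → ℕ → Set
  PExponent χ j = (∀ u → χ ⟨ u ⟩ ^ (p ℕ.^ j) ≈ 1#) × (∀ i → j ≡ suc i → ∃[ u ] ¬ χ ⟨ u ⟩ ^ (p ℕ.^ i) ≈ 1#)

  -- Descent from σ: at each stage the finite search either finds a value of full order or shows
  -- that the exponent can be lowered.
  find-PExponent : ∀ {N} .{{_ : ℕ.NonZero N}} (χ : Character C N) σ →
                   (∀ u → χ ⟨ u ⟩ ^ (p ℕ.^ σ) ≈ 1#) → ∃[ j ] PExponent χ j
  find-PExponent χ zero    h = 0 , h , λ _ ()
  find-PExponent {N} χ (suc σ) h
    with UnitSearch.any-unit? N (λ u → ¬ χ ⟨ u ⟩ ^ (p ℕ.^ σ) ≈ 1#)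
           (λ {u} {w} u≡w ¬χu χw → ¬χu (trans (^-congˡ (p ℕ.^ σ) (χ-cong χ {u} {w} u≡w)) χw))
           (λ u → ¬? (χ ⟨ u ⟩ ^ (p ℕ.^ σ) ≈? 1#))
  ... | yes w = suc σ , h , λ { _ refl → w }
  ... | no ∄u = find-PExponent χ σ λ u → decidable-stable (_ ≈? _) λ ¬χu → ∄u (u , ¬χu)

  record Values {N} (χ : Character C N) (m : ℕ) : Set where
    field
      point    : Fin m → Carrier
      arg      : Fin m → Unit (ℤ/ N)
      arg-ok   : ∀ i → χ ⟨ arg i ⟩ ≈ point i
      distinct : Distinct point
      covers   : ∀ u → ∃[ i ] point i ≈ χ ⟨ u ⟩

    order : ∀ u → χ ⟨ u ⟩ ^ m ≈ 1#
    order u = lagrange point distinct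
        (λ i e → unit≉0 (⟦ χ ⟧ (arg i)) (trans (arg-ok i) e))
        (trans (sym (χ-∙ χ u (u ⁻¹) {u ∙ (u ⁻¹)} mod-refl)) (χ-1 χ {u ∙ (u ⁻¹)} (val*inv u)))
        (closed u) (closed (u ⁻¹))
      where
      open AbelianGroup ((ℤ/ N) ˣ) using (_∙_; _⁻¹)
      closed : ∀ u i → ∃[ k ] point k ≈ χ ⟨ u ⟩ * point i
      closed u i = let k , e = covers (u ∙ arg i) in
        k , trans e (trans (χ-∙ χ u (arg i) {u ∙ arg i} mod-refl) (*-congˡ (arg-ok i)))

    nonempty : m ≢ 0
    nonempty refl with covers (AbelianGroup.ε ((ℤ/ N) ˣ))
    ... | () , _

  values : ∀ {N m} (χ : Character C N) → HasCardinality C (Im χ) m → Values χ m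
  values χ B = record
    { point    = λ i → proj₁ (B.to i)
    ; arg      = λ i → proj₁ (proj₂ (B.to i))
    ; arg-ok   = λ i → proj₂ (proj₂ (B.to i))
    ; distinct = B.injective
    ; covers   = λ u → let i , e = B.surjective (χ ⟨ u ⟩ , u , ≈-refl) in i , e refl }
    where module B = Bijection B

-- The Teichmüller character with values in ℂₚ.

module TeichmüllerCharacter {p : ℕ} (C : ℂₚ p) (𝝎 : Teichmüller p) where
  open ℂₚ C hiding (zero) renaming (refl to ≈-refl)
  open Field C
  open Padic p
  open OneUnits C
  open Characters C
  open Teichmüller 𝝎 using (ω; isHom) public

  Ω : Unit (ℤ/ (teichmüllerModulus p)) → Unit commRing
  Ω w = ιᵘ (ω w)

  private module ω = UnitHomomorphism (ℤ/ (teichmüllerModulus p)) (ℤₚ-ring p) ω isHom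

  ω-cong : ∀ u w → val u ≡ val w [mod teichmüllerModulus p ] → valₚ (ω u) ≈ₚ valₚ (ω w)
  ω-cong = ω.val-cong

  ω-∙ : ∀ u w t → val t ≡ val u ℤ.* val w [mod teichmüllerModulus p ] → ∀ n →
        seq (valₚ (ω t)) n ≡ seq (valₚ (ω u)) n ℤ.* seq (valₚ (ω w)) n [mod p ℕ.^ n ]
  ω-∙ u w t e = _≈ₚ_.at (ω.val-∙ u w t e)

  Ω-character : Character C (teichmüllerModulus p)
  Ω-character = character Ω (λ u w e → ι-cong (ω-cong u w e)) λ u w t e →
    trans (ι-cong {valₚ (ω t)} {CommutativeRing._*_ (ℤₚ-ring p) (valₚ (ω u)) (valₚ (ω w))}
        (eq (ω-∙ u w t (≡⇒≡mod e))))
      (ι-* (valₚ (ω u)) (valₚ (ω w)))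

  -- χ along w ↦ ω(w) mod p^v. It is again a character modulo q, so the classification of those as
  -- powers of ω yields the exponent a.
  restriction : ∀ {v} → Character C (p ℕ.^ v) → Character C (teichmüllerModulus p)
  restriction {v} χ = character (λ w → ⟦ χ ⟧ (red w))
    (λ u w e → χ-cong χ {red u} {red w} (_≈ₚ_.at (ω-cong u w e) v))
    (λ u w t e → χ-∙ χ (red u) (red w) {red t} (ω-∙ u w t (≡⇒≡mod e) v))
    where
    red : Unit (ℤ/ (teichmüllerModulus p)) → Unit (ℤ/ (p ℕ.^ v))
    red w = reduceₚ {v = v} ℕ.∣-refl (ω w)

-- The maximal congruence

-- Here p^(r+1) is p for odd p and 4 for p = 2.
module Congruence {p : ℕ} (pr : ℕ.Prime p) (C : ℂₚ p) (𝝎 : Teichmüller p) (r : ℕ)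
  (q≡pʳ⁺¹ : teichmüllerModulus p ≡ p ℕ.^ suc r) (r+1≤2 : suc r ℕ.≤ 2)
  (gains : OneUnits.GainsOneFactor C (suc r)) where
  open ℂₚ C hiding (zero) renaming (refl to ≈-refl)
  open Field C
  open Roots C
  open Padic p
  open OneUnits C
  open Characters C
  open UnitPowers commRing
  open Gain r gains
  open TeichmüllerCharacter C 𝝎
  open import Relation.Binary.Reasoning.Setoid setoid

  private instance
    p≢0 : ℕ.NonZero p
    p≢0 = ℕ.prime⇒nonZero pr

  ω-≡ : ∀ w → seq (valₚ (ω w)) (suc r) ≡ val w [mod p ℕ.^ suc r ]
  ω-≡ w = mod-trans (mod-sym (seq-≤ (valₚ (ω w)) r+1≤2))
    (subst (λ q → seq (valₚ (ω w)) 2 ≡ val w [mod q ]) q≡pʳ⁺¹ (Teichmüller.lifts 𝝎 w))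

  abstract
    decompose : ∀ (x : Unit (ℤₚ-ring p)) → ∃[ w ] ∃[ y ] (seq (valₚ y) (suc r) ≡ + 1 [mod p ℕ.^ suc r ] ×
                (∀ n → seq (valₚ x) n ≡ seq (valₚ (ω w)) n ℤ.* seq (valₚ y) n [mod p ℕ.^ n ]))
    decompose x = w , proj₁ spec
      , ≡1 (seq (valₚ (proj₁ spec)) (suc r)) (seq (valₚ x) (suc r)) (seq (valₚ (ω w)) (suc r))
          (seq (invₚ (ω w)) (suc r))
          (_≈ₚ_.at (proj₁ (proj₂ spec)) (suc r)) (ω-≡ w) (_≈ₚ_.at (val*inv {ℤₚ-ring p} (ω w)) (suc r))
      , _≈ₚ_.at (proj₂ (proj₂ spec))
      where
      w : Unit (ℤ/ (teichmüllerModulus p))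
      w = reduceₚ {v = suc r} (ℕ.∣-reflexive q≡pʳ⁺¹) x
      spec : ∃[ y ] (val {ℤₚ-ring p} y ≈ₚ CommutativeRing._*_ (ℤₚ-ring p) (val {ℤₚ-ring p} x)
          (inv {ℤₚ-ring p} (ω w)) ×
                     val {ℤₚ-ring p} x ≈ₚ CommutativeRing._*_ (ℤₚ-ring p) (val {ℤₚ-ring p} (ω w))
                         (val {ℤₚ-ring p} y))
      spec = unit-quotient (ℤₚ-ring p) x (ω w)
      ≡1 : ∀ {N} y a b c → y ≡ a ℤ.* c [mod N ] → b ≡ a [mod N ] → b ℤ.* c ≡ + 1 [mod N ] → y ≡ + 1 [mod N ]
      ≡1 y a b c y≡ac b≡a bc≡1 = mod-trans y≡ac
          (mod-trans (mod-* {x = a} {y = b} {u = c} {v = c} (mod-sym b≡a) mod-refl) bc≡1)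

    -- For v > 0 an inverse modulo p^v is one modulo p, which is all that `unitₚ` asks for. Modulo
    -- p^0 there is nothing to match and 1 serves.
    lift : ∀ v (u : Unit (ℤ/ (p ℕ.^ v))) → ∃[ x ] seq (valₚ x) v ≡ val u [mod p ℕ.^ v ]
    lift zero    u = AbelianGroup.ε (ℤₚ-ring p ˣ) , mod-1
    lift (suc v) u = unitₚ (fromℤ (val u)) (inv u) uu⁻¹≡1
      , ≡⇒≡mod (cong (λ z → seq z (suc v)) (val-unitₚ (fromℤ (val u)) (inv u) uu⁻¹≡1))
      where
      uu⁻¹≡1 : val u ℤ.* inv u ≡ + 1 [mod p ]
      uu⁻¹≡1 = mod-weaken (ℕ.m∣m*n (p ℕ.^ v)) (val*inv u)

    ι-product : ∀ x w y → (∀ n → seq (valₚ x) n ≡ seq (valₚ (ω w)) n ℤ.* seq (valₚ y) n [mod p ℕ.^ n ]) →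
                val (ιᵘ x) ≈ val (Ω w) * val (ιᵘ y)
    ι-product x w y x≡ = trans (ι-cong {valₚ x} {CommutativeRing._*_ (ℤₚ-ring p) (valₚ (ω w)) (valₚ y)}
        (eq x≡))
      (ι-* (valₚ (ω w)) (valₚ y))

  one-unit-^ : ∀ (y : ℤₚ p) → seq y (suc r) ≡ + 1 [mod p ℕ.^ suc r ] → ∀ v →
               seq y v ℤ.^ (p ℕ.^ (v ℕ.∸ suc r)) ≡ + 1 [mod p ℕ.^ v ]
  one-unit-^ y y≡1 v with ℕ.≤-total v (suc r)
  -- Here the truncated difference is 0, so the exponent is p^0 = 1, and y is already 1 modulo p^v.
  ... | inj₁ v≤r = subst (λ e → seq y v ℤ.^ (p ℕ.^ e) ≡ + 1 [mod p ℕ.^ v ]) (≡.sym (ℕ.m≤n⇒m∸n≡0 v≤r))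
        (mod-trans (≡⇒≡mod (ℤ.*-identityʳ _))
            (mod-trans (mod-sym (seq-≤ y v≤r)) (mod-weaken (p^-mono-∣ v≤r) y≡1)))
  ... | inj₂ r≤v = subst (λ e → seq y v ℤ.^ (p ℕ.^ (v ℕ.∸ suc r)) ≡ + 1 [mod p ℕ.^ e ]) (ℕ.m+[n∸m]≡n r≤v)
        (mod-^p^ {p} r (v ℕ.∸ suc r) (mod-trans (seq-≤ y r≤v) y≡1))

  module Product (v N′ : ℕ) (p∤N′ : ¬ p ℕ.∣ N′) (χ : Character C (p ℕ.^ v ℕ.* N′))
    (χₚ : Character C (p ℕ.^ v)) (χ′ : Character C N′) (χ≈χₚχ′ : IsProduct χ χₚ χ′) (k : ℤ) where

    R : Carrier → Set
    R = ℤₚ[_] C (Im χ)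

    R-ring : IsSubring R
    R-ring = ℤₚ[]-isSubring (Im χ)

    open IsSubring R-ring

    ψ′ : Unit (ℤₚ-ring p) → Unit (ℤ/ N′) → Carrier
    ψ′ = ψ v χₚ χ′ k

    MaxCong : Carrier → Set₁
    MaxCong α = IsMaximalCongruence v R χₚ χ′ k (Principal C R α)

    Trivial : (Carrier → Set) → Set
    Trivial J = ∀ x b → J (ψ′ x b - 1#)

    RestrictsTo : ℕ → Set
    RestrictsTo = RestrictsToTeichmüllerPower v ℕ.∣-refl 𝝎 χₚ

    red : Unit (ℤₚ-ring p) → Unit (ℤ/ (p ℕ.^ v))
    red = reduceₚ {v = v} ℕ.∣-refl

    coprime : ℕ.Coprime (p ℕ.^ v) N′
    coprime = coprime-^ (prime∤⇒coprime pr p∤N′) v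

    1ₙ : ∀ {N} → Unit (ℤ/ N)
    1ₙ {N} = AbelianGroup.ε ((ℤ/ N) ˣ)

    1ₚ : Unit (ℤₚ-ring p)
    1ₚ = AbelianGroup.ε (ℤₚ-ring p ˣ)

    -- The Chinese remainder theorem joins a and b to one unit modulo p^v N′. Setting one of them to
    -- 1 puts the values of χₚ and of χ′ into `R` separately.
    χₚχ′∈Imχ : ∀ a b → Im χ (χₚ ⟨ a ⟩ * χ′ ⟨ b ⟩)
    χₚχ′∈Imχ a b = let u , u≡a , u≡b = crt-unit coprime a b in
      u , trans (χ≈χₚχ′ u) (*-cong (χ-cong χₚ {_} {a} u≡a) (χ-cong χ′ {_} {b} u≡b))

    χₚ∈R : ∀ a → R (χₚ ⟨ a ⟩)
    χₚ∈R a = ≈-mem (trans (*-congˡ (χ-1 χ′ {1ₙ} mod-refl)) (*-identityʳ _)) (gen (χₚχ′∈Imχ a 1ₙ))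

    χ′∈R : ∀ b → R (χ′ ⟨ b ⟩)
    χ′∈R b = ≈-mem (trans (*-congʳ (χ-1 χₚ {1ₙ} mod-refl)) (*-identityˡ _)) (gen (χₚχ′∈Imχ 1ₙ b))

    ψ∈R : ∀ x b → R (ψ′ x b)
    ψ∈R x b = *-mem (*-mem (χₚ∈R (red x)) (χ′∈R b)) (ι-mem (valₚ (x ^ᵘ k)))

    ψ-at-1 : ∀ b → ψ′ 1ₚ b ≈ χ′ ⟨ b ⟩
    ψ-at-1 b = begin
      χₚ ⟨ red 1ₚ ⟩ * χ′ ⟨ b ⟩ * ι (valₚ (1ₚ ^ᵘ k))
        ≈⟨ *-cong (*-congʳ (χ-1 χₚ {red 1ₚ} mod-refl)) (ι-^ᵘ 1ₚ k) ⟩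
      1# * χ′ ⟨ b ⟩ * val (ιᵘ 1ₚ ^ᵘ k)  ≈⟨ *-congˡ (^ᵘ-ε (ιᵘ 1ₚ) k ι-1) ⟩
      1# * χ′ ⟨ b ⟩ * 1#  ≈⟨ solve 1 (λ a → :1 :* a :* :1 := a) ≈-refl _ ⟩
      χ′ ⟨ b ⟩  ∎

    ψ-at-χ′=1 : ∀ x → ψ′ x 1ₙ ≈ χₚ ⟨ red x ⟩ * val (ιᵘ x ^ᵘ k)
    ψ-at-χ′=1 x = *-cong (trans (*-congˡ (χ-1 χ′ {1ₙ} mod-refl)) (*-identityʳ _)) (ι-^ᵘ x k)

    χₚω : ∀ {a} → RestrictsTo a → ∀ w → χₚ ⟨ red (ω w) ⟩ ≈ val (Ω w ^ᵘ (+ a))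
    χₚω {a} χₚω≈ w = trans (χₚω≈ w) (ι-^ᵘ (ω w) (+ a))

    ψ-at-ω : ∀ {a} → RestrictsTo a → ∀ w → ψ′ (ω w) 1ₙ ≈ val (Ω w ^ᵘ (k ℤ.+ + a))
    ψ-at-ω {a} χₚω≈ w = begin
      ψ′ (ω w) 1ₙ  ≈⟨ ψ-at-χ′=1 (ω w) ⟩
      χₚ ⟨ red (ω w) ⟩ * val (Ω w ^ᵘ k)  ≈⟨ *-congʳ (χₚω {a} χₚω≈ w) ⟩
      val (Ω w ^ᵘ (+ a)) * val (Ω w ^ᵘ k)  ≈⟨ *-comm _ _ ⟩
      val (Ω w ^ᵘ k) * val (Ω w ^ᵘ (+ a))  ≈⟨ ^ᵘ-+ (Ω w) k (+ a) ⟨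
      val (Ω w ^ᵘ (k ℤ.+ + a))  ∎

    χₚ-decomposed : ∀ x w y → (∀ n → seq (valₚ x) n ≡ seq (valₚ (ω w)) n ℤ.* seq (valₚ y) n [mod p ℕ.^ n ])
        →
                    χₚ ⟨ red x ⟩ ≈ χₚ ⟨ red (ω w) ⟩ * χₚ ⟨ red y ⟩
    χₚ-decomposed x w y x≡ = χ-∙ χₚ (red (ω w)) (red y) {red x} (x≡ v)

    ψ-decomposed : ∀ {a} → RestrictsTo a → ∀ x w y →
      (∀ n → seq (valₚ x) n ≡ seq (valₚ (ω w)) n ℤ.* seq (valₚ y) n [mod p ℕ.^ n ]) → ∀ b →
      ψ′ x b ≈ val (Ω w ^ᵘ (k ℤ.+ + a)) * (χₚ ⟨ red y ⟩ * χ′ ⟨ b ⟩) * val (ιᵘ y ^ᵘ k)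
    ψ-decomposed {a} χₚω≈ x w y x≡ b = begin
      χₚ ⟨ red x ⟩ * χ′ ⟨ b ⟩ * ι (valₚ (x ^ᵘ k))
        ≈⟨ *-cong (*-congʳ (trans (χₚ-decomposed x w y x≡) (*-congʳ (χₚω {a} χₚω≈ w))))
                  (trans (ι-^ᵘ x k) (trans (^ᵘ-cong {ιᵘ x} {Ω w ∙ ιᵘ y} k (ι-product x w y x≡))
                      (^ᵘ-distrib-∙ (Ω w) (ιᵘ y) k))) ⟩
      Ωᵃ * χₚ ⟨ red y ⟩ * χ′ ⟨ b ⟩ * (Ωᵏ * yᵏ)
        ≈⟨ solve 5 (λ Ωᵃ χₚ χ′ Ωᵏ yᵏ → Ωᵃ :* χₚ :* χ′ :* (Ωᵏ :* yᵏ) := (Ωᵏ :* Ωᵃ) :* (χₚ :* χ′) :* yᵏ)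
            ≈-refl Ωᵃ (χₚ ⟨ red y ⟩) (χ′ ⟨ b ⟩) Ωᵏ yᵏ ⟩
      (Ωᵏ * Ωᵃ) * (χₚ ⟨ red y ⟩ * χ′ ⟨ b ⟩) * yᵏ
        ≈⟨ *-congʳ (*-congʳ (^ᵘ-+ (Ω w) k (+ a))) ⟨
      val (Ω w ^ᵘ (k ℤ.+ + a)) * (χₚ ⟨ red y ⟩ * χ′ ⟨ b ⟩) * yᵏ ∎
      where
      open AbelianGroup (commRing ˣ) using (_∙_)
      Ωᵃ = val (Ω w ^ᵘ (+ a))
      Ωᵏ = val (Ω w ^ᵘ k)
      yᵏ = val (ιᵘ y ^ᵘ k)

    maxCong : ∀ {α} → R α → (∀ x b → Principal C R α (ψ′ x b - 1#)) →
              (∀ J → IsIdeal C R J → Trivial J → J α) → MaxCong α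
    maxCong Rα trivial smallest = record
      { isIdeal  = Principal-isIdeal R-ring Rα
      ; trivial  = trivial
      ; smallest = λ J J-ideal J-trivial (s , Rs , x≈) →
          IsIdeal.I-resp J-ideal (sym x≈) (IsIdeal.*-closed J-ideal Rs (smallest J J-ideal J-trivial)) }

    maxCong-1 : (∀ J → IsIdeal C R J → Trivial J → J 1#) → MaxCong 1#
    maxCong-1 = maxCong 1-mem λ x b → ψ′ x b - 1# , sub-mem (ψ∈R x b) 1-mem , sym (*-identityʳ _)

    maxCong-1-from-χ′ : ∀ b n i → + n ℤ.* i ≡ + 1 [mod p ] → χ′ ⟨ b ⟩ ^ n ≈ 1# → ¬ χ′ ⟨ b ⟩ ≈ 1# → MaxCong
        1#
    maxCong-1-from-χ′ b n i ni≡1 χ′ⁿ≈1 χ′≉1 = maxCong-1 λ J J-ideal J-trivial →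
      1-from-root-of-unity R-ring J-ideal n i ni≡1 (χ′∈R b) χ′ⁿ≈1 χ′≉1
        (IsIdeal.I-resp J-ideal (+-congʳ (ψ-at-1 b)) (J-trivial 1ₚ b))

    maxCong-1-from-ω : ∀ {a} → RestrictsTo a → ∀ w n i → + n ℤ.* i ≡ + 1 [mod p ] →
      val (Ω w ^ᵘ (k ℤ.+ + a)) ^ n ≈ 1# → ¬ val (Ω w ^ᵘ (k ℤ.+ + a)) ≈ 1# → MaxCong 1#
    maxCong-1-from-ω {a} χₚω≈ w n i ni≡1 Ωⁿ≈1 Ω≉1 = maxCong-1 λ J J-ideal J-trivial →
      1-from-root-of-unity R-ring J-ideal n i ni≡1
        (≈-mem (ψ-at-ω {a} χₚω≈ w) (ψ∈R (ω w) 1ₙ)) Ωⁿ≈1 Ω≉1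
        (IsIdeal.I-resp J-ideal (+-congʳ (ψ-at-ω {a} χₚω≈ w)) (J-trivial (ω w) 1ₙ))

    val-integral : ∀ y → Integral (val (ιᵘ y))
    val-integral y = valₚ y , ≈-refl

    inv-integral : ∀ y → Integral (inv (ιᵘ y))
    inv-integral y = invₚ y , ≈-refl

    -- The unit 1 + q, at which the bounds are attained: with t = 1 it realizes the least valuation
    -- of y^k - 1, and for primitive χₚ of conductor beyond q its value is a root of unity of
    -- maximal p-power order.
    γ : Unit (ℤₚ-ring p)
    γ = proj₁ (one-plus-P^ pr r)

    γ-seq : ∀ n → seq (valₚ γ) n ≡ + 1 ℤ.+ + (p ℕ.^ suc r)
    γ-seq = proj₂ (one-plus-P^ pr r)

    γ≡1 : seq (valₚ γ) (suc r) ≡ + 1 [mod p ℕ.^ suc r ]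
    γ≡1 = mod-trans (≡⇒≡mod (γ-seq (suc r))) (mod (ℤ.divides (+ 1) (lem (+ (p ℕ.^ suc r)))))
      where
      lem : ∀ a → + 1 ℤ.+ a ℤ.- + 1 ≡ + 1 ℤ.* a
      lem = ℤ-solver.solve-∀

    γ≈ : val (ιᵘ γ) ≈ 1# + P^ (suc r) * 1#
    γ≈ = begin
      ι (valₚ γ)
        ≈⟨ ι-cong {valₚ γ} {fromℤ (+ 1 ℤ.+ + (p ℕ.^ suc r))} (eq λ n → ≡⇒≡mod (γ-seq n)) ⟩
      ι (fromℤ (+ 1 ℤ.+ + (p ℕ.^ suc r))) ≡⟨ int≡ι _ ⟨
      int (+ 1 ℤ.+ + (p ℕ.^ suc r))  ≈⟨ int-+ (+ 1) _ ⟩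
      int (+ 1) + P^ (suc r)  ≈⟨ +-cong int-1 (sym (*-identityʳ _)) ⟩
      1# + P^ (suc r) * 1#  ∎

    -- As p^v divides q, χₚ is trivial at y and ψ reduces to y^k. Lifting the exponent writes y^k -
    -- 1 as q p^e times t u, and at `γ`, where t = 1, this generates the ideal. For k = 0 all these
    -- differences vanish, in accordance with the convention p^∞ = 0.
    unramified : v ℕ.≤ suc r → (∀ b → χ′ ⟨ b ⟩ ≈ 1#) → ∀ {a} → RestrictsTo a →
      (∀ w → val (Ω w ^ᵘ (k ℤ.+ + a)) ≈ 1#) → MaxCong (ι (fromℤ (p ^⁺ (vₚ p k +⁺ suc r))))
    unramified v≤r χ′≈1 {a} χₚω≈ Ω≈1 = subst MaxCong (int≡ι _) (cases (ℤ.∣ k ∣ ℕ.≟ 0))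
      where
      ψ≈yᵏ : ∀ x b → ∃[ y ] (seq (valₚ y) (suc r) ≡ + 1 [mod p ℕ.^ suc r ] × ψ′ x b ≈ val (ιᵘ y ^ᵘ k))
      ψ≈yᵏ x b = let w , y , y≡1 , x≡ = decompose x in y , y≡1 , (begin
        ψ′ x b  ≈⟨ ψ-decomposed {a} χₚω≈ x w y x≡ b ⟩
        val (Ω w ^ᵘ (k ℤ.+ + a)) * (χₚ ⟨ red y ⟩ * χ′ ⟨ b ⟩) * val (ιᵘ y ^ᵘ k)
          ≈⟨ *-congʳ (*-cong (Ω≈1 w) (*-cong
              (χ-1 χₚ {red y} (mod-trans (mod-sym (seq-≤ (valₚ y) v≤r)) (mod-weaken (p^-mono-∣ v≤r) y≡1)))
              (χ′≈1 b))) ⟩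
        1# * (1# * 1#) * val (ιᵘ y ^ᵘ k)
          ≈⟨ solve 1 (λ a → :1 :* (:1 :* :1) :* a := a) ≈-refl _ ⟩
        val (ιᵘ y ^ᵘ k)  ∎)
      cases : Dec (ℤ.∣ k ∣ ≡ 0) → MaxCong (int (p ^⁺ (vₚ p k +⁺ suc r)))
      cases (yes k≡0) = subst (λ e → MaxCong (int (p ^⁺ (e +⁺ suc r))))
          (≡.sym (cong (vₚ p) (ℤ.∣i∣≡0⇒i≡0 {k} k≡0)))
        (maxCong (int-mem _)
          (λ x b → let y , _ , ψ≈ = ψ≈yᵏ x b in
            0# , 0-mem , trans (+-congʳ (trans ψ≈
                (reflexive (cong (λ j → val (ιᵘ y ^ᵘ j)) (ℤ.∣i∣≡0⇒i≡0 {k} k≡0)))))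
              (trans (-‿inverseʳ 1#) (sym (zeroˡ _))))
          (λ J J-ideal _ → IsIdeal.I-resp J-ideal (sym int-0) (IsIdeal.0∈I J-ideal)))
      cases (no k≢0) = from-factor (vₚ-factor (prime>1 pr) k k≢0)
        where
        from-factor : ∃[ e ] ∃[ m ] (vₚ p k ≡ [ e ] × ℤ.∣ k ∣ ≡ p ℕ.^ e ℕ.* m × ¬ p ℕ.∣ m) →
                      MaxCong (int (p ^⁺ (vₚ p k +⁺ suc r)))
        from-factor (e , m , vₚ≡ , k≡ , p∤m) = subst MaxCong
          (cong int (≡.trans (cong (λ d → + (p ℕ.^ d)) (ℕ.+-comm (suc r) e))
              (cong (λ d → p ^⁺ (d +⁺ suc r)) (≡.sym vₚ≡))))
          (maxCong (int-mem _)
            (λ x b → let y , y≡1 , ψ≈ = ψ≈yᵏ x b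
                         t , It , y≈ = ι-≡1 (valₚ y) (suc r) y≡1
                         u , U , yᵏ≈ = lte y It y≈
                     in t * u , Integral⊆ R-ring (Int.*-mem It (InvertibleIn.mem U)) ,
                        trans (+-congʳ (trans ψ≈ yᵏ≈)) (solve 2 (λ a b → :1 :+ a :* b :- :1 := b :* a)
                            ≈-refl _ (t * u)))
            λ J J-ideal J-trivial →
              let u , U , γᵏ≈ = lte γ Int.1-mem γ≈ in
              IdealIn.cancel-invertible R-ring J-ideal (InvertibleIn⊆ R-ring U)
                (IsIdeal.I-resp J-ideal
                  (trans (+-congʳ (trans (ψ-at-χ′=1 γ) (*-cong χₚγ≈1 γᵏ≈)))
                    (solve 2 (λ a u → :1 :* (:1 :+ a :* (:1 :* u)) :- :1 := a :* u) ≈-refl _ u))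
                  (J-trivial γ 1ₙ)))
          where
          mi = inverse-mod (ℕ.sym (prime∤⇒coprime pr p∤m))
          χₚγ≈1 : χₚ ⟨ red γ ⟩ ≈ 1#
          χₚγ≈1 = χ-1 χₚ {red γ} (mod-trans (mod-sym (seq-≤ (valₚ γ) v≤r)) (mod-weaken (p^-mono-∣ v≤r) γ≡1))
          lte : ∀ y {t} → Integral t → val (ιᵘ y) ≈ 1# + P^ (suc r) * t →
                ∃[ u ] (InvertibleIn Integral u × val (ιᵘ y ^ᵘ k) ≈ 1# + P^ (suc r ℕ.+ e) * (t * u))
          lte y It y≈ = lifting-exponentᵘ (ιᵘ y) (val-integral y) (inv-integral y) It y≈ k e m (proj₁ mi)
              k≡ (proj₂ mi)

    χₚ-on-one-units : ∀ y → seq (valₚ y) (suc r) ≡ + 1 [mod p ℕ.^ suc r ] → χₚ ⟨ red y ⟩ ^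
        (p ℕ.^ (v ℕ.∸ suc r)) ≈ 1#
    χₚ-on-one-units y y≡1 = χ-^≈1 χₚ (red y) (p ℕ.^ (v ℕ.∸ suc r)) (one-unit-^ (valₚ y) y≡1 v)

    ^p-mono : ∀ {x m n} → m ℕ.≤ n → x ^ (p ℕ.^ m) ≈ 1# → x ^ (p ℕ.^ n) ≈ 1#
    ^p-mono {x} {m} {n} m≤n xᵐ≈1 = trans
      (reflexive (cong (x ^_) (≡.trans (cong (p ℕ.^_) (≡.sym (ℕ.m+[n∸m]≡n m≤n)))
          (ℕ.^-distribˡ-+-* p m (n ℕ.∸ m)))))
      (^-multiple-1 (p ℕ.^ m) (p ℕ.^ (n ℕ.∸ m)) xᵐ≈1)

    -- Write m = p^e n with p ∤ n. If all m values were p^e-th roots of unity, then m ≤ p^e and m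
    -- would be a power of p. Otherwise the p^e-th power of some value is a root of unity other than
    -- 1 whose order divides n.
    cardinality⇒maxCong-1 : ∀ m → Values χ′ m → ¬ (∃[ e ] m ≡ p ℕ.^ e) → MaxCong 1#
    cardinality⇒maxCong-1 m V m≢pᵉ = from-p-part (p-part (prime>1 pr) m nonempty)
      where
      open Values V
      from-p-part : ∃[ e ] ∃[ n ] (m ≡ p ℕ.^ e ℕ.* n × ¬ p ℕ.∣ n) → MaxCong 1#
      from-p-part (e , n , m≡ , p∤n) = search-root (Fin.any? (λ i → ¬? (point i ^ (p ℕ.^ e) ≈? 1#)))
        where
        n⁻¹ = inverse-mod (ℕ.sym (prime∤⇒coprime pr p∤n))
        search-root : Dec (∃[ i ] ¬ point i ^ (p ℕ.^ e) ≈ 1#) → MaxCong 1#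
        search-root (yes (i , xᵉ≉1)) = maxCong-1-from-χ′ (^-unit (arg i) (p ℕ.^ e)) n (proj₁ n⁻¹)
            (proj₂ n⁻¹)
          (begin
            χ′ ⟨ ^-unit (arg i) (p ℕ.^ e) ⟩ ^ n ≈⟨ ^-congˡ n χ′bᵉ≈ ⟩
            (χ′ ⟨ arg i ⟩ ^ (p ℕ.^ e)) ^ n     ≈⟨ ^-assocʳ (χ′ ⟨ arg i ⟩) (p ℕ.^ e) n ⟩
            χ′ ⟨ arg i ⟩ ^ (p ℕ.^ e ℕ.* n)     ≡⟨ cong (χ′ ⟨ arg i ⟩ ^_) m≡ ⟨
            χ′ ⟨ arg i ⟩ ^ m  ≈⟨ order (arg i) ⟩
            1#  ∎)
          (λ χ′≈1 → xᵉ≉1 (trans (^-congˡ (p ℕ.^ e) (sym (arg-ok i))) (trans (sym χ′bᵉ≈) χ′≈1)))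
          where
          χ′bᵉ≈ : χ′ ⟨ ^-unit (arg i) (p ℕ.^ e) ⟩ ≈ χ′ ⟨ arg i ⟩ ^ (p ℕ.^ e)
          χ′bᵉ≈ = χ-^ χ′ (arg i) (p ℕ.^ e) {^-unit (arg i) (p ℕ.^ e)} mod-refl
        search-root (no ∄i) = contradiction (e , ℕ.≤-antisym
          (roots-of-unity-bound (p ℕ.^ e) (ℕ.≢-nonZero⁻¹ _ {{ℕ.m^n≢0 p e}}) point distinct
            (λ i → decidable-stable (_ ≈? _) λ ¬x → ∄i (i , ¬x)))
          (ℕ.≤-trans (ℕ.m≤m*n (p ℕ.^ e) n
              {{ℕ.≢-nonZero λ n≡0 → p∤n (subst (p ℕ.∣_) (≡.sym n≡0) (p ℕ.∣0))}})
              (ℕ.≤-reflexive (≡.sym m≡))))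
          m≢pᵉ

    -- Lagrange's theorem bounds the exponent from above. It cannot be smaller, since p^v′ distinct
    -- values are too many to be p^i-th roots of unity for i < v′.
    cardinality⇒exponent : ∀ v′ → Values χ′ (p ℕ.^ v′) → PExponent χ′ v′
    cardinality⇒exponent v′ V = order , non-root
      where
      open Values V
      non-root : ∀ i → v′ ≡ suc i → ∃[ u ] ¬ χ′ ⟨ u ⟩ ^ (p ℕ.^ i) ≈ 1#
      non-root i v′≡ = search-root (Fin.any? (λ n → ¬? (point n ^ (p ℕ.^ i) ≈? 1#)))
        where
        search-root : Dec (∃[ n ] ¬ point n ^ (p ℕ.^ i) ≈ 1#) → ∃[ u ] ¬ χ′ ⟨ u ⟩ ^ (p ℕ.^ i) ≈ 1#
        search-root (yes (n , x≉1)) = arg n , λ χ′≈1 → x≉1 (trans (^-congˡ (p ℕ.^ i) (sym (arg-ok n))) χ′≈1)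
        search-root (no ∄n) = contradiction
          (roots-of-unity-bound (p ℕ.^ i) (ℕ.≢-nonZero⁻¹ _ {{ℕ.m^n≢0 p i}}) point distinct
            (λ n → decidable-stable (_ ≈? _) λ ¬x → ∄n (n , ¬x)))
          (ℕ.<⇒≱ (subst (λ e → p ℕ.^ i ℕ.< p ℕ.^ e) (≡.sym v′≡) (ℕ.^-monoʳ-< p (prime>1 pr) (ℕ.n<1+n i))))

    restricts : ∀ e → (∀ w → restriction {v} χₚ ⟨ w ⟩ ≈ val (Ω w) ^ e) → RestrictsTo e
    restricts e χₚω≈ w = trans (χₚω≈ w)
        (trans (reflexive (≡.sym (val-^ᵘ (Ω w) e))) (sym (ι-^ᵘ (ω w) (+ e))))

    small-conductor : p ℕ.^ v ℕ.* N′ ℕ.∣ p ℕ.^ suc r → N′ ≡ 1 × v ℕ.≤ suc r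
    small-conductor N∣ =
      coprime-^ (prime∤⇒coprime pr p∤N′) (suc r) (ℕ.m*n∣⇒n∣ (p ℕ.^ v) N′ N∣ , ℕ.∣-refl) ,
      ℕ.≮⇒≥ λ r<v → ℕ.<⇒≱ (ℕ.^-monoʳ-< p (prime>1 pr) r<v)
        (ℕ.∣⇒≤ {{ℕ.m^n≢0 p (suc r)}} (ℕ.m*n∣⇒m∣ (p ℕ.^ v) N′ N∣))

    -- Characters of p-power conductor.

    module TrivialAwayFromP (N′≡1 : N′ ≡ 1) where
      χ′≈1 : ∀ b → χ′ ⟨ b ⟩ ≈ 1#
      χ′≈1 b = χ-1 χ′ {b} (subst (λ N → val b ≡ + 1 [mod N ]) (≡.sym N′≡1) mod-1)

      χ′-exponent : PExponent χ′ 0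
      χ′-exponent = (λ b → ^-cong-1 1 (χ′≈1 b)) , λ _ ()

      χ≈χₚ : ∀ u a → val u ≡ val a [mod p ℕ.^ v ] → χ ⟨ u ⟩ ≈ χₚ ⟨ a ⟩
      χ≈χₚ u a u≡a = trans (χ≈χₚχ′ u)
        (trans (*-cong (χ-cong χₚ {reduce (ℕ.m∣m*n N′) u} {a} u≡a) (χ′≈1 _)) (*-identityʳ _))

      module _ (N∣pᵛ : p ℕ.^ v ℕ.* N′ ℕ.∣ p ℕ.^ v) where
        restricts-χ⇒χₚ : ∀ {a} → RestrictsToTeichmüllerPower v N∣pᵛ 𝝎 χ a → RestrictsTo a
        restricts-χ⇒χₚ χω≈ w = trans (sym (χ≈χₚ (reduceₚ {v = v} N∣pᵛ (ω w)) (red (ω w)) mod-refl)) (χω≈ w)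

        restricts-χₚ⇒χ : ∀ {a} → RestrictsTo a → RestrictsToTeichmüllerPower v N∣pᵛ 𝝎 χ a
        restricts-χₚ⇒χ χₚω≈ w = trans (χ≈χₚ (reduceₚ {v = v} N∣pᵛ (ω w)) (red (ω w)) mod-refl) (χₚω≈ w)

      module _ (v≤r : v ℕ.≤ suc r) where
        ω-≡ᵥ : ∀ w → seq (valₚ (ω w)) v ≡ val w [mod p ℕ.^ v ]
        ω-≡ᵥ w = mod-trans (mod-sym (seq-≤ (valₚ (ω w)) v≤r)) (mod-weaken (p^-mono-∣ v≤r) (ω-≡ w))

        -- For v ≤ r + 1 the integers w and ω(w) agree modulo p^v, so comparing χ with ω^a on
        -- integers amounts to comparing χₚ with it along w ↦ ω(w).
        TeichmüllerPower⇒restricts : p ℕ.^ v ℕ.* N′ ℕ.∣ teichmüllerModulus p →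
          ∀ {a} → IsTeichmüllerPower 𝝎 χ a → RestrictsTo a
        TeichmüllerPower⇒restricts N∣q χ≈ωᵃ w =
          trans (sym (χ≈χₚ (reduce N∣q w) (red (ω w)) (mod-sym (ω-≡ᵥ w)))) (χ≈ωᵃ (reduce N∣q w) w refl)

        restricts⇒TeichmüllerPower : ∀ {a} → RestrictsTo a → IsTeichmüllerPower 𝝎 χ a
        restricts⇒TeichmüllerPower χₚω≈ u w u≡w =
          trans (χ≈χₚ u (red (ω w)) (mod-trans (≡⇒≡mod u≡w) (mod-sym (ω-≡ᵥ w)))) (χₚω≈ w)

    -- Congruences generated by 1 - ζ for ζ of p-power order.

    module Ramified (v′ j : ℕ) (v⊔v′≡ : (v ℕ.∸ suc r) ℕ.⊔ v′ ≡ suc j) (χₚ-primitive : Primitive χₚ)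
      (χ′-exponent : PExponent χ′ v′) where

      generator : ∃[ ζ₁ ] (R ζ₁ × PrimitiveRoot C (p ℕ.^ suc j) ζ₁ ×
                  (∀ J → IsIdeal C R J → Trivial J → J (1# - ζ₁)))
      generator with ℕ.≤-total (v ℕ.∸ suc r) v′
      ... | inj₁ v≤v′ = from-χ′ (≡.trans (≡.sym (ℕ.m≤n⇒m⊔n≡n v≤v′)) v⊔v′≡)
        where
        from-χ′ : v′ ≡ suc j → _
        from-χ′ v′≡ = let b , χ′b≉1 = proj₂ χ′-exponent j v′≡ in
          χ′ ⟨ b ⟩ , χ′∈R b
          , prime-power-PrimitiveRoot pr j
              (subst (λ e → χ′ ⟨ b ⟩ ^ (p ℕ.^ e) ≈ 1#) v′≡ (proj₁ χ′-exponent b)) χ′b≉1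
          , λ J J-ideal J-trivial → IsIdeal.I-resp J-ideal
              (trans (-‿cong (+-congʳ (ψ-at-1 b))) (solve 1 (λ a → :- (a :- :1) := :1 :- a) ≈-refl _))
              (IdealIn.neg-closed R-ring J-ideal (J-trivial 1ₚ b))
      ... | inj₂ v′≤v = from-χₚ (≡.trans (≡.sym (ℕ.m≥n⇒m⊔n≡m v′≤v)) v⊔v′≡)
        where
        from-χₚ : v ℕ.∸ suc r ≡ suc j → _
        from-χₚ v∸r≡ = ζ₁ , χₚ∈R (red γ) , prime-power-PrimitiveRoot pr j ζ₁^≈1 ζ₁^≉1
          , λ J J-ideal J-trivial →
              let t , It , c≈ = ^ᵘ-≡1 (ιᵘ γ) (inv-integral γ) Int.1-mem γ≈ k in
              1-ζ-from-ζc-1 pr R-ring J-ideal j (χₚ∈R (red γ)) ζ₁^≈1 ζ₁^≉1 It c≈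
                (IsIdeal.I-resp J-ideal (+-congʳ (ψ-at-χ′=1 γ)) (J-trivial γ 1ₙ))
          where
          ζ₁ = χₚ ⟨ red γ ⟩
          -- The truncated difference v ∸ (r + 1) is j + 1 > 0, so it is the true difference.
          v≡ : v ≡ suc (suc (r ℕ.+ j))
          v≡ = ≡.trans (≡.sym (ℕ.m+[n∸m]≡n {suc r}
              (ℕ.<⇒≤ (ℕ.m∸n≢0⇒n<m {v} {suc r} λ v∸r≡0 → contradiction (≡.trans (≡.sym v∸r≡) v∸r≡0) λ ()))))
            (≡.trans (cong (suc r ℕ.+_) v∸r≡) (cong suc (ℕ.+-suc r j)))
          ζ₁^≈1 : ζ₁ ^ (p ℕ.^ suc j) ≈ 1#
          ζ₁^≈1 = subst (λ e → ζ₁ ^ (p ℕ.^ e) ≈ 1#) v∸r≡ (χₚ-on-one-units γ γ≡1)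
          ζ₁^≉1 : ¬ ζ₁ ^ (p ℕ.^ j) ≈ 1#
          ζ₁^≉1 = primitive-on-one-units pr r gains j v≡ χₚ χₚ-primitive (red γ) (γ-seq v)

      module _ {ζ} (ζ-primitive : PrimitiveRoot C (p ℕ.^ suc j) ζ) where
        private
          pʲ⁺¹≢0 : p ℕ.^ suc j ≢ 0
          pʲ⁺¹≢0 = ℕ.≢-nonZero⁻¹ _ {{ℕ.m^n≢0 p (suc j)}}

          ζ^pʲ≉1 : ¬ ζ ^ (p ℕ.^ j) ≈ 1#
          ζ^pʲ≉1 = proj₂ ζ-primitive (p ℕ.^ j) (ℕ.m^n>0 p j) (ℕ.^-monoʳ-< p (prime>1 pr) (ℕ.n<1+n j))

          -- The given ζ is a power of the ζ₁ of `generator`, which has the same order. Hence ζ lies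
          -- in `R`, and 1 - ζ is a multiple of 1 - ζ₁.
          ζ∈R×smallest : R ζ × (∀ J → IsIdeal C R J → Trivial J → J (1# - ζ))
          ζ∈R×smallest =
            let ζ₁ , Rζ₁ , ζ₁-primitive , smallest = generator
                i , ζ≈ = root-of-unity⇒power pʲ⁺¹≢0 ζ₁-primitive (proj₁ ζ-primitive)
            in ≈-mem (sym ζ≈) (^-mem i Rζ₁) , λ J J-ideal J-trivial →
                 let s , Rs , e = 1-ζ^i∈⟨1-ζ⟩ R-ring i Rζ₁ in
                 IsIdeal.I-resp J-ideal (trans (sym e) (+-congˡ (-‿cong (sym ζ≈))))
                   (IsIdeal.*-closed J-ideal Rs (smallest J J-ideal J-trivial))

          Rζ = proj₁ ζ∈R×smallest

          χₚy-power : ∀ y → seq (valₚ y) (suc r) ≡ + 1 [mod p ℕ.^ suc r ] → ∃[ i ] χₚ ⟨ red y ⟩ ≈ ζ ^ i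
          χₚy-power y y≡1 = root-of-unity⇒power pʲ⁺¹≢0 ζ-primitive
            (^p-mono (ℕ.≤-trans (ℕ.m≤m⊔n _ v′) (ℕ.≤-reflexive v⊔v′≡)) (χₚ-on-one-units y y≡1))

          χ′-power : ∀ b → ∃[ i ] χ′ ⟨ b ⟩ ≈ ζ ^ i
          χ′-power b = root-of-unity⇒power pʲ⁺¹≢0 ζ-primitive
            (^p-mono (ℕ.≤-trans (ℕ.m≤n⊔m (v ℕ.∸ suc r) v′) (ℕ.≤-reflexive v⊔v′≡)) (proj₁ χ′-exponent b))

        -- A value of χₚ is a value of ω^a, which lies in ℤₚ, times the value at a one-unit, which
        -- like the values of χ′ is a power of ζ. This gives one inclusion; the other is ζ ∈ `R`.
        ring≐ : ∀ {a} → RestrictsTo a → _≐_ C R (ℤₚ[_] C (_≈ ζ))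
        ring≐ {a} χₚω≈ x = mk⇔ R⊆ (adjoin-⊆ R-ring λ y≈ζ → ≈-mem (sym y≈ζ) Rζ)
          where
          ζ-ring = ℤₚ[]-isSubring (_≈ ζ)
          module ζ = IsSubring ζ-ring
          ζ^∈ : ∀ i → ℤₚ[_] C (_≈ ζ) (ζ ^ i)
          ζ^∈ i = ζ.^-mem i (gen ≈-refl)
          χₚ∈ : ∀ u → ℤₚ[_] C (_≈ ζ) (χₚ ⟨ u ⟩)
          χₚ∈ u = let x , x≡u = lift v u
                      w , y , y≡1 , x≡ = decompose x
                      i , e = χₚy-power y y≡1
                  in ζ.≈-mem (sym (trans (χ-cong χₚ {u} {red x} (mod-sym x≡u))
                      (trans (χₚ-decomposed x w y x≡) (*-cong (χₚω≈ w) e))))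
                       (ζ.*-mem (ζ.ι-mem _) (ζ^∈ i))
          R⊆ : R x → ℤₚ[_] C (_≈ ζ) x
          R⊆ = adjoin-⊆ ζ-ring λ (u , χu≈) →
            let i , e = χ′-power (reduce (ℕ.n∣m*n (p ℕ.^ v)) u) in
            ζ.≈-mem (trans (*-congˡ (sym e)) (trans (sym (χ≈χₚχ′ u)) χu≈))
              (ζ.*-mem (χₚ∈ (reduce (ℕ.m∣m*n N′) u)) (ζ^∈ i))

        -- Each factor of ψ is 1 modulo 1 - ζ: the powers of ζ directly, the power of ω and y^k
        -- because they are 1 modulo p. Asking the power of ω to be 1 only modulo p covers both
        -- parities: for odd p it equals 1, and for p = 2 every unit of ℤ₂ is odd.
        ramified : ∀ {a} → RestrictsTo a →
            (∀ w → ∃[ t ] (Integral t × val (Ω w ^ᵘ (k ℤ.+ + a)) ≈ 1# + P * t)) →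
                   MaxCong (1# - ζ)
        ramified {a} χₚω≈ Ω≡1 = maxCong R[1-ζ] trivial (proj₂ ζ∈R×smallest)
          where
          R[1-ζ] = sub-mem 1-mem Rζ
          I = Principal C R (1# - ζ)
          open IsIdeal (Principal-isIdeal R-ring R[1-ζ])
          open IdealIn R-ring (Principal-isIdeal R-ring R[1-ζ])
          IP : I P
          IP = P∈⟨1-ζ⟩ R-ring j Rζ (proj₁ ζ-primitive) ζ^pʲ≉1
          I-power : ∀ {x} → ∃[ i ] x ≈ ζ ^ i → I (x - 1#)
          I-power (i , x≈) = I-resp (trans (solve 1 (λ a → :- (:1 :- a) := a :- :1) ≈-refl (ζ ^ i))
              (+-congʳ (sym x≈)))
            (neg-closed (1-ζ^i∈⟨1-ζ⟩ R-ring i Rζ))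
          I-one-unit : ∀ {x} → ∃[ t ] (Integral t × x ≈ 1# + P * t) → I (x - 1#)
          I-one-unit (t , It , x≈) = I-resp
              (trans (solve 2 (λ P t → P :* t := :1 :+ P :* t :- :1) ≈-refl P t) (+-congʳ (sym x≈)))
            (*-closedʳ IP (Integral⊆ R-ring It))
          weaken : ∀ {x} → ∃[ t ] (Integral t × x ≈ 1# + P^ (suc r) * t) → ∃[ t ]
              (Integral t × x ≈ 1# + P * t)
          weaken (t , It , x≈) = P^ r * t , Int.*-mem (Int.int-mem _) It
            , trans x≈ (+-congˡ (trans (*-congʳ (P^-suc r)) (*-assoc _ _ _)))
          trivial : ∀ x b → I (ψ′ x b - 1#)
          trivial x b =
            let w , y , y≡1 , x≡ = decompose x
                t , It , y≈ = ι-≡1 (valₚ y) (suc r) y≡1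
                s , Is , Ωw≈ = Ω≡1 w
                RΩ = Integral⊆ R-ring (Int.≈-mem (sym Ωw≈)
                    (Int.+-mem Int.1-mem (Int.*-mem (Int.int-mem (+ p)) Is)))
            in I-resp (+-congʳ (sym (ψ-decomposed {a} χₚω≈ x w y x≡ b)))
                 (*-≡1 (*-mem RΩ (*-mem (χₚ∈R (red y)) (χ′∈R b)))
                   (*-≡1 RΩ (I-one-unit (s , Is , Ωw≈))
                     (*-≡1 (χₚ∈R (red y)) (I-power (χₚy-power y y≡1)) (I-power (χ′-power b))))
                   (I-one-unit (weaken (^ᵘ-≡1 (ιᵘ y) (inv-integral y) It y≈ k))))

    ramified-case : ∀ M v′ → (v ℕ.∸ suc r) ℕ.⊔ v′ ≡ M → M ≢ 0 → Primitive χₚ → PExponent χ′ v′ →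
      ∀ ζ → PrimitiveRoot C (p ℕ.^ M) ζ →
      (∀ {a} → RestrictsTo a → _≐_ C R (ℤₚ[_] C (_≈ ζ))) ×
      (∀ {a} → RestrictsTo a → (∀ w → ∃[ t ] (Integral t × val (Ω w ^ᵘ (k ℤ.+ + a)) ≈ 1# + P * t)) →
        MaxCong (1# - ζ))
    ramified-case zero    v′ _ M≢0 = contradiction refl M≢0
    ramified-case (suc j) v′ v⊔v′≡ _ χₚ-primitive χ′-exponent ζ ζ-primitive =
      (λ {a} → ring≐ ζ-primitive {a}) , (λ {a} → ramified ζ-primitive {a})
      where open Ramified v′ j v⊔v′≡ χₚ-primitive χ′-exponent

-- Powers of the Teichmüller character

module TeichmüllerPowers {p : ℕ} (C : ℂₚ p) (𝝎 : Teichmüller p) (q∣p² : teichmüllerModulus p ℕ.∣ p ℕ.^ 2)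
    where
  open ℂₚ C hiding (zero) renaming (refl to ≈-refl)
  open Padic p
  open Characters C
  open TeichmüllerCharacter C 𝝎

  Ω-injective : ∀ u w → val (Ω u) ≈ val (Ω w) → val u ≡ val w [mod teichmüllerModulus p ]
  Ω-injective u w e = mod-trans (mod-sym (Teichmüller.lifts 𝝎 u))
    (mod-trans (mod-weaken q∣p² (ι-injective {valₚ (ω u)} {valₚ (ω w)} e 2)) (Teichmüller.lifts 𝝎 w))

-- Characters modulo an odd prime.

module OddTeichmüller {p : ℕ} (pr : ℕ.Prime p) (C : ℂₚ p) (𝝎 : Teichmüller p)
  (q≡p : teichmüllerModulus p ≡ p) where
  open ℂₚ C hiding (zero) renaming (refl to ≈-refl)
  open Field C
  open Roots C
  open Characters C
  open UnitPowers commRing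
  open TeichmüllerCharacter C 𝝎
  open TeichmüllerPowers C 𝝎 (subst (ℕ._∣ p ℕ.^ 2) (≡.sym q≡p) (ℕ.m∣m*n (p ℕ.^ 1)))
  open import Relation.Binary.Reasoning.Setoid setoid

  private
    instance
      p≢0 : ℕ.NonZero p
      p≢0 = ℕ.prime⇒nonZero pr

    n : ℕ
    n = p ℕ.∸ 1

    p≡ : p ≡ suc n
    p≡ = ≡.sym (ℕ.suc-pred p)

    to-p : ∀ {x y} → x ≡ y [mod teichmüllerModulus p ] → x ≡ y [mod p ]
    to-p {x} {y} = subst (λ q → x ≡ y [mod q ]) q≡p

    from-p : ∀ {x y} → x ≡ y [mod p ] → x ≡ y [mod teichmüllerModulus p ]
    from-p {x} {y} = subst (λ q → x ≡ y [mod q ]) (≡.sym q≡p)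

    i+1<p : ∀ (i : Fin n) → suc (Fin.toℕ i) ℕ.< p
    i+1<p i = subst (suc (Fin.toℕ i) ℕ.<_) (≡.sym p≡) (ℕ.s≤s (Fin.toℕ<n i))

    abstract
      representative : Fin n → Unit (ℤ/ (teichmüllerModulus p))
      representative i =
        let y , iy≡1 = inverse-mod {suc (Fin.toℕ i)} (ℕ.sym (ℕ.prime⇒coprime pr (i+1<p i)))
        in record { val = + suc (Fin.toℕ i) ; inv = y ; val*inv = from-p iy≡1 }

      val-representative : ∀ i → val (representative i) ≡ + suc (Fin.toℕ i)
      val-representative i = refl

    nonzero-residue : ∀ x a → a ℕ.< p → x ≡ + a [mod p ] → ¬ x ≡ + 0 [mod teichmüllerModulus p ] →
                      ∃[ i ] x ≡ val (representative i) [mod teichmüllerModulus p ]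
    nonzero-residue x zero    _   x≡0 x≢0 = contradiction (from-p x≡0) x≢0
    nonzero-residue x (suc a) a<p x≡a _   = Fin.fromℕ< a<n
      , mod-trans (from-p x≡a) (≡⇒≡mod (≡.sym (≡.trans (val-representative (Fin.fromℕ< a<n))
          (cong (λ b → + suc b) (Fin.toℕ-fromℕ< a<n)))))
      where
      a<n : a ℕ.< n
      a<n = ℕ.≤-pred (subst (suc a ℕ.<_) p≡ a<p)

    abstract
      represent : ∀ (u : Unit (ℤ/ (teichmüllerModulus p))) →
                  ∃[ i ] val u ≡ val (representative i) [mod teichmüllerModulus p ]
      represent u = nonzero-residue (val u) (val u ℤ.%ℕ p) (ℤ.n%ℕd<d (val u) p) (≡%ℕ (val u) p)
        (unit≢0 (subst (1 ℕ.<_) (≡.sym q≡p) (prime>1 pr)) u)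

    point : Fin n → Carrier
    point i = val (Ω (representative i))

    distinct : Distinct point
    distinct {i} {j} e = Fin.toℕ-injective (ℕ.suc-injective
      (≡mod⇒≡ (i+1<p i) (i+1<p j) (≡.subst₂ (λ x y → x ≡ y [mod p ]) (val-representative i)
          (val-representative j)
        (to-p (Ω-injective (representative i) (representative j) e)))))

    product : ∀ i j → Unit (ℤ/ (teichmüllerModulus p))
    product i j = AbelianGroup._∙_ ((ℤ/ (teichmüllerModulus p)) ˣ) (representative i) (representative j)

    closed : ∀ (Y : Character C (teichmüllerModulus p)) i j → let k = proj₁ (represent (product i j)) in
             Y ⟨ representative k ⟩ ≈ Y ⟨ representative i ⟩ * Y ⟨ representative j ⟩
    closed Y i j = χ-∙ Y (representative i) (representative j)
        {representative (proj₁ (represent (product i j)))}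
      (mod-sym (proj₂ (represent (product i j))))

    Ω-represent : ∀ w → val (Ω w) ≈ point (proj₁ (represent w))
    Ω-represent w = χ-cong Ω-character {w} {representative (proj₁ (represent w))} (proj₂ (represent w))

    -- The values of ω at 1, ..., p - 1 are distinct, nonzero and closed under multiplication, so
    -- `fermat` applies to them.
    Ω^n≈1 : ∀ w → val (Ω w) ^ n ≈ 1#
    Ω^n≈1 w = trans (^-congˡ n (Ω-represent w))
      (fermat point distinct (λ i j → _ , closed Ω-character i j) (λ i → unit≉0 (Ω (representative i)))
          (proj₁ (represent w)))

  -- Since ω is injective, Y is a multiplicative function of the value of ω, and interpolation finds
  -- the exponent; a primitive root modulo p is never chosen.
  character⇒power : ∀ (Y : Character C (teichmüllerModulus p)) →
                    ∃[ e ] (e ℕ.< p ℕ.∸ 1 × (∀ w → Y ⟨ w ⟩ ≈ val (Ω w) ^ e))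
  character⇒power Y =
    let i₀ = proj₁ (represent (AbelianGroup.ε ((ℤ/ (teichmüllerModulus p)) ˣ)))
        e , e<n , Y≈ = multiplicative⇒power point (λ i → Y ⟨ representative i ⟩) distinct
          (λ i j → _ , closed Ω-character i j , closed Y i j) i₀ (unit≉0 (⟦ Y ⟧ (representative i₀)))
    in e , e<n , λ w → let i , w≡ = represent w in
         trans (χ-cong Y {w} {representative i} w≡) (trans (Y≈ i) (^-congˡ e (sym (Ω-represent w))))

  power-trivial : ∀ m → + (p ℕ.∸ 1) ℤ.∣ m → ∀ w → val (Ω w ^ᵘ m) ≈ 1#
  power-trivial m (ℤ.divides c m≡) w = trans (reflexive (cong (λ m → val (Ω w ^ᵘ m)) m≡))
    (^ᵘ-multiple (Ω w) n (trans (reflexive (val-^ᵘ (Ω w) n)) (Ω^n≈1 w)) c)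

  -- Let a be the residue of m modulo p - 1, so that 0 < a < p - 1 and ω^m = ω^a. Were this trivial,
  -- the p - 1 distinct values of ω would all be roots of X^a - 1.
  power-nontrivial : ∀ m → ¬ (+ (p ℕ.∸ 1) ℤ.∣ m) →
                     ∃[ w ] (val (Ω w ^ᵘ m) ^ (p ℕ.∸ 1) ≈ 1# × ¬ val (Ω w ^ᵘ m) ≈ 1#)
  power-nontrivial m n∤m = search-root (Fin.any? (λ i → ¬? (point i ^ a ≈? 1#)))
    where
    n≢0 : n ≢ 0
    n≢0 n≡0 = contradiction (subst (1 ℕ.<_) (≡.trans p≡ (cong suc n≡0)) (prime>1 pr)) (ℕ.<-irrefl refl)
    instance
      n-nonZero : ℕ.NonZero n
      n-nonZero = ℕ.≢-nonZero n≢0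
    a : ℕ
    a = m ℤ.%ℕ n
    a<n : a ℕ.< n
    a<n = ℤ.n%ℕd<d m n
    m≡ : m ≡ + a ℤ.+ (m ℤ./ℕ n) ℤ.* + n
    m≡ = ℤ.a≡a%ℕn+[a/ℕn]*n m n
    a≢0 : a ≢ 0
    a≢0 a≡0 = n∤m (ℤ.divides (m ℤ./ℕ n)
        (≡.trans m≡ (≡.trans (cong (λ b → + b ℤ.+ (m ℤ./ℕ n) ℤ.* + n) a≡0) (ℤ.+-identityˡ _))))
    Ωᵐ≈Ωᵃ : ∀ w → val (Ω w ^ᵘ m) ≈ val (Ω w) ^ a
    Ωᵐ≈Ωᵃ w = begin
      val (Ω w ^ᵘ m)  ≡⟨ cong (λ m → val (Ω w ^ᵘ m)) m≡ ⟩
      val (Ω w ^ᵘ (+ a ℤ.+ (m ℤ./ℕ n) ℤ.* + n))  ≈⟨ ^ᵘ-+ (Ω w) (+ a) ((m ℤ./ℕ n) ℤ.* + n) ⟩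
      val (Ω w ^ᵘ (+ a)) * val (Ω w ^ᵘ ((m ℤ./ℕ n) ℤ.* + n))
        ≈⟨ *-cong (reflexive (val-^ᵘ (Ω w) a))
        (power-trivial ((m ℤ./ℕ n) ℤ.* + n) (ℤ.divides (m ℤ./ℕ n) refl) w) ⟩
      val (Ω w) ^ a * 1#  ≈⟨ *-identityʳ _ ⟩
      val (Ω w) ^ a  ∎
    search-root : Dec (∃[ i ] ¬ point i ^ a ≈ 1#) →
                  ∃[ w ] (val (Ω w ^ᵘ m) ^ n ≈ 1# × ¬ val (Ω w ^ᵘ m) ≈ 1#)
    search-root (yes (i , xᵃ≉1)) = w
      , trans (^-congˡ n (Ωᵐ≈Ωᵃ w)) (trans (^-assocʳ (val (Ω w)) a n)
          (trans (reflexive (cong (val (Ω w) ^_) (ℕ.*-comm a n))) (^-multiple-1 n a (Ω^n≈1 w))))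
      , λ Ωᵐ≈1 → xᵃ≉1 (trans (sym (Ωᵐ≈Ωᵃ w)) Ωᵐ≈1)
      where w = representative i
    search-root (no ∄i) = contradiction
      (roots-of-unity-bound a a≢0 point distinct (λ i → decidable-stable (_ ≈? _) λ ¬x → ∄i (i , ¬x)))
      (ℕ.<⇒≱ a<n)

-- Characters modulo 4.

module TwoTeichmüller (C : ℂₚ 2) (𝝎 : Teichmüller 2) where
  open ℂₚ C hiding (zero) renaming (refl to ≈-refl)
  open Field C
  open Padic 2
  open OneUnits C
  open Characters C
  open UnitPowers commRing
  open TeichmüllerCharacter C 𝝎
  open TeichmüllerPowers C 𝝎 ℕ.∣-refl
  open import Relation.Binary.Reasoning.Setoid setoid

  odd : ∀ a b → a ℤ.* b ≡ + 1 [mod 2 ] → a ≡ + 1 [mod 2 ]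
  odd a b ab≡1 = residue (a ℤ.%ℕ 2) (ℤ.n%ℕd<d a 2) (≡%ℕ a 2)
    where
    residue : ∀ c → c ℕ.< 2 → a ≡ + c [mod 2 ] → a ≡ + 1 [mod 2 ]
    residue 0 _ a≡0 = contradiction a≡0
        (unit≢0 (ℕ.s≤s (ℕ.s≤s ℕ.z≤n)) (record { val = a ; inv = b ; val*inv = ab≡1 }))
    residue 1 _ a≡1 = a≡1
    residue (suc (suc _)) (ℕ.s≤s (ℕ.s≤s ())) _

  unit-mod-4 : (u : Unit (ℤ/ (teichmüllerModulus 2))) → val u ≡ + 1 [mod 4 ] ⊎ val u ≡ ℤ.- + 1 [mod 4 ]
  unit-mod-4 u = residue (val u ℤ.%ℕ 4) (ℤ.n%ℕd<d (val u) 4) (≡%ℕ (val u) 4)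
    where
    even : ∀ a → val u ≡ + a [mod 4 ] → + a ≡ + 0 [mod 2 ] → ¬ val u ≡ + 1 [mod 2 ]
    even a u≡a a≡0 u≡1 = contradiction
      (≡mod⇒≡ {1} {0} (ℕ.s≤s (ℕ.s≤s ℕ.z≤n)) (ℕ.s≤s ℕ.z≤n)
        (mod-trans (mod-sym u≡1) (mod-trans (mod-weaken (ℕ.divides 2 refl) u≡a) a≡0))) λ ()
    u-odd : val u ≡ + 1 [mod 2 ]
    u-odd = odd (val u) (inv u) (mod-weaken (ℕ.divides 2 refl) (val*inv u))
    residue : ∀ c → c ℕ.< 4 → val u ≡ + c [mod 4 ] → val u ≡ + 1 [mod 4 ] ⊎ val u ≡ ℤ.- + 1 [mod 4 ]
    residue 0 _ u≡0 = contradiction u-odd (even 0 u≡0 mod-refl)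
    residue 1 _ u≡1 = inj₁ u≡1
    residue 2 _ u≡2 = contradiction u-odd (even 2 u≡2 (mod (ℤ.divides (+ 1) refl)))
    residue 3 _ u≡3 = inj₂ (mod-trans u≡3 (mod (ℤ.divides (+ 1) refl)))
    residue (suc (suc (suc (suc _)))) (ℕ.s≤s (ℕ.s≤s (ℕ.s≤s (ℕ.s≤s ())))) _

  -1₄ : Unit (ℤ/ (teichmüllerModulus 2))
  -1₄ = -1ᵘ

  square≈1 : ∀ (Y : Character C (teichmüllerModulus 2)) u → Y ⟨ u ⟩ ^ 2 ≈ 1#
  square≈1 Y u = χ-^≈1 Y u 2 (u²≡1 (unit-mod-4 u))
    where
    u²≡1 : val u ≡ + 1 [mod 4 ] ⊎ val u ≡ ℤ.- + 1 [mod 4 ] → val u ℤ.^ 2 ≡ + 1 [mod 4 ]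
    u²≡1 (inj₁ u≡1)  = mod-^ u≡1 2
    u²≡1 (inj₂ u≡-1) = mod-^ u≡-1 2

  root-of-x²-1 : ∀ {x} → x ^ 2 ≈ 1# → ¬ x ≈ 1# → x ≈ - 1#
  root-of-x²-1 {x} x²≈1 x≉1 = x-y≈0⇒x≈y x (- 1#) (no-zero-divisors (begin
      (x - 1#) * (x - (- 1#))   ≈⟨ solve 1 (λ x → (x :- :1) :* (x :- (:- :1)) := x :* (x :* :1) :- :1)
          ≈-refl x ⟩
      x ^ 2 - 1#  ≈⟨ x≈y⇒x-y≈0 x²≈1 ⟩
      0#  ∎)
    (λ x-1≈0 → x≉1 (x-y≈0⇒x≈y x 1# x-1≈0)))

  Ω-1≉1 : ¬ val (Ω -1₄) ≈ 1#
  Ω-1≉1 Ω≈1 = contradiction (≡mod⇒≡ {3} {1} (ℕ.s≤s (ℕ.s≤s (ℕ.s≤s (ℕ.s≤s ℕ.z≤n)))) (ℕ.s≤s (ℕ.s≤s ℕ.z≤n))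
    (mod-trans (mod (ℤ.divides (+ 1) refl))
      (Ω-injective -1₄ ε (trans Ω≈1 (sym (χ-1 Ω-character {ε} mod-refl)))))) λ ()
    where open AbelianGroup ((ℤ/ (teichmüllerModulus 2)) ˣ) using (ε)

  Ω-1≈-1 : val (Ω -1₄) ≈ - 1#
  Ω-1≈-1 = root-of-x²-1 (square≈1 Ω-character -1₄) Ω-1≉1

  power-trivial : ∀ m → + 2 ℤ.∣ m → ∀ w → val (Ω w ^ᵘ m) ≈ 1#
  power-trivial m (ℤ.divides c m≡) w = trans (reflexive (cong (λ m → val (Ω w ^ᵘ m)) m≡))
    (^ᵘ-multiple (Ω w) 2 (square≈1 Ω-character w) c)

  -- The units modulo 4 are 1 and -1, so Y is determined by its sign at -1, and ω has sign -1 there.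
  character⇒power : ∀ (Y : Character C (teichmüllerModulus 2)) → ∃[ e ]
      (e ℕ.≤ 1 × (∀ w → Y ⟨ w ⟩ ≈ val (Ω w) ^ e))
  character⇒power Y = from-sign (Y ⟨ -1₄ ⟩ ≈? 1#)
    where
    Y-trivial : Y ⟨ -1₄ ⟩ ≈ 1# → ∀ w → val w ≡ + 1 [mod 4 ] ⊎ val w ≡ ℤ.- + 1 [mod 4 ] → Y ⟨ w ⟩ ≈ 1#
    Y-trivial Y≈1 w (inj₁ w≡1)  = χ-1 Y {w} w≡1
    Y-trivial Y≈1 w (inj₂ w≡-1) = trans (χ-cong Y {w} { -1₄} w≡-1) Y≈1
    Y-sign : ¬ Y ⟨ -1₄ ⟩ ≈ 1# → ∀ w → val w ≡ + 1 [mod 4 ] ⊎ val w ≡ ℤ.- + 1 [mod 4 ] → Y ⟨ w ⟩ ≈ val (Ω w)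
        * 1#
    Y-sign Y≉1 w (inj₁ w≡1)  = trans (χ-1 Y {w} w≡1) (sym (trans (*-identityʳ _) (χ-1 Ω-character {w} w≡1)))
    Y-sign Y≉1 w (inj₂ w≡-1) = begin
      Y ⟨ w ⟩  ≈⟨ χ-cong Y {w} { -1₄} w≡-1 ⟩
      Y ⟨ -1₄ ⟩      ≈⟨ root-of-x²-1 (square≈1 Y -1₄) Y≉1 ⟩
      - 1#  ≈⟨ Ω-1≈-1 ⟨
      val (Ω -1₄)    ≈⟨ χ-cong Ω-character {w} { -1₄} w≡-1 ⟨
      val (Ω w)      ≈⟨ *-identityʳ _ ⟨
      val (Ω w) * 1# ∎
    from-sign : Dec (Y ⟨ -1₄ ⟩ ≈ 1#) → ∃[ e ] (e ℕ.≤ 1 × (∀ w → Y ⟨ w ⟩ ≈ val (Ω w) ^ e))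
    from-sign (yes Y≈1) = 0 , ℕ.z≤n , λ w → Y-trivial Y≈1 w (unit-mod-4 w)
    from-sign (no Y≉1)  = 1 , ℕ.≤-refl , λ w → Y-sign Y≉1 w (unit-mod-4 w)

  power≡1-mod-2 : ∀ m w → ∃[ t ] (Integral t × val (Ω w ^ᵘ m) ≈ 1# + P * t)
  power≡1-mod-2 m w = let t , It , e = ι-≡1 (valₚ (ω w ^ᵘ m)) 1 unit-odd in
    t , It , trans (sym (ι-^ᵘ (ω w) m)) e
    where
    unit-odd : seq (valₚ (ω w ^ᵘ m)) 1 ≡ + 1 [mod 2 ]
    unit-odd = odd (seq (valₚ (ω w ^ᵘ m)) 1) (seq (invₚ (ω w ^ᵘ m)) 1)
        (_≈ₚ_.at (val*inv {ℤₚ-ring 2} (ω w ^ᵘ m)) 1)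

  -- Since ω(-1) = -1, the hypothesis gives ω(-1)^(k+a) = ω(-1)^(2a) = 1, whereas an odd exponent
  -- would give -1.
  even-from-parity : ∀ k a → val (-1ᵘ {commRing} ^ᵘ k) ≈ val (Ω -1₄ ^ᵘ (+ a)) → + 2 ℤ.∣ (k ℤ.+ + a)
  even-from-parity k a parity = residue ((k ℤ.+ + a) ℤ.%ℕ 2) (ℤ.n%ℕd<d (k ℤ.+ + a) 2)
      (ℤ.a≡a%ℕn+[a/ℕn]*n (k ℤ.+ + a) 2)
    where
    d = (k ℤ.+ + a) ℤ./ℕ 2
    Ω^[k+a]≈1 : val (Ω -1₄ ^ᵘ (k ℤ.+ + a)) ≈ 1#
    Ω^[k+a]≈1 = begin
      val (Ω -1₄ ^ᵘ (k ℤ.+ + a))  ≈⟨ ^ᵘ-+ (Ω -1₄) k (+ a) ⟩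
      val (Ω -1₄ ^ᵘ k) * val (Ω -1₄ ^ᵘ (+ a))
        ≈⟨ *-congʳ (trans (^ᵘ-cong {Ω -1₄} { -1ᵘ} k Ω-1≈-1) parity) ⟩
      val (Ω -1₄ ^ᵘ (+ a)) * val (Ω -1₄ ^ᵘ (+ a))    ≈⟨ ^ᵘ-+ (Ω -1₄) (+ a) (+ a) ⟨
      val (Ω -1₄ ^ᵘ (+ a ℤ.+ + a))
        ≈⟨ power-trivial (+ a ℤ.+ + a) (ℤ.divides (+ a) (lem (+ a))) -1₄ ⟩
      1#  ∎
      where
      lem : ∀ a → a ℤ.+ a ≡ a ℤ.* + 2
      lem = ℤ-solver.solve-∀
    residue : ∀ c → c ℕ.< 2 → k ℤ.+ + a ≡ + c ℤ.+ d ℤ.* + 2 → + 2 ℤ.∣ (k ℤ.+ + a)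
    residue 0 _ k+a≡ = ℤ.divides d (≡.trans k+a≡ (ℤ.+-identityˡ _))
    residue 1 _ k+a≡ = contradiction (begin
      val (Ω -1₄)  ≈⟨ *-identityʳ _ ⟨
      val (Ω -1₄) * 1#  ≈⟨ *-identityʳ _ ⟨
      val (Ω -1₄) * 1# * 1#
        ≈⟨ *-congˡ (power-trivial (d ℤ.* + 2) (ℤ.divides d refl) -1₄) ⟨
      val (Ω -1₄ ^ᵘ (+ 1)) * val (Ω -1₄ ^ᵘ (d ℤ.* + 2))  ≈⟨ ^ᵘ-+ (Ω -1₄) (+ 1) (d ℤ.* + 2) ⟨
      val (Ω -1₄ ^ᵘ (+ 1 ℤ.+ d ℤ.* + 2))  ≡⟨ cong (λ m → val (Ω -1₄ ^ᵘ m)) k+a≡ ⟨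
      val (Ω -1₄ ^ᵘ (k ℤ.+ + a))  ≈⟨ Ω^[k+a]≈1 ⟩
      1#  ∎) Ω-1≉1
    residue (suc (suc _)) (ℕ.s≤s (ℕ.s≤s ())) _

-- Characters with totally ramified values

module Valuation {p : ℕ} (C : ℂₚ p) where
  open ℂₚ C hiding (zero) renaming (refl to ≈-refl)
  open Field C
  open AddSupremum ℚ._≤_ using (_≤⊤⁺) renaming ([_] to ≤[_])
  open import Algebra.Properties.Group ℚ.+-0-group using () renaming
      (identityʳ-unique to +ℚ-identityʳ-unique)

  ord-1 : ord 1# ≡ [ ℚ.0ℚ ]
  ord-1 = finite (ord 1#) refl
    where
    idempotent : ord 1# +∞ ord 1# ≡ ord 1#
    idempotent = ≡.trans (≡.sym (ord-* 1# 1#)) (ord-cong (*-identityˡ 1#))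
    finite : ∀ a → ord 1# ≡ a → ord 1# ≡ [ ℚ.0ℚ ]
    finite ⊤⁺    ord≡ = contradiction (Equivalence.to (ord-∞ 1#) ord≡) 1≉0
    finite [ a ] ord≡ = ≡.trans ord≡ (cong [_] (+ℚ-identityʳ-unique a a (just-injective
      (≡.trans (≡.sym (cong₂ _+∞_ ord≡ ord≡)) (≡.trans idempotent ord≡)))))

  HasIntegralOrd : Carrier → Set
  HasIntegralOrd x = fromℕ∞ 0 ≤∞ ord x

  +∞-nonneg : ∀ a b → fromℕ∞ 0 ≤∞ a → fromℕ∞ 0 ≤∞ b → fromℕ∞ 0 ≤∞ (a +∞ b)
  +∞-nonneg ⊤⁺    b     _       _       = _ ≤⊤⁺
  +∞-nonneg [ a ] ⊤⁺    _       _       = _ ≤⊤⁺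
  +∞-nonneg [ a ] [ b ] ≤[ 0≤a ] ≤[ 0≤b ] = ≤[ ℚ.+-mono-≤ {ℚ.0ℚ} {a} {ℚ.0ℚ} {b} 0≤a 0≤b ]

  HasIntegralOrd-isSubring : IsSubring HasIntegralOrd
  HasIntegralOrd-isSubring = record
    { ≈-mem = λ x≈y → subst (fromℕ∞ 0 ≤∞_) (ord-cong x≈y)
    ; ι-mem = λ z → Equivalence.from (ord-ι z 0) mod-1
    ; +-mem = λ {x} {y} → ord-+ x y (fromℕ∞ 0)
    ; *-mem = λ {x} {y} 0≤x 0≤y → subst (fromℕ∞ 0 ≤∞_) (≡.sym (ord-* x y))
        (+∞-nonneg (ord x) (ord y) 0≤x 0≤y) }

  -- A negative valuation would become more negative with each further power, while the valuation of
  -- 1 is 0.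
  root-of-unity-ord : ∀ {x} n → n ≢ 0 → x ^ n ≈ 1# → HasIntegralOrd x
  root-of-unity-ord zero n≢0 _ = contradiction refl n≢0
  root-of-unity-ord {x} (suc n) _ xⁿ≈1 = nonneg (ord x) refl
    where
    nonneg : ∀ a → ord x ≡ a → HasIntegralOrd x
    nonneg ⊤⁺    ord≡ = subst (fromℕ∞ 0 ≤∞_) (≡.sym ord≡) (_ ≤⊤⁺)
    nonneg [ a ] ord≡ with ℚ.0ℚ ℚ.≤? a
    ... | yes 0≤a = subst (fromℕ∞ 0 ≤∞_) (≡.sym ord≡) ≤[ 0≤a ]
    ... | no 0≰a = let b , ord-xⁿ≡ , b≤0 = power n in
          contradiction (just-injective (≡.trans (≡.sym (ord-power-suc n b ord-xⁿ≡))
              (≡.trans (ord-cong xⁿ≈1) ord-1)))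
            (ℚ.<⇒≢ (ℚ.+-mono-<-≤ {a} {ℚ.0ℚ} {b} {ℚ.0ℚ} (ℚ.≰⇒> 0≰a) b≤0))
      where
      ord-power-suc : ∀ m b → ord (x ^ m) ≡ [ b ] → ord (x ^ suc m) ≡ [ a ℚ.+ b ]
      ord-power-suc m b e = ≡.trans (ord-* x (x ^ m)) (cong₂ _+∞_ ord≡ e)
      power : ∀ m → ∃[ b ] (ord (x ^ m) ≡ [ b ] × b ℚ.≤ ℚ.0ℚ)
      power zero    = ℚ.0ℚ , ord-1 , ℚ.≤-refl
      power (suc m) = let b , e , b≤0 = power m in
        a ℚ.+ b , ord-power-suc m b e , ℚ.+-mono-≤ {a} {ℚ.0ℚ} {b} {ℚ.0ℚ} (ℚ.<⇒≤ (ℚ.≰⇒> 0≰a)) b≤0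

  unit-ord : ∀ {x y} → x * y ≈ 1# → HasIntegralOrd y → ord x ≤∞ fromℕ∞ 0
  unit-ord {x} {y} xy≈1 0≤y = compare (ord x) (ord y)
      (≡.trans (≡.sym (ord-* x y)) (≡.trans (ord-cong xy≈1) ord-1)) 0≤y
    where
    compare : ∀ a b → a +∞ b ≡ [ ℚ.0ℚ ] → fromℕ∞ 0 ≤∞ b → a ≤∞ fromℕ∞ 0
    compare [ a ] [ b ] a+b≡0 ≤[ 0≤b ] = ≤[ ≡.subst₂ ℚ._≤_ (ℚ.+-identityʳ a) (just-injective a+b≡0)
        (ℚ.+-monoʳ-≤ a 0≤b) ]

module TotallyRamifiedAtTwo (C : ℂₚ 2) where
  open ℂₚ C hiding (zero) renaming (refl to ≈-refl)
  open Field C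
  open Roots C
  open Padic 2
  open OneUnits C
  open Characters C
  open Valuation C
  open import Relation.Binary.Reasoning.Setoid setoid

  -- The residue field has two elements. For z even the sum is 1 modulo 2, and for z odd it is n
  -- modulo 2; both are units.
  geo-odd : ∀ n i → + n ℤ.* i ≡ + 1 [mod 2 ] → n ≢ 0 → ∀ z → InvertibleIn Integral (geo commRing n (ι z))
  geo-odd zero    i _     n≢0 z = contradiction refl n≢0
  geo-odd n@(suc m) i ni≡1 _ z = residue (seq z 1 ℤ.%ℕ 2) (ℤ.n%ℕd<d (seq z 1) 2) (≡%ℕ (seq z 1) 2)
    where
    residue : ∀ c → c ℕ.< 2 → seq z 1 ≡ + c [mod 2 ] → InvertibleIn Integral (geo commRing n (ι z))
    residue 0 _ z≡0 = let t , It , z≈ = ι-≡ z (+ 0) 1 z≡0 in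
      InvertibleIn-≈ Integral-isSubring (begin
        1# + P * (t * geo commRing m (ι z))  ≈⟨ +-congˡ (*-assoc P t _) ⟨
        1# + P * t * geo commRing m (ι z)
          ≈⟨ +-congˡ (*-congʳ (trans (sym (+-identityˡ _)) (+-congʳ (sym int-0)))) ⟩
        1# + (int (+ 0) + P * t) * geo commRing m (ι z) ≈⟨ +-congˡ (*-congʳ z≈) ⟨
        geo commRing n (ι z)  ∎)
      (invertible-1+P (Int.*-mem It (Int.geo-mem m (z , ≈-refl))))
    residue 1 _ z≡1 = let t , It , z≈ = ι-≡1 z 1 z≡1
                          g , Ig , geo≈ = geo-≡ n It
                      in InvertibleIn-≈ Integral-isSubring (sym (trans (geo-cong n z≈) geo≈))
                          (invertible-mod-p (+ n) i ni≡1 Ig)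
    residue (suc (suc _)) (ℕ.s≤s (ℕ.s≤s ())) _

  -- 1 + z + … + z^(n-1) is a unit for every z ∈ ℤ₂ when n is odd, and is
  -- divisible by z - y when y is an n-th root of unity other than 1.
  odd-root-not-ramified : ∀ {y} n i → + n ℤ.* i ≡ + 1 [mod 2 ] → n ≢ 0 → y ^ n ≈ 1# → ¬ y ≈ 1# →
                          ∀ z → ord (y - ι z) ≤∞ fromℕ∞ 0
  odd-root-not-ramified {y} n i ni≡1 n≢0 yⁿ≈1 y≉1 z =
    let invertible {g⁻¹} _ Ig⁻¹ gg⁻¹≈1 = geo-odd n i ni≡1 n≢0 z in
    unit-ord {y - ι z} { - (geo-difference n (ι z) y * g⁻¹)} (begin
      (y - ι z) * (- (d * g⁻¹))
        ≈⟨ solve 4 (λ y z d g → (y :- z) :* (:- (d :* g)) := (z :- y) :* d :* g) ≈-refl y (ι z) d g⁻¹ ⟩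
      (ι z - y) * d * g⁻¹  ≈⟨ *-congʳ (geo-sub n (ι z) y) ⟨
      (geo commRing n (ι z) - geo commRing n y) * g⁻¹
        ≈⟨ *-congʳ (trans (+-congˡ (-‿cong (geo-root-of-unity n yⁿ≈1 y≉1)))
        (solve 1 (λ a → a :- con (+ 0) := a) ≈-refl _)) ⟩
      geo commRing n (ι z) * g⁻¹  ≈⟨ gg⁻¹≈1 ⟩
      1#  ∎)
      (neg-mem (*-mem (geo-difference-mem n (ι-mem z) (root-of-unity-ord n n≢0 yⁿ≈1))
          (Integral⊆ HasIntegralOrd-isSubring Ig⁻¹)))
    where
    open IsSubring HasIntegralOrd-isSubring
    d = geo-difference n (ι z) y

  -- Write N! = 2^e n with n odd. Then y = χ(u)^(2^e) is an n-th root of unity. Total ramification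
  -- supplies z in ℤ₂ congruent to y modulo the maximal ideal, which `odd-root-not-ramified` forbids
  -- unless y = 1. So every value has order dividing 2^e, and the exact exponent is found by
  -- descent.
  totallyRamified⇒exponent : ∀ {N} .{{_ : ℕ.NonZero N}} (χ : Character C N) → TotallyRamified C (Im χ) →
                             ∃[ j ] PExponent χ j
  totallyRamified⇒exponent {N} χ ramified = from-2-part
      (p-part (ℕ.s≤s (ℕ.s≤s ℕ.z≤n)) (N ℕ.!) (ℕ.≢-nonZero⁻¹ (N ℕ.!) {{N ℕ.!≢0}}))
    where
    from-2-part : ∃[ e ] ∃[ n ] (N ℕ.! ≡ 2 ℕ.^ e ℕ.* n × ¬ 2 ℕ.∣ n) → ∃[ j ] PExponent χ j
    from-2-part (e , n , N!≡ , 2∤n) = find-PExponent χ e λ u → decidable-stable (_ ≈? _) λ y≉1 →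
        let z , ord≰0 = ramified (χ ⟨ u ⟩ ^ (2 ℕ.^ e)) (y-mem u (2 ℕ.^ e))
              (root-of-unity-ord n n≢0 (yⁿ≈1 u)) in
        ord≰0 (odd-root-not-ramified n (proj₁ n⁻¹) (proj₂ n⁻¹) n≢0 (yⁿ≈1 u) y≉1 z)
      where
      n≢0 : n ≢ 0
      n≢0 n≡0 = 2∤n (subst (2 ℕ.∣_) (≡.sym n≡0) (2 ℕ.∣0))
      n⁻¹ = inverse-mod (ℕ.sym (prime∤⇒coprime ℕ.prime[2] 2∤n))
      y-mem : ∀ u m → ℚₚ⟨_⟩ C (Im χ) (χ ⟨ u ⟩ ^ m)
      y-mem u m = gen (^-unit u m , χ-^ χ u m {^-unit u m} mod-refl)
      yⁿ≈1 : ∀ u → (χ ⟨ u ⟩ ^ (2 ℕ.^ e)) ^ n ≈ 1#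
      yⁿ≈1 u = begin
        (χ ⟨ u ⟩ ^ (2 ℕ.^ e)) ^ n  ≈⟨ ^-assocʳ (χ ⟨ u ⟩) (2 ℕ.^ e) n ⟩
        χ ⟨ u ⟩ ^ (2 ℕ.^ e ℕ.* n)  ≡⟨ cong (χ ⟨ u ⟩ ^_) N!≡ ⟨
        χ ⟨ u ⟩ ^ (N ℕ.!)  ≈⟨ χ-^≈1 χ u (N ℕ.!) (UnitSearch.unit-exponent N u) ⟩
        1#  ∎

  GeneratedByRoot : ∀ {N} → Character C N → ℕ → Set
  GeneratedByRoot χ j = ∃[ ζ ] (PrimitiveRoot C (2 ℕ.^ j) ζ × Generates C ζ (Im χ))

  -- A value of order exactly 2^j generates, since all other values are 2^j-th roots of unity and
  -- hence powers of it. Exponent 1 is excluded because a primitive character of modulus N ≠ 1 is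
  -- nontrivial.
  exponent⇒generated : ∀ {N} (χ : Character C N) → Primitive χ → N ≢ 1 → ∃[ j ] PExponent χ j →
                       ∃[ j ] (1 ℕ.≤ j × GeneratedByRoot χ j)
  exponent⇒generated χ χ-primitive N≢1 (zero , χ^1≈1 , _) =
    contradiction (λ u → trans (sym (*-identityʳ _)) (χ^1≈1 u)) (primitive-nontrivial χ χ-primitive N≢1)
  exponent⇒generated χ χ-primitive N≢1 (suc j , χ^≈1 , nontrivial) =
    let b , χb≉1 = nontrivial j refl
        ζ-primitive = prime-power-PrimitiveRoot ℕ.prime[2] j (χ^≈1 b) χb≉1
    in suc j , ℕ.s≤s ℕ.z≤n , χ ⟨ b ⟩ , ζ-primitive , λ x → mk⇔
         (λ (u , χu≈x) → let i , χu≈ = root-of-unity⇒power (ℕ.≢-nonZero⁻¹ _ {{ℕ.m^n≢0 2 (suc j)}})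
                               ζ-primitive (χ^≈1 u)
                         in i , trans (sym χu≈x) χu≈)
         (λ (i , x≈) → ^-unit b i , trans (χ-^ χ b i {^-unit b i} mod-refl) (sym x≈))

  generated⇒exponent : ∀ {N} (χ : Character C N) j → GeneratedByRoot χ j → PExponent χ j
  generated⇒exponent χ j (ζ , ζ-primitive , generates) = χ^≈1 , nontrivial
    where
    χ^≈1 : ∀ u → χ ⟨ u ⟩ ^ (2 ℕ.^ j) ≈ 1#
    χ^≈1 u = let i , χu≈ = Equivalence.to (generates (χ ⟨ u ⟩)) (u , ≈-refl) in begin
      χ ⟨ u ⟩ ^ (2 ℕ.^ j)    ≈⟨ ^-congˡ (2 ℕ.^ j) χu≈ ⟩
      (ζ ^ i) ^ (2 ℕ.^ j)    ≈⟨ ^-assocʳ ζ i (2 ℕ.^ j) ⟩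
      ζ ^ (i ℕ.* 2 ℕ.^ j)    ≡⟨ cong (ζ ^_) (ℕ.*-comm i (2 ℕ.^ j)) ⟩
      ζ ^ (2 ℕ.^ j ℕ.* i)    ≈⟨ ^-multiple-1 (2 ℕ.^ j) i (proj₁ ζ-primitive) ⟩
      1#  ∎
    nontrivial : ∀ i → j ≡ suc i → ∃[ u ] ¬ χ ⟨ u ⟩ ^ (2 ℕ.^ i) ≈ 1#
    nontrivial i j≡ = let u , χu≈ζ = Equivalence.from (generates ζ) (1 , sym (*-identityʳ ζ)) in
      u , λ χu^≈1 → proj₂ ζ-primitive (2 ℕ.^ i) (ℕ.m^n>0 2 i)
            (subst (λ e → 2 ℕ.^ i ℕ.< 2 ℕ.^ e) (≡.sym j≡) (ℕ.^-monoʳ-< 2 (ℕ.s≤s (ℕ.s≤s ℕ.z≤n)) (ℕ.n<1+n i)))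
            (trans (^-congˡ (2 ℕ.^ i) (sym χu≈ζ)) χu^≈1)

-- The seven cases

≡1⊎≡⇒∣ : ∀ {m n} → m ≡ 1 ⊎ m ≡ n → m ℕ.∣ n
≡1⊎≡⇒∣ {n = n} (inj₁ refl) = ℕ.1∣ n
≡1⊎≡⇒∣         (inj₂ refl) = ℕ.∣-refl

teichmüllerModulus-odd : ∀ p → 2 ℕ.< p → teichmüllerModulus p ≡ p
teichmüllerModulus-odd (suc (suc (suc p))) _ = refl
teichmüllerModulus-odd 1 (ℕ.s≤s ())
teichmüllerModulus-odd 2 (ℕ.s≤s (ℕ.s≤s ()))

odd-prime : ∀ {p} → ℕ.Prime p → 2 ℕ.< p → p ≡ 1 ℕ.+ 2 ℕ.* (p ℕ./ 2)
odd-prime {p} pr 2<p = remainder (p ℕ.% 2) (ℕ.m%n<n p 2) (ℕ.m≡m%n+[m/n]*n p 2)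
  where
  remainder : ∀ a → a ℕ.< 2 → p ≡ a ℕ.+ (p ℕ./ 2) ℕ.* 2 → p ≡ 1 ℕ.+ 2 ℕ.* (p ℕ./ 2)
  remainder 0 _ p≡ with ℕ.prime⇒irreducible pr (ℕ.divides (p ℕ./ 2) p≡)
  ... | inj₁ ()
  ... | inj₂ 2≡p = contradiction 2≡p (ℕ.<⇒≢ 2<p)
  remainder 1 _ p≡ = ≡.trans p≡ (cong suc (ℕ.*-comm (p ℕ./ 2) 2))
  remainder (suc (suc _)) (ℕ.s≤s (ℕ.s≤s ())) _

module OddPrime {p : ℕ} (pr : ℕ.Prime p) (2<p : 2 ℕ.< p) (C : ℂₚ p) (𝝎 : Teichmüller p)
  (v N′ : ℕ) (p∤N′ : ¬ p ℕ.∣ N′) (χ : Character C (p ℕ.^ v ℕ.* N′))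
  (χₚ : Character C (p ℕ.^ v)) (χ′ : Character C N′) (χ≈χₚχ′ : IsProduct χ χₚ χ′) (k : ℤ) where
  open ℂₚ C hiding (zero) renaming (refl to ≈-refl)
  open Field C
  open OneUnits C
  open Characters C
  open UnitPowers commRing
  open TeichmüllerCharacter C 𝝎

  private
    q≡p : teichmüllerModulus p ≡ p
    q≡p = teichmüllerModulus-odd p 2<p

    p¹≡p : p ℕ.^ 1 ≡ p
    p¹≡p = ℕ.*-identityʳ p

  open OddTeichmüller pr C 𝝎 q≡p
  open Congruence pr C 𝝎 0 (≡.trans q≡p (≡.sym p¹≡p)) (ℕ.s≤s ℕ.z≤n) (odd-gains (p ℕ./ 2) (odd-prime pr 2<p))
  open Product v N′ p∤N′ χ χₚ χ′ χ≈χₚχ′ k public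

  private instance
    p≢0 : ℕ.NonZero p
    p≢0 = ℕ.prime⇒nonZero pr

  restricts-to-some : ∃[ a ] (a ℕ.≤ p ℕ.∸ 2 × RestrictsTo a)
  restricts-to-some = let e , e<p-1 , χₚω≈ = character⇒power (restriction {v} χₚ) in
    e , subst (e ℕ.≤_) (ℕ.∸-+-assoc p 1 1) (ℕ.∸-monoˡ-≤ 1 e<p-1) , restricts e χₚω≈

  not-dividing : ∀ {a} → RestrictsTo a → ¬ (+ (p ℕ.∸ 1) ℤ.∣ (k ℤ.+ + a)) → MaxCong 1#
  not-dividing {a} χₚω≈ ∤k+a = let w , Ωⁿ≈1 , Ω≉1 = power-nontrivial (k ℤ.+ + a) ∤k+a in
    -- The value is a root of unity of order dividing p - 1, and p - 1 ≡ -1 is its own inverse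
    -- modulo p.
    maxCong-1-from-ω {a} χₚω≈ w (p ℕ.∸ 1) (ℤ.- + 1) [p-1]*-1≡1 Ωⁿ≈1 Ω≉1
    where
    lem : ∀ n → n ℤ.* (ℤ.- + 1) ℤ.- + 1 ≡ (ℤ.- + 1) ℤ.* (+ 1 ℤ.+ n)
    lem = ℤ-solver.solve-∀
    [p-1]*-1≡1 : + (p ℕ.∸ 1) ℤ.* (ℤ.- + 1) ≡ + 1 [mod p ]
    [p-1]*-1≡1 = mod (ℤ.divides (ℤ.- + 1) (≡.trans (lem (+ (p ℕ.∸ 1)))
      (cong (λ m → (ℤ.- + 1) ℤ.* + m) (ℕ.suc-pred p))))

  dichotomy : ∀ {ζ} → (∀ {a} → RestrictsTo a →
      (∀ w → ∃[ t ] (Integral t × val (Ω w ^ᵘ (k ℤ.+ + a)) ≈ 1# + P * t)) →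
                        MaxCong (1# - ζ)) →
              ∀ {a} → RestrictsTo a →
              (+ (p ℕ.∸ 1) ℤ.∣ (k ℤ.+ + a) → MaxCong (1# - ζ)) ×
              (¬ (+ (p ℕ.∸ 1) ℤ.∣ (k ℤ.+ + a)) → MaxCong 1#)
  dichotomy maxCong-1-ζ {a} χₚω≈ =
    (λ ∣k+a → maxCong-1-ζ {a} χₚω≈ λ w → 0# , Int.0-mem ,
      trans (power-trivial (k ℤ.+ + a) ∣k+a w) (solve 1 (λ P → :1 := :1 :+ P :* con (+ 0)) ≈-refl P)) ,
    not-dividing {a} χₚω≈

  case-I : (p ℕ.^ v ℕ.* N′ ≡ 1 ⊎ p ℕ.^ v ℕ.* N′ ≡ p) →
    (∃[ a ] (a ℕ.≤ p ℕ.∸ 2 × IsTeichmüllerPower 𝝎 χ a)) ×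
    (∀ a → a ℕ.≤ p ℕ.∸ 2 → IsTeichmüllerPower 𝝎 χ a →
      (+ (p ℕ.∸ 1) ℤ.∣ (k ℤ.+ + a) → MaxCong (ι (fromℤ (p ^⁺ (vₚ p k +⁺ 1))))) ×
      (¬ (+ (p ℕ.∸ 1) ℤ.∣ (k ℤ.+ + a)) → MaxCong 1#))
  case-I N≡ =
    (let a , a≤ , χₚω≈ = restricts-to-some in a , a≤ , restricts⇒TeichmüllerPower v≤1 {a} χₚω≈) ,
    λ a _ χ≈ωᵃ → let χₚω≈ = TeichmüllerPower⇒restricts v≤1 (subst (p ℕ.^ v ℕ.* N′ ℕ.∣_) (≡.sym q≡p) N∣p)
                       {a} χ≈ωᵃ in
      (λ ∣k+a → unramified v≤1 χ′≈1 {a} χₚω≈ (power-trivial (k ℤ.+ + a) ∣k+a)) ,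
      not-dividing {a} χₚω≈
    where
    N∣p : p ℕ.^ v ℕ.* N′ ℕ.∣ p
    N∣p = ≡1⊎≡⇒∣ N≡
    small : N′ ≡ 1 × v ℕ.≤ 1
    small = small-conductor (subst (p ℕ.^ v ℕ.* N′ ℕ.∣_) (≡.sym p¹≡p) N∣p)
    v≤1 = proj₂ small
    open TrivialAwayFromP (proj₁ small)

  module _ (χₚ-primitive : Primitive χₚ) where
    case-III : (N′≡1 : N′ ≡ 1) → p ℕ.< p ℕ.^ v →
      let restrictsTo = RestrictsToTeichmüllerPower v (conductor-prime-power N′≡1) 𝝎 χ in
      (∃[ a ] restrictsTo a) ×
      (∀ ζ → PrimitiveRoot C (p ℕ.^ (v ℕ.∸ 1)) ζ →
        _≐_ C R (ℤₚ[_] C (_≈ ζ)) ×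
        (∀ a → restrictsTo a →
          (+ (p ℕ.∸ 1) ℤ.∣ (k ℤ.+ + a) → MaxCong (1# - ζ)) ×
          (¬ (+ (p ℕ.∸ 1) ℤ.∣ (k ℤ.+ + a)) → MaxCong 1#)))
    case-III N′≡1 p<pᵛ =
      (let a , _ , χₚω≈ = restricts-to-some in a , restricts-χₚ⇒χ D {a} χₚω≈) ,
      λ ζ ζ-primitive →
        -- The ring equality holds before any a is given; its proof takes the exponent found here.
        let a₀ , _ , χₚω≈₀ = restricts-to-some
            ring , maxCong-1-ζ = ramified-case (v ℕ.∸ 1) 0 (ℕ.⊔-identityʳ (v ℕ.∸ 1)) v-1≢0 χₚ-primitive
                χ′-exponent ζ ζ-primitive
        in ring {a₀} χₚω≈₀ , λ a χω≈ → dichotomy {ζ} (λ {a} → maxCong-1-ζ {a}) {a}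
            (restricts-χ⇒χₚ D {a} χω≈)
      where
      open TrivialAwayFromP N′≡1
      D = conductor-prime-power N′≡1
      v-1≢0 : v ℕ.∸ 1 ≢ 0
      v-1≢0 v-1≡0 = ℕ.<⇒≱ p<pᵛ (subst (p ℕ.^ v ℕ.≤_) p¹≡p (ℕ.^-monoʳ-≤ p {v} {1} (ℕ.m∸n≡0⇒m≤n v-1≡0)))

    case-VI : ∀ v′ → HasCardinality C (Im χ′) (p ℕ.^ v′) → 1 ℕ.< p ℕ.^ v′ →
      (∃[ a ] RestrictsTo a) ×
      (∀ ζ → PrimitiveRoot C (p ℕ.^ ((v ℕ.∸ 1) ℕ.⊔ v′)) ζ →
        _≐_ C R (ℤₚ[_] C (_≈ ζ)) ×
        (∀ a → RestrictsTo a →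
          (+ (p ℕ.∸ 1) ℤ.∣ (k ℤ.+ + a) → MaxCong (1# - ζ)) ×
          (¬ (+ (p ℕ.∸ 1) ℤ.∣ (k ℤ.+ + a)) → MaxCong 1#)))
    case-VI v′ B 1<pᵛ′ =
      (let a , _ , χₚω≈ = restricts-to-some in a , χₚω≈) ,
      λ ζ ζ-primitive →
        let a₀ , _ , χₚω≈₀ = restricts-to-some
            ring , maxCong-1-ζ = ramified-case ((v ℕ.∸ 1) ℕ.⊔ v′) v′ refl M≢0 χₚ-primitive
                (cardinality⇒exponent v′ (values χ′ B)) ζ ζ-primitive
        in ring {a₀} χₚω≈₀ , λ a χₚω≈ → dichotomy {ζ} (λ {a} → maxCong-1-ζ {a}) {a} χₚω≈
      where
      M≢0 : (v ℕ.∸ 1) ℕ.⊔ v′ ≢ 0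
      M≢0 M≡0 = ℕ.<⇒≢ 1<pᵛ′ (≡.sym (cong (p ℕ.^_) (ℕ.n≤0⇒n≡0 (subst (v′ ℕ.≤_) M≡0 (ℕ.m≤n⊔m (v ℕ.∸ 1) v′)))))

module PrimeTwo (C : ℂₚ 2) (𝝎 : Teichmüller 2)
  (v N′ : ℕ) (2∤N′ : ¬ 2 ℕ.∣ N′) (χ : Character C (2 ℕ.^ v ℕ.* N′))
  (χₚ : Character C (2 ℕ.^ v)) (χ′ : Character C N′) (χ≈χₚχ′ : IsProduct χ χₚ χ′) (k : ℤ) where
  open ℂₚ C hiding (zero) renaming (refl to ≈-refl)
  open Field C
  open OneUnits C
  open Characters C
  open UnitPowers commRing
  open TeichmüllerCharacter C 𝝎
  open TwoTeichmüller C 𝝎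
  open TotallyRamifiedAtTwo C
  open Congruence ℕ.prime[2] C 𝝎 1 refl ℕ.≤-refl (two-gains refl)
  open Product v N′ 2∤N′ χ χₚ χ′ χ≈χₚχ′ k public

  restricts-to-some : ∃[ a ] (a ℕ.≤ 1 × RestrictsTo a)
  restricts-to-some = let e , e≤1 , χₚω≈ = character⇒power (restriction {v} χₚ) in e , e≤1 , restricts e
                            χₚω≈

  case-II : HasParity χ k → (2 ℕ.^ v ℕ.* N′ ≡ 1 ⊎ 2 ℕ.^ v ℕ.* N′ ≡ 4) →
    (∃[ a ] (a ℕ.≤ 1 × IsTeichmüllerPower 𝝎 χ a)) ×
    (∀ a → a ℕ.≤ 1 → IsTeichmüllerPower 𝝎 χ a →
      (+ 2 ℤ.∣ (k ℤ.+ + a) → MaxCong (ι (fromℤ (2 ^⁺ (vₚ 2 k +⁺ 2))))) ×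
      (¬ (+ 2 ℤ.∣ (k ℤ.+ + a)) → MaxCong (ι (fromℤ (+ 2)))))
  case-II parity N≡ =
    (let a , a≤1 , χₚω≈ = restricts-to-some in a , a≤1 , restricts⇒TeichmüllerPower v≤2 {a} χₚω≈) ,
    λ a _ χ≈ωᵃ →
      (λ 2∣k+a → unramified v≤2 χ′≈1 {a} (TeichmüllerPower⇒restricts v≤2 N∣4 {a} χ≈ωᵃ)
          (power-trivial (k ℤ.+ + a) 2∣k+a)) ,
      -- Evaluated at -1, the parity condition makes k + a even, so an odd sum is contradictory.
      (λ 2∤k+a → contradiction
        (even-from-parity k a (trans parity (trans (χ≈ωᵃ -1ᵘ -1₄ refl) (ι-^ᵘ (ω -1₄) (+ a))))) 2∤k+a)
    where
    N∣4 : 2 ℕ.^ v ℕ.* N′ ℕ.∣ 4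
    N∣4 = ≡1⊎≡⇒∣ N≡
    small : N′ ≡ 1 × v ℕ.≤ 2
    small = small-conductor N∣4
    v≤2 = proj₂ small
    open TrivialAwayFromP (proj₁ small)

  module _ (χₚ-primitive : Primitive χₚ) where
    case-IV : (N′≡1 : N′ ≡ 1) → 4 ℕ.< 2 ℕ.^ v →
      let restrictsTo = RestrictsToTeichmüllerPower v (conductor-prime-power N′≡1) 𝝎 χ in
      (∃[ a ] restrictsTo a) ×
      (∀ ζ → PrimitiveRoot C (2 ℕ.^ (v ℕ.∸ 2)) ζ →
        _≐_ C R (ℤₚ[_] C (_≈ ζ)) × (∀ a → restrictsTo a → MaxCong (1# - ζ)))
    case-IV N′≡1 4<2ᵛ =
      (let a , _ , χₚω≈ = restricts-to-some in a , restricts-χₚ⇒χ D {a} χₚω≈) ,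
      λ ζ ζ-primitive →
        let a₀ , _ , χₚω≈₀ = restricts-to-some
            ring , maxCong-1-ζ = ramified-case (v ℕ.∸ 2) 0 (ℕ.⊔-identityʳ (v ℕ.∸ 2)) v-2≢0 χₚ-primitive
                χ′-exponent ζ ζ-primitive
        in ring {a₀} χₚω≈₀ , λ a χω≈ → maxCong-1-ζ {a} (restricts-χ⇒χₚ D {a} χω≈)
            (power≡1-mod-2 (k ℤ.+ + a))
      where
      open TrivialAwayFromP N′≡1
      D = conductor-prime-power N′≡1
      v-2≢0 : v ℕ.∸ 2 ≢ 0
      v-2≢0 v-2≡0 = ℕ.<⇒≱ 4<2ᵛ (ℕ.^-monoʳ-≤ 2 {v} {2} (ℕ.m∸n≡0⇒m≤n v-2≡0))

    case-VII : Primitive χ′ → N′ ≢ 1 → TotallyRamified C (Im χ′) →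
      (∃[ v′ ] (1 ℕ.≤ v′ × GeneratedByRoot χ′ v′)) ×
      (∃[ a ] RestrictsTo a) ×
      (∀ v′ → 1 ℕ.≤ v′ → GeneratedByRoot χ′ v′ → ∀ ζ → PrimitiveRoot C (2 ℕ.^ (v′ ℕ.⊔ (v ℕ.∸ 2))) ζ →
        _≐_ C R (ℤₚ[_] C (_≈ ζ)) × (∀ a → RestrictsTo a → MaxCong (1# - ζ)))
    case-VII χ′-primitive N′≢1 χ′-ramified =
      exponent⇒generated χ′ χ′-primitive N′≢1 (totallyRamified⇒exponent χ′ χ′-ramified) ,
      (let a , _ , χₚω≈ = restricts-to-some in a , χₚω≈) ,
      λ v′ 1≤v′ generated ζ ζ-primitive →
        let a₀ , _ , χₚω≈₀ = restricts-to-some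
            ring , maxCong-1-ζ = ramified-case (v′ ℕ.⊔ (v ℕ.∸ 2)) v′ (ℕ.⊔-comm (v ℕ.∸ 2) v′)
              (λ M≡0 → ℕ.<⇒≢ (ℕ.≤-trans 1≤v′ (ℕ.m≤m⊔n v′ (v ℕ.∸ 2))) (≡.sym M≡0))
              χₚ-primitive (generated⇒exponent χ′ v′ generated) ζ ζ-primitive
        in ring {a₀} χₚω≈₀ , λ a χₚω≈ → maxCong-1-ζ {a} χₚω≈ (power≡1-mod-2 (k ℤ.+ + a))
      where
      instance
        N′-nonZero : ℕ.NonZero N′
        N′-nonZero = ℕ.≢-nonZero λ N′≡0 → 2∤N′ (subst (2 ℕ.∣_) (≡.sym N′≡0) (2 ℕ.∣0))

open import Data.Nat using (ℕ; _^_; _*_; _∸_; _⊔_; _≤_; _<_)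
open import Data.Nat.Divisibility using (_∣_; ∣-refl)
open import Data.Nat.Primality using (Prime)
open import Data.Integer using (ℤ; +_) renaming (_+_ to _+ℤ_)
open import Data.Integer.Divisibility.Signed using () renaming (_∣_ to _∣ℤ_)
open import Data.Product using (_×_; ∃-syntax)
open import Data.Sum using (_⊎_)
open import Relation.Nullary using (¬_)
open import Relation.Binary.PropositionalEquality using (_≡_; _≢_)

mainTheorem10 :
  (p : ℕ) → Prime p → (C : ℂₚ p) → (𝝎 : Teichmüller p) →
  (v N' : ℕ) → ¬ p ∣ N' →
  (χ : Character C (p ^ v * N')) → Primitive χ →
  (χₚ : Character C (p ^ v)) → Primitive χₚ →
  (χ' : Character C N') → Primitive χ' →
  IsProduct χ χₚ χ' →
  (k : ℤ) → HasParity χ k →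
  let Carrier = ℂₚ.Carrier C
      _≈_ = ℂₚ._≈_ C
      1# = ℂₚ.1# C
      _-_ = ℂₚ._-_ C
      ι = ℂₚ.ι C
      ℤₚ[χ] : Carrier → Set
      ℤₚ[χ] = ℤₚ[_] C (Im χ)
      ℤₚ[ζ=_] : Carrier → Carrier → Set
      ℤₚ[ζ= ζ ] = ℤₚ[_] C (_≈ ζ)
      MaxCong = λ α → IsMaximalCongruence v ℤₚ[χ] χₚ χ' k (Principal C ℤₚ[χ] α)
  in
  -- I
  ( 2 < p → (p ^ v * N' ≡ 1 ⊎ p ^ v * N' ≡ p) →
    (∃[ a ] (a ≤ p ∸ 2 × IsTeichmüllerPower 𝝎 χ a)) ×
    (∀ a → a ≤ p ∸ 2 → IsTeichmüllerPower 𝝎 χ a →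
      (+ (p ∸ 1) ∣ℤ (k +ℤ + a) → MaxCong (ι (fromℤ (p ^⁺ (vₚ p k +⁺ 1))))) ×
      (¬ (+ (p ∸ 1) ∣ℤ (k +ℤ + a)) → MaxCong 1#)) ) ×
  -- II
  ( p ≡ 2 → (p ^ v * N' ≡ 1 ⊎ p ^ v * N' ≡ 4) →
    (∃[ a ] (a ≤ 1 × IsTeichmüllerPower 𝝎 χ a)) ×
    (∀ a → a ≤ 1 → IsTeichmüllerPower 𝝎 χ a →
      (+ 2 ∣ℤ (k +ℤ + a) → MaxCong (ι (fromℤ (2 ^⁺ (vₚ 2 k +⁺ 2))))) ×
      (¬ (+ 2 ∣ℤ (k +ℤ + a)) → MaxCong (ι (fromℤ (+ 2))))) ) ×
  -- III
  ( 2 < p → (N'≡1 : N' ≡ 1) → p < p ^ v →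
    let restrictsTo = RestrictsToTeichmüllerPower v (conductor-prime-power N'≡1) 𝝎 χ
    in
    (∃[ a ] restrictsTo a) ×
    (∀ ζ → PrimitiveRoot C (p ^ (v ∸ 1)) ζ →
      _≐_ C ℤₚ[χ] ℤₚ[ζ= ζ ] ×
      (∀ a → restrictsTo a →
        (+ (p ∸ 1) ∣ℤ (k +ℤ + a) → MaxCong (1# - ζ)) ×
        (¬ (+ (p ∸ 1) ∣ℤ (k +ℤ + a)) → MaxCong 1#))) ) ×
  -- IV
  ( p ≡ 2 → (N'≡1 : N' ≡ 1) → 4 < p ^ v →
    let restrictsTo = RestrictsToTeichmüllerPower v (conductor-prime-power N'≡1) 𝝎 χ
    in
    (∃[ a ] restrictsTo a) ×
    (∀ ζ → PrimitiveRoot C (2 ^ (v ∸ 2)) ζ →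
      _≐_ C ℤₚ[χ] ℤₚ[ζ= ζ ] ×
      (∀ a → restrictsTo a → MaxCong (1# - ζ))) ) ×
  -- V
  ( N' ≢ 1 → ∀ m → HasCardinality C (Im χ') m → ¬ (∃[ e ] m ≡ p ^ e) →
    MaxCong 1# ) ×
  -- VI
  ( 2 < p → N' ≢ 1 → ∀ v' → HasCardinality C (Im χ') (p ^ v') → 1 < p ^ v' →
    let restrictsTo = RestrictsToTeichmüllerPower v ∣-refl 𝝎 χₚ
    in
    (∃[ a ] restrictsTo a) ×
    (∀ ζ → PrimitiveRoot C (p ^ ((v ∸ 1) ⊔ v')) ζ →
      _≐_ C ℤₚ[χ] ℤₚ[ζ= ζ ] ×
      (∀ a → restrictsTo a →
        (+ (p ∸ 1) ∣ℤ (k +ℤ + a) → MaxCong (1# - ζ)) ×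
        (¬ (+ (p ∸ 1) ∣ℤ (k +ℤ + a)) → MaxCong 1#))) ) ×
  -- VII
  ( p ≡ 2 → N' ≢ 1 → TotallyRamified C (Im χ') →
    let restrictsTo = RestrictsToTeichmüllerPower v ∣-refl 𝝎 χₚ
        imGeneratedBy-ζ₂ = λ v' → ∃[ ζ ] (PrimitiveRoot C (2 ^ v') ζ × Generates C ζ (Im χ'))
    in
    (∃[ v' ] (1 ≤ v' × imGeneratedBy-ζ₂ v')) ×
    (∃[ a ] restrictsTo a) ×
    (∀ v' → 1 ≤ v' → imGeneratedBy-ζ₂ v' →
      ∀ ζ → PrimitiveRoot C (2 ^ (v' ⊔ (v ∸ 2))) ζ →
        _≐_ C ℤₚ[χ] ℤₚ[ζ= ζ ] ×
        (∀ a → restrictsTo a → MaxCong (1# - ζ))) )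
mainTheorem10 p p-prime C 𝝎 v N' p∤N' χ _ χₚ χₚ-primitive χ' χ'-primitive χ≈χₚχ' k parity =
  (λ 2<p → OddPrime.case-I p-prime 2<p C 𝝎 v N' p∤N' χ χₚ χ' χ≈χₚχ' k) ,
  (λ { refl → PrimeTwo.case-II C 𝝎 v N' p∤N' χ χₚ χ' χ≈χₚχ' k parity }) ,
  (λ 2<p → OddPrime.case-III p-prime 2<p C 𝝎 v N' p∤N' χ χₚ χ' χ≈χₚχ' k χₚ-primitive) ,
  (λ { refl → PrimeTwo.case-IV C 𝝎 v N' p∤N' χ χₚ χ' χ≈χₚχ' k χₚ-primitive }) ,
  (λ _ m cardinality m≢pᵉ → case-V (ℕ.m≤n⇒m<n∨m≡n (prime>1 p-prime)) m cardinality m≢pᵉ) ,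
  (λ 2<p _ → OddPrime.case-VI p-prime 2<p C 𝝎 v N' p∤N' χ χₚ χ' χ≈χₚχ' k χₚ-primitive) ,
  (λ { refl → PrimeTwo.case-VII C 𝝎 v N' p∤N' χ χₚ χ' χ≈χₚχ' k χₚ-primitive χ'-primitive })
  where
  -- The counting argument is uniform in p. The split only chooses q, and with it the instance of
  -- `GainsOneFactor` under which the argument was set up.
  case-V : 2 < p ⊎ 2 ≡ p → ∀ m → HasCardinality C (Im χ') m → ¬ (∃[ e ] m ≡ p ^ e) →
    IsMaximalCongruence v (ℤₚ[_] C (Im χ)) χₚ χ' k (Principal C (ℤₚ[_] C (Im χ)) (ℂₚ.1# C))
  case-V (inj₁ 2<p)  m cardinality =
    OddPrime.cardinality⇒maxCong-1 p-prime 2<p C 𝝎 v N' p∤N' χ χₚ χ' χ≈χₚχ' k m (Characters.values C χ' cardinality)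
  case-V (inj₂ refl) m cardinality =
    PrimeTwo.cardinality⇒maxCong-1 C 𝝎 v N' p∤N' χ χₚ χ' χ≈χₚχ' k m (Characters.values C χ' cardinality)
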